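{- Let $\Phi$ be an indecomposable root system of rank $>1$, $R$ an algebraically closed field, and $G_\pi(\Phi,R)$ the corresponding Chevalley group. If $A$ is a computable subfield of $R$, then the Diophantine problem in $G_\pi(\Phi,R)$ with constants from $G_\pi(\Phi,A)$ is decidable (under a proper enumeration of $G_\pi(\Phi,A)$).
   Context: A countable structure $\mathcal A$ of finite signature is computable with respect to an enumeration (surjective map) $\nu:\mathbb N\to\mathcal A$ if all basic operations and predicates of $\mathcal A$, including equality, are computable with respect to $\nu$; it is computable if it has such an enumeration. A computable subfield is a subfield that is a computable structure. A proper enumeration of $G_\pi(\Phi,A)$ is one arising from an enumeration making $A$ computable, by representing elements of $G_\pi(\Phi,A)$ as matrices over $A$. Root systems are reduced. Let $\pi$ be a faithful finite-dimensional representation of the complex semisimple Lie algebra with root system $\Phi$, with weight lattice $\Lambda_\pi$. $G_\pi(\Phi,K)$ denotes the Chevalley group of type $(\Phi,\Lambda_\pi)$ over a commutative ring $K$ with $1$, i.e. the group of $K$-points of the Chevalley--Demazure group scheme, realized as the subgroup of $\mathrm{SL}_n(K)$, $n=\dim\pi$, given by polynomial equations with integer coefficients in the matrix entries; thus $G_\pi(\Phi,A)\leqslant G_\pi(\Phi,R)$. The Diophantine problem in a group $G$ with constants from an enumerated countable subset $C$ is decidable if there is an algorithm which, given a finite system of group equations with coefficients in $C$ (presented through the enumeration), decides whether the system has a solution in $G$. -}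

module Defs where

open import Algebra.Bundles using (CommutativeRing; Group)
open import Algebra.Module.Bundles using (LeftModule)
open import Data.Fin.Base using (Fin; zero; suc; toℕ; fromℕ)
open import Data.Fin.Subset using (Subset; _∈_; _∉_)
open import Data.Integer.Base as ℤ using (ℤ)
open import Data.List.Base using (List; []; _∷_)
open import Data.List.Relation.Unary.All using (All)
open import Data.Nat.Base as ℕ using (ℕ; zero; suc; _!)
import Data.Nat.Properties as ℕ
open import Data.Product.Base using (∃; ∃-syntax; _×_; _,_; proj₁; proj₂)
open import Data.Rational.Base as ℚ using (ℚ; 0ℚ; 1ℚ; ½; ∣_∣)
import Data.Rational.Properties as ℚ
open import Data.Sum.Base using (_⊎_)
open import Data.Vec.Base using (Vec; []; _∷_; lookup)
open import Function.Base using (flip)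
open import Level using (0ℓ; _⊔_)
open import Relation.Binary.PropositionalEquality using (_≡_; _≗_)
open import Relation.Nullary using (¬_)
open import Relation.Unary using (Pred)

import Algebra.Properties.CommutativeMonoid.Sum as CommutativeMonoidSum
import Algebra.Properties.CommutativeSemigroup as CommutativeSemigroupProperties
import Algebra.Properties.Ring as RingProperties
import Algebra.Properties.Semiring.Exp as SemiringExp
import Algebra.Properties.Semiring.Sum as SemiringSum
import Algebra.Solver.Ring.NaturalCoefficients.Default as SemiringSolver
import Relation.Binary.Reasoning.Setoid as SetoidReasoning

------------------------------------------------------------------------
-- Real and complex numbers

module Real where

  open import Relation.Binary.PropositionalEquality
    using (refl; sym; trans; cong; cong₂; subst)

  -- f(m, n) → 0 as m, n → ∞ independently.
  Small : (ℕ → ℕ → ℚ) → Set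
  Small f = ∀ ε → 0ℚ ℚ.< ε →
    ∃[ N ] (∀ m n → N ℕ.≤ m → N ℕ.≤ n → ∣ f m n ∣ ℚ.< ε)

  Bounded : (ℕ → ℕ → ℚ) → Set
  Bounded f = ∃[ B ] (0ℚ ℚ.< B) ×
    (∃[ N ] (∀ m n → N ℕ.≤ m → N ℕ.≤ n → ∣ f m n ∣ ℚ.≤ B))

  record ℝ : Set where
    constructor mkℝ
    field
      seq    : ℕ → ℚ
      cauchy : Small (λ m n → seq m ℚ.- seq n)
  open ℝ public

  -- For Cauchy sequences this is equivalent to seq x n - seq y n → 0.
  infix 4 _≈_
  _≈_ : ℝ → ℝ → Set
  x ≈ y = Small (λ m n → seq x m ℚ.- seq y n)

  private
    variable
      f g b : ℕ → ℕ → ℚ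

    module ℚ-Ring = RingProperties (CommutativeRing.ring ℚ.+-*-commutativeRing)

    cancel : ∀ p q → (p ℚ.- q) ℚ.+ q ≡ p
    cancel p q = trans (ℚ.+-assoc p (ℚ.- q) q)
      (trans (cong (p ℚ.+_) (ℚ.+-inverseˡ q)) (ℚ.+-identityʳ p))

    telescope : ∀ p q r → (p ℚ.- q) ℚ.+ (q ℚ.- r) ≡ p ℚ.- r
    telescope p q r = trans (sym (ℚ.+-assoc (p ℚ.- q) q (ℚ.- r)))
      (cong (ℚ._- r) (cancel p q))

    neg-diff : ∀ p q → ℚ.- (p ℚ.- q) ≡ q ℚ.- p
    neg-diff p q = trans (ℚ.neg-distrib-+ p (ℚ.- q))
      (trans (ℚ.+-comm (ℚ.- p) (ℚ.- (ℚ.- q)))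
        (cong (ℚ._- p) (ℚ-Ring.-‿involutive q)))

    +-diff : ∀ p p′ q q′ → (p ℚ.- p′) ℚ.+ (q ℚ.- q′) ≡ (p ℚ.+ q) ℚ.- (p′ ℚ.+ q′)
    +-diff p p′ q q′ = trans (interchange p (ℚ.- p′) q (ℚ.- q′))
      (cong ((p ℚ.+ q) ℚ.+_) (sym (ℚ.neg-distrib-+ p′ q′)))
      where
      open CommutativeSemigroupProperties
        (CommutativeRing.+-commutativeSemigroup ℚ.+-*-commutativeRing) using (interchange)

    *-diff : ∀ p p′ q q′ →
      p ℚ.* (q ℚ.- q′) ℚ.+ q′ ℚ.* (p ℚ.- p′) ≡ (p ℚ.* q) ℚ.- (p′ ℚ.* q′)
    *-diff p p′ q q′ = trans
      (cong₂ ℚ._+_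
        (ℚ-Ring.x[y-z]≈xy-xz p q q′)
        (trans (ℚ-Ring.x[y-z]≈xy-xz q′ p p′)
          (cong₂ ℚ._-_ (ℚ.*-comm q′ p) (ℚ.*-comm q′ p′))))
      (telescope (p ℚ.* q) (p ℚ.* q′) (p′ ℚ.* q′))

    small-resp : (∀ m n → f m n ≡ g m n) → Small f → Small g
    small-resp f≡g F ε ε>0 with F ε ε>0
    ... | N , p = N , λ m n N≤m N≤n → subst (λ q → ∣ q ∣ ℚ.< ε) (f≡g m n) (p m n N≤m N≤n)

    small-0 : (∀ m n → f m n ≡ 0ℚ) → Small f
    small-0 f≡0 ε ε>0 = 0 , λ m n _ _ → subst (λ q → ∣ q ∣ ℚ.< ε) (sym (f≡0 m n)) ε>0

    small-flip : Small f → Small (flip f)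
    small-flip F ε ε>0 with F ε ε>0
    ... | N , p = N , λ m n N≤m N≤n → p n m N≤n N≤m

    small-diag : Small f → Small (λ m _ → f m m)
    small-diag F ε ε>0 with F ε ε>0
    ... | N , p = N , λ m _ N≤m _ → p m m N≤m N≤m

    small-neg : Small f → Small (λ m n → ℚ.- f m n)
    small-neg {f} F ε ε>0 with F ε ε>0
    ... | N , p = N , λ m n N≤m N≤n →
      subst (ℚ._< ε) (sym (ℚ.∣-p∣≡∣p∣ (f m n))) (p m n N≤m N≤n)

    half-positive : ∀ {ε} → 0ℚ ℚ.< ε → 0ℚ ℚ.< ½ ℚ.* ε
    half-positive {ε} ε>0 =
      subst (ℚ._< ½ ℚ.* ε) (ℚ.*-zeroʳ ½) (ℚ.*-monoʳ-<-pos ½ ε>0)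

    halves : ∀ ε → ½ ℚ.* ε ℚ.+ ½ ℚ.* ε ≡ ε
    halves ε = trans (sym (ℚ.*-distribʳ-+ ε ½ ½))
      (trans (cong (ℚ._* ε) {½ ℚ.+ ½} {1ℚ} refl) (ℚ.*-identityˡ ε))

    small-+ : Small f → Small g → Small (λ m n → f m n ℚ.+ g m n)
    small-+ {f} {g} F G ε ε>0
      with F (½ ℚ.* ε) (half-positive ε>0) | G (½ ℚ.* ε) (half-positive ε>0)
    ... | N , p | M , q = N ℕ.⊔ M , λ m n ≤m ≤n →
      ℚ.≤-<-trans (ℚ.∣p+q∣≤∣p∣+∣q∣ (f m n) (g m n))
        (subst (∣ f m n ∣ ℚ.+ ∣ g m n ∣ ℚ.<_) (halves ε)
          (ℚ.+-mono-<
            (p m n (ℕ.≤-trans (ℕ.m≤m⊔n N M) ≤m) (ℕ.≤-trans (ℕ.m≤m⊔n N M) ≤n))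
            (q m n (ℕ.≤-trans (ℕ.m≤n⊔m N M) ≤m) (ℕ.≤-trans (ℕ.m≤n⊔m N M) ≤n))))

    small-* : Bounded b → Small f → Small (λ m n → b m n ℚ.* f m n)
    small-* {b} {f} (B , B>0 , M , bound) F ε ε>0 = N ℕ.⊔ M , λ m n ≤m ≤n →
      let
        instance _ = ℚ.nonNegative (ℚ.0≤∣p∣ (f m n))
        N≤ : ∀ {k} → N ℕ.⊔ M ℕ.≤ k → N ℕ.≤ k
        N≤ = ℕ.≤-trans (ℕ.m≤m⊔n N M)
        M≤ : ∀ {k} → N ℕ.⊔ M ℕ.≤ k → M ℕ.≤ k
        M≤ = ℕ.≤-trans (ℕ.m≤n⊔m N M)
      in
      subst (ℚ._< ε) (sym (ℚ.∣p*q∣≡∣p∣*∣q∣ (b m n) (f m n)))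
        (ℚ.≤-<-trans (ℚ.*-monoʳ-≤-nonNeg ∣ f m n ∣ (bound m n (M≤ ≤m) (M≤ ≤n)))
          (subst (B ℚ.* ∣ f m n ∣ ℚ.<_) Bδ≡ε
            (ℚ.*-monoʳ-<-pos B (proj₂ (F δ δ>0) m n (N≤ ≤m) (N≤ ≤n)))))
      where
      instance
        _ = ℚ.positive B>0
        _ = ℚ.pos⇒nonZero B
        _ = ℚ.1/pos⇒pos B
      δ = ℚ.1/ B ℚ.* ε
      δ>0 : 0ℚ ℚ.< δ
      δ>0 = subst (ℚ._< δ) (ℚ.*-zeroʳ (ℚ.1/ B)) (ℚ.*-monoʳ-<-pos (ℚ.1/ B) ε>0)
      N = proj₁ (F δ δ>0)
      Bδ≡ε : B ℚ.* δ ≡ ε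
      Bδ≡ε = trans (sym (ℚ.*-assoc B (ℚ.1/ B) ε))
        (trans (cong (ℚ._* ε) (ℚ.*-inverseʳ B)) (ℚ.*-identityˡ ε))

    bounded : ∀ x → ∃[ B ] (0ℚ ℚ.< B) × (∃[ N ] (∀ n → N ℕ.≤ n → ∣ seq x n ∣ ℚ.≤ B))
    bounded x with cauchy x 1ℚ (ℚ.positive⁻¹ 1ℚ)
    ... | N , p = B , B>0 , N , bound
      where
      c = seq x N
      B = 1ℚ ℚ.+ ∣ c ∣
      B>0 : 0ℚ ℚ.< B
      B>0 = ℚ.+-mono-<-≤ (ℚ.positive⁻¹ 1ℚ) (ℚ.0≤∣p∣ c)
      bound : ∀ n → N ℕ.≤ n → ∣ seq x n ∣ ℚ.≤ B
      bound n N≤n = subst (λ q → ∣ q ∣ ℚ.≤ B)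
        (cancel (seq x n) c)
        (ℚ.≤-trans (ℚ.∣p+q∣≤∣p∣+∣q∣ (seq x n ℚ.- c) c)
          (ℚ.+-monoˡ-≤ ∣ c ∣ (ℚ.<⇒≤ (p n N N≤n ℕ.≤-refl))))

    boundedˡ : ∀ x → Bounded (λ m _ → seq x m)
    boundedˡ x with bounded x
    ... | B , B>0 , N , p = B , B>0 , N , λ m _ N≤m _ → p m N≤m

    boundedʳ : ∀ x → Bounded (λ _ n → seq x n)
    boundedʳ x with bounded x
    ... | B , B>0 , N , p = B , B>0 , N , λ _ n _ N≤n → p n N≤n

    pointwise : ∀ {x y} → (∀ n → seq x n ≡ seq y n) → x ≈ y
    pointwise {x} {y} eq = small-resp (λ m n → cong (λ q → seq x m ℚ.- q) (eq n)) (cauchy x)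

    +-small : ∀ x₁ x₂ y₁ y₂ → x₁ ≈ x₂ → y₁ ≈ y₂ →
      Small (λ m n → (seq x₁ m ℚ.+ seq y₁ m) ℚ.- (seq x₂ n ℚ.+ seq y₂ n))
    +-small x₁ x₂ y₁ y₂ p q = small-resp
      (λ m n → +-diff (seq x₁ m) (seq x₂ n) (seq y₁ m) (seq y₂ n))
      (small-+ p q)

    *-small : ∀ x₁ x₂ y₁ y₂ → x₁ ≈ x₂ → y₁ ≈ y₂ →
      Small (λ m n → (seq x₁ m ℚ.* seq y₁ m) ℚ.- (seq x₂ n ℚ.* seq y₂ n))
    *-small x₁ x₂ y₁ y₂ p q = small-resp
      (λ m n → *-diff (seq x₁ m) (seq x₂ n) (seq y₁ m) (seq y₂ n))
      (small-+ (small-* (boundedˡ x₁) q) (small-* (boundedʳ y₂) p))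

    neg-small : ∀ x y → x ≈ y → Small (λ m n → (ℚ.- seq x m) ℚ.- (ℚ.- seq y n))
    neg-small x y p = small-resp
      (λ m n → ℚ.neg-distrib-+ (seq x m) (ℚ.- seq y n))
      (small-neg p)

  infixl 6 _+_
  infixl 7 _*_
  infix 8 -_

  _+_ : ℝ → ℝ → ℝ
  x + y = mkℝ (λ n → seq x n ℚ.+ seq y n) (+-small x x y y (cauchy x) (cauchy y))

  _*_ : ℝ → ℝ → ℝ
  x * y = mkℝ (λ n → seq x n ℚ.* seq y n) (*-small x x y y (cauchy x) (cauchy y))

  -_ : ℝ → ℝ
  - x = mkℝ (λ n → ℚ.- seq x n) (neg-small x x (cauchy x))

  fromℚ : ℚ → ℝ
  fromℚ q = mkℝ (λ _ → q) (small-0 (λ _ _ → ℚ.+-inverseʳ q))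

  private
    ≈-sym : ∀ {x y} → x ≈ y → y ≈ x
    ≈-sym {x} {y} p = small-resp
      (λ m n → neg-diff (seq x n) (seq y m))
      (small-neg (small-flip p))

    ≈-trans : ∀ {x y z} → x ≈ y → y ≈ z → x ≈ z
    ≈-trans {x} {y} {z} p q = small-resp
      (λ m n → telescope (seq x m) (seq y m) (seq z n))
      (small-+ (small-diag p) q)

  ℝ-commutativeRing : CommutativeRing 0ℓ 0ℓ
  ℝ-commutativeRing = record
    { Carrier = ℝ ; _≈_ = _≈_ ; _+_ = _+_ ; _*_ = _*_ ; -_ = -_
    ; 0# = fromℚ 0ℚ ; 1# = fromℚ 1ℚ
    ; isCommutativeRing = record
      { isRing = record
        { +-isAbelianGroup = record
          { isGroup = record
            { isMonoid = record
              { isSemigroup = record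
                { isMagma = record
                  { isEquivalence = record
                    { refl  = λ {x} → cauchy x
                    ; sym   = λ {x} {y} → ≈-sym {x} {y}
                    ; trans = λ {x} {y} {z} → ≈-trans {x} {y} {z}
                    }
                  ; ∙-cong = λ {x₁} {x₂} {y₁} {y₂} → +-small x₁ x₂ y₁ y₂
                  }
                ; assoc = λ x y z → pointwise {(x + y) + z} {x + (y + z)}
                    (λ n → ℚ.+-assoc (seq x n) (seq y n) (seq z n))
                }
              ; identity =
                  (λ x → pointwise {fromℚ 0ℚ + x} {x} (λ n → ℚ.+-identityˡ (seq x n)))
                , (λ x → pointwise {x + fromℚ 0ℚ} {x} (λ n → ℚ.+-identityʳ (seq x n)))
              }
            ; inverse =
                (λ x → pointwise {(- x) + x} {fromℚ 0ℚ} (λ n → ℚ.+-inverseˡ (seq x n)))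
              , (λ x → pointwise {x + (- x)} {fromℚ 0ℚ} (λ n → ℚ.+-inverseʳ (seq x n)))
            ; ⁻¹-cong = λ {x} {y} → neg-small x y
            }
          ; comm = λ x y → pointwise {x + y} {y + x} (λ n → ℚ.+-comm (seq x n) (seq y n))
          }
        ; *-cong = λ {x₁} {x₂} {y₁} {y₂} → *-small x₁ x₂ y₁ y₂
        ; *-assoc = λ x y z → pointwise {(x * y) * z} {x * (y * z)}
            (λ n → ℚ.*-assoc (seq x n) (seq y n) (seq z n))
        ; *-identity =
            (λ x → pointwise {fromℚ 1ℚ * x} {x} (λ n → ℚ.*-identityˡ (seq x n)))
          , (λ x → pointwise {x * fromℚ 1ℚ} {x} (λ n → ℚ.*-identityʳ (seq x n)))
        ; distrib =
            (λ x y z → pointwise {x * (y + z)} {(x * y) + (x * z)}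
              (λ n → ℚ.*-distribˡ-+ (seq x n) (seq y n) (seq z n)))
          , (λ x y z → pointwise {(y + z) * x} {(y * x) + (z * x)}
              (λ n → ℚ.*-distribʳ-+ (seq x n) (seq y n) (seq z n)))
        }
      ; *-comm = λ x y → pointwise {x * y} {y * x} (λ n → ℚ.*-comm (seq x n) (seq y n))
      }
    }

-- R[i] for a commutative ring R
module AdjoinI {c ℓ} (R : CommutativeRing c ℓ) where
  private
    module Identities where
      open CommutativeRing R
      open SemiringSolver commutativeSemiring using (solve; _:=_; _:+_; _:*_)

      assoc-re : ∀ k a b c d e f →
        (a * c + k * (b * d)) * e + k * ((a * d + b * c) * f) ≈
        a * (c * e + k * (d * f)) + k * (b * (c * f + d * e))
      assoc-re = solve 7 (λ k a b c d e f →
        (a :* c :+ k :* (b :* d)) :* e :+ k :* ((a :* d :+ b :* c) :* f) :=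
        a :* (c :* e :+ k :* (d :* f)) :+ k :* (b :* (c :* f :+ d :* e))) refl

      assoc-im : ∀ k a b c d e f →
        (a * c + k * (b * d)) * f + (a * d + b * c) * e ≈
        a * (c * f + d * e) + b * (c * e + k * (d * f))
      assoc-im = solve 7 (λ k a b c d e f →
        (a :* c :+ k :* (b :* d)) :* f :+ (a :* d :+ b :* c) :* e :=
        a :* (c :* f :+ d :* e) :+ b :* (c :* e :+ k :* (d :* f))) refl

      distrib-re : ∀ k a b c d e f →
        a * (c + e) + k * (b * (d + f)) ≈
        (a * c + k * (b * d)) + (a * e + k * (b * f))
      distrib-re = solve 7 (λ k a b c d e f →
        a :* (c :+ e) :+ k :* (b :* (d :+ f)) :=
        (a :* c :+ k :* (b :* d)) :+ (a :* e :+ k :* (b :* f))) refl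

      distrib-im : ∀ a b c d e f →
        a * (d + f) + b * (c + e) ≈
        (a * d + b * c) + (a * f + b * e)
      distrib-im = solve 6 (λ a b c d e f →
        a :* (d :+ f) :+ b :* (c :+ e) :=
        (a :* d :+ b :* c) :+ (a :* f :+ b :* e)) refl

      comm-re : ∀ k a b c d →
        a * c + k * (b * d) ≈
        c * a + k * (d * b)
      comm-re = solve 5 (λ k a b c d →
        a :* c :+ k :* (b :* d) :=
        c :* a :+ k :* (d :* b)) refl

      comm-im : ∀ a b c d →
        a * d + b * c ≈
        c * b + d * a
      comm-im = solve 4 (λ a b c d →
        a :* d :+ b :* c :=
        c :* b :+ d :* a) refl

  open CommutativeRing R
  private
    module R = CommutativeRing R
    C : Set c
    C = Carrier × Carrier

    _≈′_ : C → C → Set ℓ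
    (a , b) ≈′ (c , d) = (a ≈ c) × (b ≈ d)

    _+′_ _*′_ : C → C → C
    (a , b) +′ (c , d) = a + c , b + d
    (a , b) *′ (c , d) = a * c + (- 1#) * (b * d) , a * d + b * c

    one : C
    one = 1# , 0#

    *′-comm : ∀ x y → (x *′ y) ≈′ (y *′ x)
    *′-comm (a , b) (c , d) = Identities.comm-re (- 1#) a b c d , Identities.comm-im a b c d

    *′-identityˡ : ∀ x → (one *′ x) ≈′ x
    *′-identityˡ (a , b) =
      R.trans (+-cong (*-identityˡ a) (R.trans (*-congˡ (zeroˡ b)) (zeroʳ (- 1#)))) (+-identityʳ a) ,
      R.trans (+-cong (*-identityˡ b) (zeroˡ a)) (+-identityʳ b)

    ≈′-trans : ∀ {x y z} → x ≈′ y → y ≈′ z → x ≈′ z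
    ≈′-trans (p , q) (r , s) = R.trans p r , R.trans q s

    *′-distribˡ : ∀ x y z → (x *′ (y +′ z)) ≈′ ((x *′ y) +′ (x *′ z))
    *′-distribˡ (a , b) (c , d) (e , f) =
      Identities.distrib-re (- 1#) a b c d e f , Identities.distrib-im a b c d e f

    +′-cong : ∀ {x y u v} → x ≈′ y → u ≈′ v → (x +′ u) ≈′ (y +′ v)
    +′-cong (p , q) (r , s) = +-cong p r , +-cong q s

    *′-cong : ∀ {x y u v} → x ≈′ y → u ≈′ v → (x *′ u) ≈′ (y *′ v)
    *′-cong (p , q) (r , s) =
      +-cong (*-cong p r) (*-congˡ (*-cong q s)) , +-cong (*-cong p s) (*-cong q r)

  R[i]-commutativeRing : CommutativeRing c ℓ
  R[i]-commutativeRing = record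
    { Carrier = C ; _≈_ = _≈′_ ; _+_ = _+′_ ; _*_ = _*′_
    ; -_ = λ (a , b) → - a , - b
    ; 0# = 0# , 0# ; 1# = one
    ; isCommutativeRing = record
      { isRing = record
        { +-isAbelianGroup = record
          { isGroup = record
            { isMonoid = record
              { isSemigroup = record
                { isMagma = record
                  { isEquivalence = record
                    { refl  = R.refl , R.refl
                    ; sym   = λ (p , q) → R.sym p , R.sym q
                    ; trans = ≈′-trans
                    }
                  ; ∙-cong = +′-cong
                  }
                ; assoc = λ (a , b) (c , d) (e , f) → +-assoc a c e , +-assoc b d f
                }
              ; identity = (λ (a , b) → +-identityˡ a , +-identityˡ b)
                         , (λ (a , b) → +-identityʳ a , +-identityʳ b)
              }
            ; inverse = (λ (a , b) → -‿inverseˡ a , -‿inverseˡ b)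
                      , (λ (a , b) → -‿inverseʳ a , -‿inverseʳ b)
            ; ⁻¹-cong = λ (p , q) → -‿cong p , -‿cong q
            }
          ; comm = λ (a , b) (c , d) → +-comm a c , +-comm b d
          }
        ; *-cong = *′-cong
        ; *-assoc = λ (a , b) (c , d) (e , f) →
            Identities.assoc-re (- 1#) a b c d e f , Identities.assoc-im (- 1#) a b c d e f
        ; *-identity = *′-identityˡ
                     , (λ x → ≈′-trans (*′-comm x one) (*′-identityˡ x))
        ; distrib = *′-distribˡ
                  , (λ x y z → ≈′-trans (*′-comm (y +′ z) x)
                      (≈′-trans (*′-distribˡ x y z)
                        (+′-cong (*′-comm x y) (*′-comm x z))))
        }
      ; *-comm = *′-comm
      }
    }

-- Opaque only to keep Lie-algebra terms from unfolding to Cauchy sequences.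
opaque
  ℂ-commutativeRing : CommutativeRing 0ℓ 0ℓ
  ℂ-commutativeRing = AdjoinI.R[i]-commutativeRing Real.ℝ-commutativeRing

module ℂ where
  open CommutativeRing ℂ-commutativeRing public
  open SemiringExp semiring public using (_^_)

  opaque
    unfolding ℂ-commutativeRing

    fromℚ : ℚ → Carrier
    fromℚ q = Real.fromℚ q , Real.fromℚ 0ℚ

  fromℤ : ℤ → Carrier
  fromℤ z = fromℚ (z ℚ./ 1)

------------------------------------------------------------------------
-- Fields

module _ {c ℓ} (R : CommutativeRing c ℓ) where
  open CommutativeRing R
  open SemiringSum semiring using (sum-syntax)
  open SemiringExp semiring using (_^_)

  IsField : Set (c ⊔ ℓ)
  IsField = ¬ (1# ≈ 0#) × (∀ x → ¬ (x ≈ 0#) → ∃[ y ] x * y ≈ 1#)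

  -- a : Fin (2 + d) → Carrier are the coefficients of a polynomial of
  -- degree 1 + d, constant term first.
  IsAlgebraicallyClosedField : Set (c ⊔ ℓ)
  IsAlgebraicallyClosedField = IsField ×
    (∀ d (a : Fin (2 ℕ.+ d) → Carrier) → ¬ (a (fromℕ (suc d)) ≈ 0#) →
      ∃[ x ] (∑[ i < 2 ℕ.+ d ] (a i * x ^ toℕ i)) ≈ 0#)

  record IsSubfield {p} (A : Pred Carrier p) : Set (c ⊔ ℓ ⊔ p) where
    field
      resp : ∀ {x y} → x ≈ y → A x → A y
      0∈   : A 0#
      1∈   : A 1#
      +∈   : ∀ {x y} → A x → A y → A (x + y)
      -∈   : ∀ {x} → A x → A (- x)
      *∈   : ∀ {x y} → A x → A y → A (x * y)
      ⁻¹∈  : ∀ {x y} → A x → x * y ≈ 1# → A y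

------------------------------------------------------------------------
-- Polynomials with integer coefficients

-- Every term denotes an element of ℤ[X], and every element of ℤ[X] is
-- denoted by some term.
data ℤ[_] (X : Set) : Set where
  var   : X → ℤ[ X ]
  𝟘 𝟙   : ℤ[ X ]
  ⊖_    : ℤ[ X ] → ℤ[ X ]
  _⊕_ _⊗_ : ℤ[ X ] → ℤ[ X ] → ℤ[ X ]

module _ {c ℓ} (R : CommutativeRing c ℓ) where
  open CommutativeRing R

  evalℤ : ∀ {X} → ℤ[ X ] → (X → Carrier) → Carrier
  evalℤ (var x) ρ = ρ x
  evalℤ 𝟘       ρ = 0#
  evalℤ 𝟙       ρ = 1#
  evalℤ (⊖ f)   ρ = - evalℤ f ρ
  evalℤ (f ⊕ g) ρ = evalℤ f ρ + evalℤ g ρ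
  evalℤ (f ⊗ g) ρ = evalℤ f ρ * evalℤ g ρ

------------------------------------------------------------------------
-- Square matrices and general linear groups

module Matrices {c ℓ} (R : CommutativeRing c ℓ) where
  open CommutativeRing R
  open SemiringSum semiring
  open SetoidReasoning setoid

  Matrix : ℕ → Set c
  Matrix n = Fin n → Fin n → Carrier

  private
    variable
      n : ℕ

  infix 4 _≋_
  _≋_ : Matrix n → Matrix n → Set ℓ
  M ≋ N = ∀ i j → M i j ≈ N i j

  infixl 7 _∙_
  _∙_ : Matrix n → Matrix n → Matrix n
  _∙_ {n} M N i j = ∑[ k < n ] (M i k * N k j)

  I : Matrix n
  I zero    zero    = 1#
  I zero    (suc _) = 0#
  I (suc _) zero    = 0#
  I (suc i) (suc j) = I i j

  _^ₘ_ : Matrix n → ℕ → Matrix n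
  M ^ₘ zero  = I
  M ^ₘ suc k = M ∙ (M ^ₘ k)

  private
    ∑-zero : ∀ {f : Fin n → Carrier} → (∀ k → f k ≈ 0#) → sum f ≈ 0#
    ∑-zero {n} f≈0 = trans (sum-cong-≋ f≈0) (sum-replicate-zero n)

    ∑-Iˡ : ∀ i (f : Fin n → Carrier) → ∑[ k < n ] (I i k * f k) ≈ f i
    ∑-Iˡ zero    f = trans
      (+-cong (*-identityˡ _) (∑-zero (λ k → zeroˡ (f (suc k))))) (+-identityʳ _)
    ∑-Iˡ (suc i) f = trans
      (+-cong (zeroˡ _) (∑-Iˡ i (λ k → f (suc k)))) (+-identityˡ _)

    ∑-Iʳ : ∀ j (f : Fin n → Carrier) → ∑[ k < n ] (f k * I k j) ≈ f j
    ∑-Iʳ zero    f = trans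
      (+-cong (*-identityʳ _) (∑-zero (λ k → zeroʳ (f (suc k))))) (+-identityʳ _)
    ∑-Iʳ (suc j) f = trans
      (+-cong (zeroʳ _) (∑-Iʳ j (λ k → f (suc k)))) (+-identityˡ _)

    ∙-cong : ∀ {M M′ N N′ : Matrix n} → M ≋ M′ → N ≋ N′ → M ∙ N ≋ M′ ∙ N′
    ∙-cong p q i j = sum-cong-≋ (λ k → *-cong (p i k) (q k j))

    ∙-assoc : ∀ (L M N : Matrix n) → (L ∙ M) ∙ N ≋ L ∙ (M ∙ N)
    ∙-assoc {n} L M N i j = begin
      ∑[ k < n ] ((∑[ l < n ] (L i l * M l k)) * N k j)
        ≈⟨ sum-cong-≋ (λ k → *-distribʳ-sum (N k j) (λ l → L i l * M l k)) ⟩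
      ∑[ k < n ] ∑[ l < n ] (L i l * M l k * N k j)
        ≈⟨ ∑-comm (λ k l → L i l * M l k * N k j) ⟩
      ∑[ l < n ] ∑[ k < n ] (L i l * M l k * N k j)
        ≈⟨ sum-cong-≋ (λ l → sum-cong-≋ (λ k → *-assoc (L i l) (M l k) (N k j))) ⟩
      ∑[ l < n ] ∑[ k < n ] (L i l * (M l k * N k j))
        ≈⟨ sum-cong-≋ (λ l → *-distribˡ-sum (L i l) (λ k → M l k * N k j)) ⟨
      ∑[ l < n ] (L i l * (∑[ k < n ] (M l k * N k j)))
        ∎

    ∙-identityˡ : ∀ (M : Matrix n) → I ∙ M ≋ M
    ∙-identityˡ M i j = ∑-Iˡ i (λ k → M k j)

    ∙-identityʳ : ∀ (M : Matrix n) → M ∙ I ≋ M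
    ∙-identityʳ M i j = ∑-Iʳ j (M i)

    ≋-trans : ∀ {L M N : Matrix n} → L ≋ M → M ≋ N → L ≋ N
    ≋-trans p q i j = trans (p i j) (q i j)

    ≋-sym : ∀ {M N : Matrix n} → M ≋ N → N ≋ M
    ≋-sym p i j = sym (p i j)

    cancel-middle : ∀ (A B B′ A′ : Matrix n) → B ∙ B′ ≋ I → A ∙ A′ ≋ I →
      (A ∙ B) ∙ (B′ ∙ A′) ≋ I
    cancel-middle A B B′ A′ p q =
      ≋-trans (∙-assoc A B (B′ ∙ A′))
        (≋-trans (∙-cong {M = A} (λ _ _ → refl)
          (≋-trans (≋-sym (∙-assoc B B′ A′))
            (≋-trans (∙-cong {N = A′} p (λ _ _ → refl)) (∙-identityˡ A′))))
          q)

  record Invertible (n : ℕ) : Set (c ⊔ ℓ) where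
    field
      mat  : Matrix n
      inv  : Matrix n
      invˡ : inv ∙ mat ≋ I
      invʳ : mat ∙ inv ≋ I
  open Invertible public

  GL : ℕ → Group (c ⊔ ℓ) ℓ
  GL n = record
    { Carrier = Invertible n
    ; _≈_ = λ g h → mat g ≋ mat h
    ; _∙_ = λ g h → record
      { mat  = mat g ∙ mat h
      ; inv  = inv h ∙ inv g
      ; invˡ = cancel-middle (inv h) (inv g) (mat g) (mat h) (invˡ g) (invˡ h)
      ; invʳ = cancel-middle (mat g) (mat h) (inv h) (inv g) (invʳ h) (invʳ g)
      }
    ; ε = record { mat = I ; inv = I ; invˡ = ∙-identityˡ I ; invʳ = ∙-identityˡ I }
    ; _⁻¹ = λ g → record { mat = inv g ; inv = mat g ; invˡ = invʳ g ; invʳ = invˡ g }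
    ; isGroup = record
      { isMonoid = record
        { isSemigroup = record
          { isMagma = record
            { isEquivalence = record
              { refl  = λ _ _ → refl
              ; sym   = ≋-sym
              ; trans = ≋-trans
              }
            ; ∙-cong = ∙-cong
            }
          ; assoc = λ g h k → ∙-assoc (mat g) (mat h) (mat k)
          }
        ; identity = (λ g → ∙-identityˡ (mat g)) , (λ g → ∙-identityʳ (mat g))
        }
      ; inverse = invˡ , invʳ
      ; ⁻¹-cong = λ {g} {h} g≋h →
          ≋-trans (≋-sym (∙-identityʳ (inv g)))
            (≋-trans (∙-cong {M = inv g} (λ _ _ → refl) (≋-sym (invʳ h)))
              (≋-trans (≋-sym (∙-assoc (inv g) (mat h) (inv h)))
                (≋-trans (∙-cong {N = inv h}
                    (≋-trans (∙-cong {M = inv g} (λ _ _ → refl) (≋-sym g≋h)) (invˡ g))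
                    (λ _ _ → refl))
                  (∙-identityˡ (inv h)))))
      }
    }

------------------------------------------------------------------------
-- Root systems

-- Reduced crystallographic root systems.  The ambient space is taken
-- over ℚ: a root system in a real vector space lies in the rational span
-- of its roots, and its coroots are rational on that span.
record RootSystem : Set where
  field
    rank : ℕ
    size : ℕ
    root : Fin size → Fin rank → ℚ
    -- coordinates of the linear form α^∨ in the dual basis
    coroot : Fin size → Fin rank → ℚ

  Root : Set
  Root = Fin size

  open SemiringSum (CommutativeRing.semiring ℚ.+-*-commutativeRing) using (sum-syntax)

  ⟨_,_^∨⟩ : Root → Root → ℚ
  ⟨ β , α ^∨⟩ = ∑[ k < rank ] (root β k ℚ.* coroot α k)

  field
    root-injective : ∀ {α β} → root α ≗ root β → α ≡ β
    spanning       : ∀ (v : Fin rank → ℚ) → ∃ λ (a : Root → ℚ) → ∀ k →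
                     v k ≡ ∑[ α < size ] (a α ℚ.* root α k)
    ⟨α,α^∨⟩≡2      : ∀ α → ⟨ α , α ^∨⟩ ≡ ℤ.+ 2 ℚ./ 1
    reflection     : ∀ α β → ∃[ γ ] ∀ k →
                     root γ k ≡ root β k ℚ.- ⟨ β , α ^∨⟩ ℚ.* root α k
    crystallographic : ∀ α β → ∃[ z ] ⟨ β , α ^∨⟩ ≡ z ℚ./ 1
    reduced        : ∀ α β q → (∀ k → root β k ≡ q ℚ.* root α k) →
                     q ≡ 1ℚ ⊎ q ≡ ℚ.- 1ℚ

  -- The empty root system also satisfies this; it has rank 0.
  Indecomposable : Set
  Indecomposable = ∀ (S : Subset size) →
    (∀ {α β} → α ∈ S → β ∉ S → ⟨ β , α ^∨⟩ ≡ 0ℚ) →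
    (∀ α → α ∈ S) ⊎ (∀ α → α ∉ S)

  -- γ = α + β
  IsSum : Root → Root → Root → Set
  IsSum α β γ = ∀ k → root γ k ≡ root α k ℚ.+ root β k

  -- β = -α
  IsOpposite : Root → Root → Set
  IsOpposite α β = ∀ k → root β k ≡ ℚ.- root α k

------------------------------------------------------------------------
-- Complex Lie algebras and their representations

open Matrices ℂ-commutativeRing using () renaming
  ( Matrix to Matrixℂ; _≋_ to _≋ℂ_; _∙_ to _∙ℂ_; I to Iℂ; _^ₘ_ to _^ℂ_
  ; Invertible to Invertibleℂ )

record LieAlgebra : Set₁ where
  field
    vectorSpace : LeftModule ℂ.ring 0ℓ 0ℓ
  open LeftModule vectorSpace public
  field
    [_,_]    : Carrierᴹ → Carrierᴹ → Carrierᴹ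
    []-cong  : ∀ {x x′ y y′} → x ≈ᴹ x′ → y ≈ᴹ y′ → [ x , y ] ≈ᴹ [ x′ , y′ ]
    []-+ˡ    : ∀ x y z → [ x +ᴹ y , z ] ≈ᴹ [ x , z ] +ᴹ [ y , z ]
    []-+ʳ    : ∀ x y z → [ x , y +ᴹ z ] ≈ᴹ [ x , y ] +ᴹ [ x , z ]
    []-*ˡ    : ∀ a x y → [ a *ₗ x , y ] ≈ᴹ a *ₗ [ x , y ]
    []-*ʳ    : ∀ a x y → [ x , a *ₗ y ] ≈ᴹ a *ₗ [ x , y ]
    []-alternating : ∀ x → [ x , x ] ≈ᴹ 0ᴹ
    jacobi   : ∀ x y z →
               ([ x , [ y , z ] ] +ᴹ [ y , [ z , x ] ]) +ᴹ [ z , [ x , y ] ] ≈ᴹ 0ᴹ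

module _ (L : LieAlgebra) where
  open LieAlgebra L
  open CommutativeMonoidSum +ᴹ-commutativeMonoid using (sum-syntax)

  record IsIdeal (J : Pred Carrierᴹ 0ℓ) : Set where
    field
      resp : ∀ {x y} → x ≈ᴹ y → J x → J y
      0∈   : J 0ᴹ
      +∈   : ∀ {x y} → J x → J y → J (x +ᴹ y)
      *∈   : ∀ a {x} → J x → J (a *ₗ x)
      []∈  : ∀ x {y} → J y → J [ x , y ]

  -- The radical vanishes iff there is no nonzero abelian ideal.
  Semisimple : Set₁
  Semisimple = ∀ (J : Pred Carrierᴹ 0ℓ) → IsIdeal J →
    (∀ {x y} → J x → J y → [ x , y ] ≈ᴹ 0ᴹ) → ∀ {x} → J x → x ≈ᴹ 0ᴹ

  -- A Chevalley basis relative to a Cartan subalgebra with root system Φ.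
  -- With V the space containing Φ, the Cartan subalgebra is identified with
  -- the complexification of V*, and h runs through the basis dual to the
  -- coordinates of V; so [h, e α] = α(h) e α.
  record ChevalleyBasis (Φ : RootSystem) : Set where
    open RootSystem Φ
    field
      h : Fin rank → Carrierᴹ
      e : Root → Carrierᴹ
      spanning : ∀ x →
        ∃ λ (a : Fin rank → ℂ.Carrier) → ∃ λ (b : Root → ℂ.Carrier) →
        x ≈ᴹ (∑[ k < rank ] (a k *ₗ h k)) +ᴹ (∑[ α < size ] (b α *ₗ e α))
      independent : ∀ (a : Fin rank → ℂ.Carrier) (b : Root → ℂ.Carrier) →
        (∑[ k < rank ] (a k *ₗ h k)) +ᴹ (∑[ α < size ] (b α *ₗ e α)) ≈ᴹ 0ᴹ →
        (∀ k → a k ℂ.≈ ℂ.0#) × (∀ α → b α ℂ.≈ ℂ.0#)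
      [h,h] : ∀ j k → [ h j , h k ] ≈ᴹ 0ᴹ
      [h,e] : ∀ k α → [ h k , e α ] ≈ᴹ ℂ.fromℚ (root α k) *ₗ e α
      [e,e]-opposite : ∀ {α β} → IsOpposite α β →
        [ e α , e β ] ≈ᴹ ∑[ k < rank ] (ℂ.fromℚ (coroot α k) *ₗ h k)
      -- N(-α, -β) = -N(α, β)
      [e,e]-sum : ∀ {α β γ α′ β′ γ′} → IsSum α β γ →
        IsOpposite α α′ → IsOpposite β β′ → IsOpposite γ γ′ →
        ∃[ N ] ([ e α , e β ] ≈ᴹ N *ₗ e γ) × ([ e α′ , e β′ ] ≈ᴹ (ℂ.- N) *ₗ e γ′)

  record Representation (n : ℕ) : Set where
    field
      act      : Carrierᴹ → Matrixℂ n
      act-cong : ∀ {x y} → x ≈ᴹ y → act x ≋ℂ act y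
      act-+    : ∀ x y (i j : Fin n) → act (x +ᴹ y) i j ℂ.≈ act x i j ℂ.+ act y i j
      act-*    : ∀ a x (i j : Fin n) → act (a *ₗ x) i j ℂ.≈ a ℂ.* act x i j
      act-[]   : ∀ x y (i j : Fin n) → act [ x , y ] i j ℂ.≈
                 (act x ∙ℂ act y) i j ℂ.- (act y ∙ℂ act x) i j

  Faithful : ∀ {n} → Representation n → Set
  Faithful π = ∀ {x y} → act x ≋ℂ act y → x ≈ᴹ y
    where open Representation π

1/_! : ℕ → ℚ
1/ k ! = (ℤ.+ 1 ℚ./ k !) {{k ℕ.!≢0}}

------------------------------------------------------------------------
-- Chevalley groups

module _ {L : LieAlgebra} {Φ : RootSystem} (B : ChevalleyBasis L Φ)
         {n : ℕ} (π : Representation L n) where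
  open RootSystem Φ using (Root)
  open ChevalleyBasis B using (e)
  open Representation π using (act)
  open Matrices ℂ-commutativeRing using (mat; inv)
  open SemiringSum ℂ.semiring using (sum-syntax)

  -- The matrix of π(e α) in the basis formed by the columns of P.
  rootMatrix : Invertibleℂ n → Root → Matrixℂ n
  rootMatrix P α = (inv P ∙ℂ act (e α)) ∙ℂ mat P

  -- The columns of P span a lattice stable under the divided powers
  -- π(e α)ᵏ / k!, which generate the Kostant ℤ-form.
  Admissible : Invertibleℂ n → Set
  Admissible P = ∀ α k → ∃ λ (Z : Fin n → Fin n → ℤ) → ∀ i j →
    ℂ.fromℚ (1/ k !) ℂ.* (rootMatrix P α ^ℂ k) i j ℂ.≈ ℂ.fromℤ (Z i j)

  -- exp (t π(e α)): the n-th power of the nilpotent matrix π(e α) is zero,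
  -- so the exponential series stops before k = n.
  rootElement : Invertibleℂ n → Root → ℂ.Carrier → Matrixℂ n
  rootElement P α t i j = ∑[ k < n ]
    (ℂ.fromℚ (1/ toℕ k !) ℂ.* (t ℂ.^ toℕ k) ℂ.* (rootMatrix P α ^ℂ toℕ k) i j)

  -- The elements of the group over ℂ generated by all exp (t π(e α)); the
  -- inverse of exp (t π(e α)) is exp (- t π(e α)).
  data Chevalleyℂ (P : Invertibleℂ n) : Matrixℂ n → Set where
    one  : Chevalleyℂ P Iℂ
    step : ∀ α t {M} → Chevalleyℂ P M → Chevalleyℂ P (rootElement P α t ∙ℂ M)

  -- f is a relation between the matrix entries over the group above.  These
  -- f form the ideal of ℤ[G] = ℤ[xᵢⱼ] / I, the coordinate ring of the
  -- Chevalley–Demazure group scheme.  Since det - 1 is in I, its points are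
  -- matrices in SLₙ.
  Vanishing : Invertibleℂ n → ℤ[ Fin n × Fin n ] → Set
  Vanishing P f = ∀ {M} → Chevalleyℂ P M →
    evalℤ ℂ-commutativeRing f (λ (i , j) → M i j) ℂ.≈ ℂ.0#

  module _ (P : Invertibleℂ n) {c ℓ} (R : CommutativeRing c ℓ) where
    open CommutativeRing R using (Carrier; _≈_; 0#)
    open Matrices R using (Invertible) renaming (mat to matR)

    -- The subgroup G_π(Φ, R) of GLₙ(R).
    ChevalleyGroup : Pred (Invertible n) ℓ
    ChevalleyGroup g = ∀ f → Vanishing P f →
      evalℤ R f (λ (i , j) → matR g i j) ≈ 0#

    -- The subgroup G_π(Φ, A) for a subfield A of R: the defining equations
    -- have integer coefficients, and, since det g = 1, the entries of g⁻¹ are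
    -- integer polynomials in those of g.
    ChevalleyGroupOver : ∀ {p} → Pred Carrier p → Pred (Invertible n) (ℓ ⊔ p)
    ChevalleyGroupOver A g = ChevalleyGroup g × (∀ i j → A (matR g i j))

------------------------------------------------------------------------
-- Computability

-- Partial recursive functions
data Rec : ℕ → Set where
  zeroᵣ : ∀ {k} → Rec k
  sucᵣ  : Rec 1
  proj  : ∀ {k} → Fin k → Rec k
  comp  : ∀ {k m} → Rec m → Vec (Rec k) m → Rec k
  prec  : ∀ {k} → Rec k → Rec (2 ℕ.+ k) → Rec (suc k)
  min   : ∀ {k} → Rec (suc k) → Rec k

mutual
  -- p ⟨ xs ⟩↦ y : the computation of p on input xs halts with output y.
  infix 4 _⟨_⟩↦_ _⟨_⟩↦*_
  data _⟨_⟩↦_ : ∀ {k} → Rec k → Vec ℕ k → ℕ → Set where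
    zeroᵣ : ∀ {k} {xs : Vec ℕ k} → zeroᵣ ⟨ xs ⟩↦ 0
    sucᵣ  : ∀ {x} → sucᵣ ⟨ x ∷ [] ⟩↦ suc x
    proj  : ∀ {k} {xs : Vec ℕ k} i → proj i ⟨ xs ⟩↦ lookup xs i
    comp  : ∀ {k m} {f : Rec m} {gs : Vec (Rec k) m} {xs ys z} →
            gs ⟨ xs ⟩↦* ys → f ⟨ ys ⟩↦ z → comp f gs ⟨ xs ⟩↦ z
    prec-zero : ∀ {k} {f : Rec k} {g xs y} →
            f ⟨ xs ⟩↦ y → prec f g ⟨ 0 ∷ xs ⟩↦ y
    prec-suc : ∀ {k} {f : Rec k} {g xs m y z} →
            prec f g ⟨ m ∷ xs ⟩↦ y → g ⟨ m ∷ y ∷ xs ⟩↦ z → prec f g ⟨ suc m ∷ xs ⟩↦ z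
    min   : ∀ {k} {f : Rec (suc k)} {xs y} →
            f ⟨ y ∷ xs ⟩↦ 0 → (∀ z → z ℕ.< y → ∃[ w ] f ⟨ z ∷ xs ⟩↦ suc w) →
            min f ⟨ xs ⟩↦ y

  data _⟨_⟩↦*_ {k : ℕ} : ∀ {m} → Vec (Rec k) m → Vec ℕ k → Vec ℕ m → Set where
    []  : ∀ {xs} → [] ⟨ xs ⟩↦* []
    _∷_ : ∀ {m} {f : Rec k} {fs : Vec (Rec k) m} {xs y ys} →
          f ⟨ xs ⟩↦ y → fs ⟨ xs ⟩↦* ys → (f ∷ fs) ⟨ xs ⟩↦* (y ∷ ys)

-- p answers the instance xs of the decision problem Q.
Answers : ∀ {k ℓ} → Rec k → Vec ℕ k → Set ℓ → Set ℓ
Answers p xs Q = (Q → p ⟨ xs ⟩↦ 1) × (¬ Q → p ⟨ xs ⟩↦ 0)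

module _ {c ℓ} (R : CommutativeRing c ℓ) where
  open CommutativeRing R

  -- ν is an enumeration of the subfield A with respect to which A is
  -- computable as a structure of signature (+, -, *, =).  The constants 0
  -- and 1 are computable with respect to any surjective ν.
  record IsComputableEnumeration {p} (A : Pred Carrier p) (ν : ℕ → Carrier) : Set (c ⊔ ℓ ⊔ p) where
    field
      member         : ∀ i → A (ν i)
      surjective     : ∀ {x} → A x → ∃[ i ] ν i ≈ x
      computable-+   : ∃[ p ] ∀ i j → ∃[ k ] p ⟨ i ∷ j ∷ [] ⟩↦ k × ν k ≈ ν i + ν j
      computable-*   : ∃[ p ] ∀ i j → ∃[ k ] p ⟨ i ∷ j ∷ [] ⟩↦ k × ν k ≈ ν i * ν j
      computable-neg : ∃[ p ] ∀ i → ∃[ k ] p ⟨ i ∷ [] ⟩↦ k × ν k ≈ - ν i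
      computable-≈   : ∃[ p ] ∀ i j → Answers p (i ∷ j ∷ []) (ν i ≈ ν j)

  IsComputableSubfield : ∀ {p} → Pred Carrier p → Set (c ⊔ ℓ ⊔ p)
  IsComputableSubfield A = IsSubfield R A × ∃[ ν ] IsComputableEnumeration A ν

  open Matrices R using (Invertible; mat; _≋_)

  -- μ enumerates the set C of matrices over A, and ν-indices of the matrix
  -- entries can be computed from μ-indices.  A μ-index can then be computed
  -- from ν-indices of the entries by unbounded search.
  record IsProperEnumeration {n p q} (A : Pred Carrier p) (C : Pred (Invertible n) q)
                             (μ : ℕ → Invertible n) : Set (c ⊔ ℓ ⊔ p ⊔ q) where
    field
      ν            : ℕ → Carrier
      ν-computable : IsComputableEnumeration A ν
      member       : ∀ i → C (μ i)
      surjective   : ∀ {g} → C g → ∃[ i ] mat (μ i) ≋ mat g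
      computable-entries : ∀ r s → ∃[ p ] ∀ i → ∃[ k ]
                     p ⟨ i ∷ [] ⟩↦ k × ν k ≈ mat (μ i) r s

------------------------------------------------------------------------
-- Diophantine problems

-- const i is the constant with index i in the given enumeration.
data Symbol : Set where
  const var : ℕ → Symbol

data Letter : Set where
  _⁺ _⁻ : Symbol → Letter

-- The word w stands for the equation w = 1.
Equation System : Set
Equation = List Letter
System   = List Equation

triangular : ℕ → ℕ
triangular zero    = 0
triangular (suc k) = suc k ℕ.+ triangular k

-- Cantor's pairing bijection
pair : ℕ → ℕ → ℕ
pair x y = triangular (x ℕ.+ y) ℕ.+ y

encodeList : ∀ {X : Set} → (X → ℕ) → List X → ℕ
encodeList enc []       = 0
encodeList enc (x ∷ xs) = suc (pair (enc x) (encodeList enc xs))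

encodeSymbol : Symbol → ℕ
encodeSymbol (const i) = pair 0 i
encodeSymbol (var i)   = pair 1 i

encodeLetter : Letter → ℕ
encodeLetter (s ⁺) = pair 0 (encodeSymbol s)
encodeLetter (s ⁻) = pair 1 (encodeSymbol s)

encodeSystem : System → ℕ
encodeSystem = encodeList (encodeList encodeLetter)

module Diophantine {c ℓ} (H : Group c ℓ) (constants : ℕ → Group.Carrier H) where
  open Group H

  module _ (x : ℕ → Carrier) where

    evalSymbol : Symbol → Carrier
    evalSymbol (const i) = constants i
    evalSymbol (var i)   = x i

    evalLetter : Letter → Carrier
    evalLetter (s ⁺) = evalSymbol s
    evalLetter (s ⁻) = evalSymbol s ⁻¹

    evalWord : List Letter → Carrier
    evalWord []      = ε
    evalWord (l ∷ w) = evalLetter l ∙ evalWord w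

  -- Solutions are sought in a subgroup G of H containing the constants.  The
  -- variables not occurring in S are unconstrained.
  Solvable : ∀ {p} → Pred Carrier p → System → Set (c ⊔ ℓ ⊔ p)
  Solvable G S = ∃[ x ] (∀ i → G (x i)) × All (λ w → evalWord x w ≈ ε) S

  DecidableIn : ∀ {p} → Pred Carrier p → Set (c ⊔ ℓ ⊔ p)
  DecidableIn G = ∃[ p ] ∀ S → Answers p (encodeSystem S ∷ []) (Solvable G S)

{-# OPTIONS --safe #-}

-- By Hilbert's basis theorem, finitely many integer polynomials cut out
-- G_π(Φ, R) inside GLₙ(R), so a system of equations in the group is a system E
-- of polynomial equations over A for the entries of matrices.  Both the
-- solvability and the unsolvability of E in R are witnessed by derivations in
-- the equational theory of A-algebras, so both can be searched for.  E is
-- unsolvable when E ⊢ 1 = 0.  It is solvable when T ⊢ E for some triangular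
-- system T: the element of T with index i is a monic polynomial of positive
-- degree in the variable i with coefficients in the previous variables, so that
-- T has a zero in the algebraically closed field R.  If E ⊬ 1 = 0, then the
-- residue field of a maximal ideal containing E is algebraic over A by Zariski's
-- lemma, and the successive minimal polynomials of the variables form such a T.
--
-- Derivability is expressed by a Horn program whose derivations are checked by a
-- function that is primitive recursive relative to the operations of A.

module Submission where

open import Algebra.Bundles using (CommutativeRing; Group)
open import Axiom.ExcludedMiddle using (ExcludedMiddle)
open import Data.Fin using (#_)
open import Data.Fin.Base using (Fin; zero; suc; toℕ; fromℕ)
open import Data.Fin.Patterns
open import Data.Fin.Properties using (toℕ-injective)
open import Data.List.Base as List using (List; []; _∷_; _++_; length; allFin; cartesianProduct; cartesianProductWith)
open import Data.List.Membership.Propositional using (_∈_)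
open import Data.List.Membership.Propositional.Properties using (∈-++⁺ˡ; ∈-++⁺ʳ; ∈-cartesianProduct⁺; ∈-cartesianProductWith⁺; ∈-allFin)
open import Data.List.Relation.Unary.All as All using (All; []; _∷_)
import Data.List.Relation.Unary.All.Properties as All
open import Data.List.Relation.Unary.Any using (here; there)
open import Data.Nat.Base as ℕ using (ℕ; zero; suc; z≤n; s≤s; _<_)
open import Data.Nat.Induction using (<-rec)
import Data.Nat.Properties as ℕ
open import Data.Product.Base using (∃; ∃-syntax; _×_; _,_; proj₁; proj₂)
open import Data.Sum.Base as Sum using (_⊎_; inj₁; inj₂; fromInj₁; fromInj₂)
open import Data.Unit.Polymorphic.Base using (⊤; tt)
open import Data.Vec.Base using (Vec; []; _∷_)
open import Function.Bundles using (_⇔_; mk⇔; Equivalence)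
open import Level using (0ℓ; _⊔_; Lift; lift)
open import Relation.Binary.PropositionalEquality as ≡ using (_≡_; cong; cong₂)
open import Relation.Nullary using (Dec; ¬_; yes; no; contradiction)
open import Relation.Nullary.Decidable using (decidable-stable)
open import Relation.Unary using (Pred)
import Algebra.Construct.Pointwise as Pointwise
import Algebra.Properties.Ring as RingProperties
import Algebra.Properties.Semiring.Exp as SemiringExp
import Algebra.Properties.Semiring.Sum as SemiringSum
import Algebra.Solver.Ring.NaturalCoefficients.Default as SemiringSolver
open import Defs
open Equivalence using (to; from)

module Computability where

  open import Data.Nat.Base
  open import Data.Nat.Properties
  open import Data.Vec.Base using (lookup)
  open import Relation.Binary.PropositionalEquality
  open import Relation.Binary.Definitions using (tri<; tri≈; tri>)

  record Fun (k : ℕ) : Set where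
    field
      fun   : Vec ℕ k → ℕ
      code  : Rec k
      halts : ∀ xs → code ⟨ xs ⟩↦ fun xs
  open Fun public

  funs : ∀ {k m} → Vec (Fun k) m → Vec ℕ k → Vec ℕ m
  funs []       xs = []
  funs (f ∷ fs) xs = fun f xs ∷ funs fs xs

  private
    codes : ∀ {k m} → Vec (Fun k) m → Vec (Rec k) m
    codes []       = []
    codes (f ∷ fs) = code f ∷ codes fs

    halts* : ∀ {k m} (fs : Vec (Fun k) m) xs → codes fs ⟨ xs ⟩↦* funs fs xs
    halts* []       xs = []
    halts* (f ∷ fs) xs = halts f xs ∷ halts* fs xs

  infixl 9 _$$_
  _$$_ : ∀ {k m} → Fun m → Vec (Fun k) m → Fun k
  f $$ gs = record
    { fun   = λ xs → fun f (funs gs xs)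
    ; code  = comp (code f) (codes gs)
    ; halts = λ xs → comp (halts* gs xs) (halts f (funs gs xs))
    }

  arg : ∀ {k} → Fin k → Fun k
  arg i = record { fun = λ xs → lookup xs i ; code = proj i ; halts = λ xs → proj i }

  sucF : Fun 1
  sucF = record { fun = λ { (x ∷ []) → suc x } ; code = sucᵣ ; halts = λ { (x ∷ []) → sucᵣ } }

  lit : ∀ {k} → ℕ → Fun k
  lit {k} n = record { fun = λ _ → n ; code = numeral n ; halts = numeral-halts n }
    where
    numeral : ℕ → Rec k
    numeral zero    = zeroᵣ
    numeral (suc n) = comp sucᵣ (numeral n ∷ [])
    numeral-halts : ∀ n xs → numeral n ⟨ xs ⟩↦ n
    numeral-halts zero    xs = zeroᵣ
    numeral-halts (suc n) xs = comp (numeral-halts n xs ∷ []) sucᵣ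

  module _ {k} (f : Fun k) (g : Fun (2 + k)) where
    primrec : ℕ → Vec ℕ k → ℕ
    primrec zero    xs = fun f xs
    primrec (suc m) xs = fun g (m ∷ primrec m xs ∷ xs)

    precF : Fun (suc k)
    precF = record
      { fun   = λ { (m ∷ xs) → primrec m xs }
      ; code  = prec (code f) (code g)
      ; halts = λ { (m ∷ xs) → halts-at m xs }
      }
      where
      halts-at : ∀ m xs → prec (code f) (code g) ⟨ m ∷ xs ⟩↦ primrec m xs
      halts-at zero    xs = prec-zero (halts f xs)
      halts-at (suc m) xs = prec-suc (halts-at m xs) (halts g _)

  infix 4 _≗F_
  _≗F_ : ∀ {k} → Fun k → (Vec ℕ k → ℕ) → Set
  F ≗F f = ∀ xs → fun F xs ≡ f xs

  as : ∀ {k} (F : Fun k) (f : Vec ℕ k → ℕ) → F ≗F f → Fun k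
  as F f eq = record
    { fun = f ; code = code F ; halts = λ xs → subst (code F ⟨ xs ⟩↦_) (eq xs) (halts F xs) }

  binary : (ℕ → ℕ → ℕ) → Vec ℕ 2 → ℕ
  binary f (x ∷ y ∷ []) = f x y

  unary : (ℕ → ℕ) → Vec ℕ 1 → ℕ
  unary f (x ∷ []) = f x

  addF mulF monusF : Fun 2
  addF = as (precF (arg 0F) (sucF $$ (arg 1F ∷ []))) (binary _+_) λ { (x ∷ y ∷ []) → eq x y }
    where
    eq : ∀ x y → primrec (arg 0F) (sucF $$ (arg 1F ∷ [])) x (y ∷ []) ≡ x + y
    eq zero    y = refl
    eq (suc x) y = cong suc (eq x y)
  mulF = as (precF (lit 0) (addF $$ (arg 2F ∷ arg 1F ∷ []))) (binary _*_) λ { (x ∷ y ∷ []) → eq x y }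
    where
    eq : ∀ x y → primrec (lit 0) (addF $$ (arg 2F ∷ arg 1F ∷ [])) x (y ∷ []) ≡ x * y
    eq zero    y = refl
    eq (suc x) y = cong (y +_) (eq x y)

  predF : Fun 1
  predF = as (precF (lit 0) (arg 0F)) (unary pred) λ { (zero ∷ []) → refl ; (suc x ∷ []) → refl }

  monusF = as (precF (arg 0F) (predF $$ (arg 1F ∷ [])) $$ (arg 1F ∷ arg 0F ∷ [])) (binary _∸_)
    λ { (x ∷ y ∷ []) → eq x y }
    where
    eq : ∀ x y → primrec (arg 0F) (predF $$ (arg 1F ∷ [])) y (x ∷ []) ≡ x ∸ y
    eq x zero    = refl
    eq x (suc y) = trans (cong pred (eq x y)) (pred[m∸n]≡m∸[1+n] x y)

  infixl 6 _+F_ _∸F_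
  infixl 7 _*F_
  _+F_ _*F_ _∸F_ : ∀ {k} → Fun k → Fun k → Fun k
  f +F g = addF $$ (f ∷ g ∷ [])
  f *F g = mulF $$ (f ∷ g ∷ [])
  f ∸F g = monusF $$ (f ∷ g ∷ [])

  triangularF : Fun 1
  triangularF = as (precF (lit 0) (sucF $$ (arg 0F ∷ []) +F arg 1F)) (unary triangular)
    λ { (x ∷ []) → eq x }
    where
    eq : ∀ x → primrec (lit 0) (sucF $$ (arg 0F ∷ []) +F arg 1F) x [] ≡ triangular x
    eq zero    = refl
    eq (suc x) = cong (suc x +_) (eq x)

  -- The largest s with triangular s ≤ n.
  root : ℕ → ℕ
  root zero    = 0
  root (suc n) = root n + (1 ∸ (triangular (suc (root n)) ∸ suc n))

  rootF : Fun 1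
  rootF = as (precF (lit 0) next) (unary root) λ { (x ∷ []) → eq x }
    where
    next : Fun 2
    next = arg 1F +F (lit 1 ∸F (triangularF $$ (sucF $$ (arg 1F ∷ []) ∷ []) ∸F sucF $$ (arg 0F ∷ [])))
    eq : ∀ x → primrec (lit 0) next x [] ≡ root x
    eq zero    = refl
    eq (suc x) = cong (λ r → r + (1 ∸ (triangular (suc r) ∸ suc x))) (eq x)

  private
    root-bounds : ∀ n → triangular (root n) ≤ n × n ≤ triangular (root n) + root n
    root-bounds zero = z≤n , z≤n
    root-bounds (suc n) with root-bounds n | <-≤-connex n (triangular (root n) + root n)
    ... | l , u | inj₁ n<
      rewrite +-comm (root n) (triangular (root n))
            | +-∸-assoc 1 n<
            | 0∸n≡0 (triangular (root n) + root n ∸ suc n) | +-identityʳ (root n) = ≤-trans l (n≤1+n n) , n<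
    ... | l , u | inj₂ n≥
      rewrite +-comm (root n) (triangular (root n)) | m≤n⇒m∸n≡0 n≥ | +-comm (root n) 1
            | +-comm (root n) (triangular (root n)) = s≤s n≥ , s≤s (≤-trans u (m≤m+n _ _))

    n≤triangular : ∀ n → n ≤ triangular n
    n≤triangular zero    = z≤n
    n≤triangular (suc n) = m≤m+n (suc n) _

    triangular-mono : ∀ {s t} → s ≤ t → triangular s ≤ triangular t
    triangular-mono z≤n       = z≤n
    triangular-mono (s≤s s≤t) = s≤s (+-mono-≤ s≤t (triangular-mono s≤t))

    disjoint : ∀ s t n → s < t → n ≤ triangular s + s → triangular t ≤ n → ∀ {a} {A : Set a} → A
    disjoint s t n s<t n≤ t≤ = contradiction
      (≤-trans (≤-trans (triangular-mono s<t) t≤) n≤)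
      (<⇒≱ (s≤s (≤-reflexive (+-comm (triangular s) s))))

    root-unique : ∀ s n → triangular s ≤ n → n ≤ triangular s + s → root n ≡ s
    root-unique s n l u with <-cmp (root n) s | root-bounds n
    ... | tri< r<s _ _ | _ , u′ = disjoint (root n) s n r<s u′ l
    ... | tri≈ _ eq _  | _      = eq
    ... | tri> _ _ s<r | l′ , _ = disjoint s (root n) n s<r u l′

    root-pair : ∀ x y → root (pair x y) ≡ x + y
    root-pair x y = root-unique (x + y) (pair x y) (m≤m+n _ y) (+-monoʳ-≤ (triangular (x + y)) (m≤n+m y x))

  -- Pairing is opaque so that codes do not unfold to sums.
  opaque
    fst snd : ℕ → ℕ
    snd n = n ∸ triangular (root n)
    fst n = root n ∸ snd n

    snd-≤ : ∀ n → snd n ≤ n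
    snd-≤ n = m∸n≤m n (triangular (root n))

    fst+snd≤ : ∀ n → fst n + snd n ≤ n
    fst+snd≤ n = ≤-trans (≤-reflexive (m∸n+n≡m (m≤n+o⇒m∸n≤o n _ (proj₂ (root-bounds n)))))
      (≤-trans (n≤triangular (root n)) (proj₁ (root-bounds n)))

    sndF-correct : arg 0F ∸F triangularF $$ (rootF ∷ []) ≗F unary snd
    sndF-correct (x ∷ []) = refl

  sndF : Fun 1
  sndF = as (arg 0F ∸F triangularF $$ (rootF ∷ [])) (unary snd) sndF-correct

  opaque
    unfolding fst

    fstF-correct : rootF ∸F sndF ≗F unary fst
    fstF-correct (x ∷ []) = refl

  fstF : Fun 1
  fstF = as (rootF ∸F sndF) (unary fst) fstF-correct

  opaque
    unfolding fst

    ⟪_,_⟫ : ℕ → ℕ → ℕ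
    ⟪ x , y ⟫ = pair x y

    ⟪⟫≡pair : ∀ x y → ⟪ x , y ⟫ ≡ pair x y
    ⟪⟫≡pair x y = refl

    snd-⟪⟫ : ∀ x y → snd ⟪ x , y ⟫ ≡ y
    snd-⟪⟫ x y rewrite root-pair x y = m+n∸m≡n (triangular (x + y)) y

    fst-⟪⟫ : ∀ x y → fst ⟪ x , y ⟫ ≡ x
    fst-⟪⟫ x y rewrite snd-⟪⟫ x y | root-pair x y = m+n∸n≡m x y

    x≤⟪⟫ : ∀ x y → x ≤ ⟪ x , y ⟫
    x≤⟪⟫ x y = ≤-trans (≤-trans (m≤m+n x y) (n≤triangular (x + y))) (m≤m+n _ y)

    y≤⟪⟫ : ∀ x y → y ≤ ⟪ x , y ⟫
    y≤⟪⟫ x y = m≤n+m y _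

    pairF-correct : triangularF $$ (arg 0F +F arg 1F ∷ []) +F arg 1F ≗F binary ⟪_,_⟫
    pairF-correct (x ∷ y ∷ []) = refl

  pairF : Fun 2
  pairF = as (triangularF $$ (arg 0F +F arg 1F ∷ []) +F arg 1F) (binary ⟪_,_⟫) pairF-correct

  ⟪⟫-injective : ∀ {x y x′ y′} → ⟪ x , y ⟫ ≡ ⟪ x′ , y′ ⟫ → x ≡ x′ × y ≡ y′
  ⟪⟫-injective {x} {y} {x′} {y′} eq =
    trans (sym (fst-⟪⟫ x y)) (trans (cong fst eq) (fst-⟪⟫ x′ y′)) ,
    trans (sym (snd-⟪⟫ x y)) (trans (cong snd eq) (snd-⟪⟫ x′ y′))

module HornPrograms where

  open import Data.List.Membership.Propositional.Properties using (∈-lookup)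
  open import Data.Nat.Base
  open import Data.Nat.Properties
  open import Data.Empty using (⊥)
  open import Relation.Binary.PropositionalEquality
  open Computability

  -- Truth values: 0 is true, so that conjunctions are sums and disjunctions products.

  ∑< ∏< : (ℕ → ℕ) → ℕ → ℕ
  ∑< f zero    = 0
  ∑< f (suc n) = ∑< f n + f n
  ∏< f zero    = 1
  ∏< f (suc n) = ∏< f n * f n

  ∑<≡0⁺ : ∀ {f} n → (∀ i → f i ≡ 0) → ∑< f n ≡ 0
  ∑<≡0⁺ zero    h = refl
  ∑<≡0⁺ (suc n) h = cong₂ _+_ (∑<≡0⁺ n h) (h n)

  ∑<≡0⁻ : ∀ {f n} → ∑< f n ≡ 0 → ∀ {i} → i < n → f i ≡ 0
  ∑<≡0⁻ {f} {suc n} eq {i} i<n with m≤n⇒m<n∨m≡n (s≤s⁻¹ i<n)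
  ... | inj₁ i<n′ = ∑<≡0⁻ (m+n≡0⇒m≡0 _ eq) i<n′
  ... | inj₂ refl = m+n≡0⇒n≡0 (∑< f n) eq

  ∏<≡0⁺ : ∀ {f n i} → i < n → f i ≡ 0 → ∏< f n ≡ 0
  ∏<≡0⁺ {f} {suc n} {i} i<n eq with m≤n⇒m<n∨m≡n (s≤s⁻¹ i<n)
  ... | inj₁ i<n′ = cong (_* f n) (∏<≡0⁺ i<n′ eq)
  ... | inj₂ refl = trans (cong (∏< f n *_) eq) (*-zeroʳ (∏< f n))

  ∏<≡0⁻ : ∀ {f} n → ∏< f n ≡ 0 → ∃[ i ] f i ≡ 0
  ∏<≡0⁻ {f} (suc n) eq with m*n≡0⇒m≡0∨n≡0 (∏< f n) eq
  ... | inj₁ p = ∏<≡0⁻ n p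
  ... | inj₂ p = n , p

  ∑F : Fun 2 → Fun 2
  ∑F f = as (precF (lit 0) next) (λ { (n ∷ x ∷ []) → ∑< (λ i → fun f (i ∷ x ∷ [])) n })
            λ { (n ∷ x ∷ []) → eq n x }
    where
    next : Fun 3
    next = arg 1F +F f $$ (arg 0F ∷ arg 2F ∷ [])
    eq : ∀ n x → primrec (lit 0) next n (x ∷ []) ≡ ∑< (λ i → fun f (i ∷ x ∷ [])) n
    eq zero    x = refl
    eq (suc n) x = cong (_+ fun f (n ∷ x ∷ [])) (eq n x)

  ∏F : Fun 3 → Fun 3
  ∏F f = as (precF (lit 1) next) (λ { (n ∷ x ∷ y ∷ []) → ∏< (λ i → fun f (i ∷ x ∷ y ∷ [])) n })
            λ { (n ∷ x ∷ y ∷ []) → eq n x y }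
    where
    next : Fun 4
    next = arg 1F *F f $$ (arg 0F ∷ arg 2F ∷ arg 3F ∷ [])
    eq : ∀ n x y → primrec (lit 1) next n (x ∷ y ∷ []) ≡ ∏< (λ i → fun f (i ∷ x ∷ y ∷ [])) n
    eq zero    x y = refl
    eq (suc n) x y = cong (_* fun f (n ∷ x ∷ y ∷ [])) (eq n x y)

  distance : ℕ → ℕ → ℕ
  distance x y = (x ∸ y) + (y ∸ x)

  distance≡0⁺ : ∀ {x y} → x ≡ y → distance x y ≡ 0
  distance≡0⁺ {x} refl = cong₂ _+_ (n∸n≡0 x) (n∸n≡0 x)

  distance≡0⁻ : ∀ x y → distance x y ≡ 0 → x ≡ y
  distance≡0⁻ x y eq = ≤-antisym (m∸n≡0⇒m≤n (m+n≡0⇒m≡0 _ eq)) (m∸n≡0⇒m≤n (m+n≡0⇒n≡0 (x ∸ y) eq))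

  distanceF : ∀ {k} → Fun k → Fun k → Fun k
  distanceF f g = (f ∸F g) +F (g ∸F f)

  listCode : List ℕ → ℕ
  listCode []       = 0
  listCode (x ∷ xs) = suc ⟪ x , listCode xs ⟫

  hd tl : ℕ → ℕ
  hd l = fst (pred l)
  tl l = snd (pred l)

  hdF tlF : Fun 1
  hdF = as (fstF $$ (predF ∷ [])) (unary hd) λ { (x ∷ []) → refl }
  tlF = as (sndF $$ (predF ∷ [])) (unary tl) λ { (x ∷ []) → refl }

  suffix : ℕ → ℕ → ℕ
  suffix zero    l = l
  suffix (suc i) l = tl (suffix i l)

  suffixF : Fun 2
  suffixF = as (precF (arg 0F) (tlF $$ (arg 1F ∷ []))) (binary suffix) λ { (i ∷ l ∷ []) → eq i l }
    where
    eq : ∀ i l → primrec (arg 0F) (tlF $$ (arg 1F ∷ [])) i (l ∷ []) ≡ suffix i l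
    eq zero    l = refl
    eq (suc i) l = cong tl (eq i l)

  suffix-tl : ∀ i l → suffix i (tl l) ≡ suffix (suc i) l
  suffix-tl zero    l = refl
  suffix-tl (suc i) l = cong tl (suffix-tl i l)

  tl-suc : ∀ l → tl (suc l) ≤ l
  tl-suc = snd-≤

  suffix-0 : ∀ i → suffix i 0 ≡ 0
  suffix-0 zero    = refl
  suffix-0 (suc i) = trans (cong tl (suffix-0 i)) (n≤0⇒n≡0 (snd-≤ 0))

  suffix-bound : ∀ n l → l ≤ n → ∀ i → suffix i l ≢ 0 → i < l
  suffix-bound n       zero    l≤n i       ≢0 = contradiction (suffix-0 i) ≢0
  suffix-bound (suc n) (suc l) l≤n zero    ≢0 = s≤s z≤n
  suffix-bound (suc n) (suc l) (s≤s l≤n) (suc i) ≢0 = s≤s (≤-trans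
    (suffix-bound n (tl (suc l)) (≤-trans (tl-suc l) l≤n) i
      (λ eq → ≢0 (trans (sym (suffix-tl i (suc l))) eq)))
    (tl-suc l))

  hd-listCode : ∀ x xs → hd (listCode (x ∷ xs)) ≡ x
  hd-listCode x xs = fst-⟪⟫ x (listCode xs)

  tl-listCode : ∀ x xs → tl (listCode (x ∷ xs)) ≡ listCode xs
  tl-listCode x xs = snd-⟪⟫ x (listCode xs)

  suffix-listCode : ∀ i x xs → suffix (suc i) (listCode (x ∷ xs)) ≡ suffix i (listCode xs)
  suffix-listCode i x xs = trans (sym (suffix-tl i _)) (cong (suffix i) (tl-listCode x xs))

  module _ (b l : ℕ) where
    Member : Set
    Member = ∃[ i ] suffix i l ≢ 0 × fst (hd (suffix i l)) ≡ b

    member : ℕ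
    member = ∏< (λ i → (1 ∸ suffix i l) + distance (fst (hd (suffix i l))) b) l

    member⁺ : Member → member ≡ 0
    member⁺ (i , ≢0 , eq) = ∏<≡0⁺ (suffix-bound l l ≤-refl i ≢0)
      (cong₂ _+_ (m≤n⇒m∸n≡0 (n≢0⇒n>0 ≢0)) (distance≡0⁺ eq))

    member⁻ : member ≡ 0 → Member
    member⁻ eq with ∏<≡0⁻ l eq
    ... | i , p = i , (λ ≡0 → contradiction (trans (sym (cong (1 ∸_) ≡0)) (m+n≡0⇒m≡0 _ p)) λ ())
                    , distance≡0⁻ _ b (m+n≡0⇒n≡0 (1 ∸ suffix i l) p)

  memberF : Fun 2
  memberF = as
    (∏F ((lit 1 ∸F s) +F distanceF (fstF $$ (hdF $$ (s ∷ []) ∷ [])) (arg 1F)) $$ (arg 1F ∷ arg 0F ∷ arg 1F ∷ []))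
    (binary member) λ { (b ∷ l ∷ []) → refl }
    where
    s : Fun 3
    s = suffixF $$ (arg 0F ∷ arg 2F ∷ [])

  Member-listCode : ∀ {x xs} → x ∈ xs → Member (fst x) (listCode xs)
  Member-listCode {x} {_ ∷ xs} (here refl) = 0 , (λ ()) , cong fst (hd-listCode x xs)
  Member-listCode {x} {y ∷ xs} (there x∈)  with Member-listCode x∈
  ... | i , ≢0 , eq = suc i ,
    (λ ≡0 → ≢0 (trans (sym (suffix-listCode i y xs)) ≡0)) ,
    trans (cong (λ s → fst (hd s)) (suffix-listCode i y xs)) eq

  Atom : Set
  Atom = Vec ℕ 4

  AtomF : ℕ → Set
  AtomF k = Vec (Fun k) 4

  -- Heads and bodies are computed from the values of the variables, so
  -- derivations are checked without unification.
  record Clause : Set where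
    constructor clause
    field
      arity : ℕ
      head  : AtomF arity
      body  : List (AtomF arity)
  open Clause public

  Program : Set
  Program = List Clause

  instances : (C : Clause) → Vec ℕ (arity C) → List Atom
  instances C env = List.map (λ b → funs b env) (body C)

  data Derivable (P : Program) : Atom → Set where
    rule : ∀ {C} → C ∈ P → ∀ env → All (Derivable P) (instances C env) → Derivable P (funs (head C) env)

  rule-at : ∀ {P} Q → (∀ {C} → C ∈ Q → C ∈ P) → ∀ i ρ →
    All (Derivable P) (instances (List.lookup Q i) ρ) → Derivable P (funs (head (List.lookup Q i)) ρ)
  rule-at Q ⊆ i = rule (⊆ (∈-lookup i))

  module _ {ℓ} (Sem : Atom → Set ℓ) where
    Sound : Clause → Set ℓ
    Sound C = ∀ env → All Sem (instances C env) → Sem (funs (head C) env)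

    module _ {P : Program} (sound : All Sound P) where
      mutual
        derivable-sound : ∀ {a} → Derivable P a → Sem a
        derivable-sound (rule C∈P env ds) = All.lookup sound C∈P env (derivable-sound* ds)

        derivable-sound* : ∀ {as} → All (Derivable P) as → All Sem as
        derivable-sound* []       = []
        derivable-sound* (d ∷ ds) = derivable-sound d ∷ derivable-sound* ds

  atomCode : Atom → ℕ
  atomCode (q ∷ a ∷ b ∷ c ∷ []) = ⟪ q , ⟪ a , ⟪ b , c ⟫ ⟫ ⟫

  atomCode-injective : ∀ a b → atomCode a ≡ atomCode b → a ≡ b
  atomCode-injective (q ∷ a ∷ b ∷ c ∷ []) (q′ ∷ a′ ∷ b′ ∷ c′ ∷ []) eq
    with refl , eq₁ ← ⟪⟫-injective eq
    with refl , eq₂ ← ⟪⟫-injective eq₁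
    with refl , refl ← ⟪⟫-injective eq₂ = refl

  infixr 5 _⟪,⟫_
  _⟪,⟫_ : ∀ {k} → Fun k → Fun k → Fun k
  f ⟪,⟫ g = pairF $$ (f ∷ g ∷ [])

  atomCodeF : Fun 4
  atomCodeF = as (arg 0F ⟪,⟫ arg 1F ⟪,⟫ arg 2F ⟪,⟫ arg 3F) atomCode λ { (q ∷ a ∷ b ∷ c ∷ []) → refl }

  envCode : ∀ {k} → Vec ℕ k → ℕ
  envCode []       = 0
  envCode (x ∷ xs) = ⟪ x , envCode xs ⟫

  env : ∀ k → ℕ → Vec ℕ k
  env zero    e = []
  env (suc k) e = fst e ∷ env k (snd e)

  env-envCode : ∀ {k} (xs : Vec ℕ k) → env k (envCode xs) ≡ xs
  env-envCode []       = refl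
  env-envCode (x ∷ xs) = cong₂ _∷_ (fst-⟪⟫ x _) (trans (cong (env _) (snd-⟪⟫ x _)) (env-envCode xs))

  envF : ∀ k {m} → Fun m → Vec (Fun m) k
  envF zero    f = []
  envF (suc k) f = fstF $$ (f ∷ []) ∷ envF k (sndF $$ (f ∷ []))

  funs-envF : ∀ k {m} (f : Fun m) xs → funs (envF k f) xs ≡ env k (fun f xs)
  funs-envF zero    f xs = refl
  funs-envF (suc k) f xs = cong (_ ∷_) (funs-envF k _ xs)

  -- A derivation is a list of items ⟪ atom , environment ⟫, each following
  -- from later ones by some clause.
  module Check (P : Program) where

    Follows : ℕ → ℕ → Clause → Set
    Follows item l C = fst item ≡ atomCode (funs (head C) ρ) ×
                       All (λ b → Member (atomCode b) l) (instances C ρ)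
      where ρ = env (arity C) (snd item)

    private
      itemF restF : Fun 2
      itemF = arg 0F
      restF = arg 1F

      module _ (C : Clause) where
        instanceF : AtomF (arity C) → Fun 2
        instanceF b = (atomCodeF $$ b) $$ envF (arity C) (sndF $$ (itemF ∷ []))

        bodyF : List (AtomF (arity C)) → Fun 2
        bodyF []       = lit 0
        bodyF (b ∷ bs) = memberF $$ (instanceF b ∷ restF ∷ []) +F bodyF bs

        followsF : Fun 2
        followsF = distanceF (fstF $$ (itemF ∷ [])) (instanceF (head C)) +F bodyF (body C)

        module _ (item l : ℕ) where
          private
            ρ : Vec ℕ (arity C)
            ρ = env (arity C) (snd item)

            xs : Vec ℕ 2
            xs = item ∷ l ∷ []

            fun-instance : ∀ b → fun (instanceF b) xs ≡ atomCode (funs b ρ)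
            fun-instance b = trans (atomCodeF-funs _) (cong (λ ρ → atomCode (funs b ρ)) (funs-envF (arity C) _ xs))
              where
              atomCodeF-funs : ∀ ρ → fun (atomCodeF $$ b) ρ ≡ atomCode (funs b ρ)
              atomCodeF-funs ρ with funs b ρ
              ... | as = refl

          body⁺ : ∀ bs → All (λ b → Member (atomCode b) l) (List.map (λ b → funs b ρ) bs) →
                  fun (bodyF bs) xs ≡ 0
          body⁺ []       []       = refl
          body⁺ (b ∷ bs) (m ∷ ms) = cong₂ _+_
            (member⁺ _ l (subst (λ x → Member x l) (sym (fun-instance b)) m)) (body⁺ bs ms)

          body⁻ : ∀ bs → fun (bodyF bs) xs ≡ 0 →
                  All (λ b → Member (atomCode b) l) (List.map (λ b → funs b ρ) bs)
          body⁻ []       eq = []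
          body⁻ (b ∷ bs) eq =
            subst (λ x → Member x l) (fun-instance b) (member⁻ _ l (m+n≡0⇒m≡0 _ eq)) ∷
            body⁻ bs (m+n≡0⇒n≡0 (member _ l) eq)

          follows⁺ : Follows item l C → fun followsF xs ≡ 0
          follows⁺ (eq , ms) = cong₂ _+_ {distance (fst item) _}
            (distance≡0⁺ (trans eq (sym (fun-instance (head C))))) (body⁺ (body C) ms)

          follows⁻ : fun followsF xs ≡ 0 → Follows item l C
          follows⁻ eq = trans (distance≡0⁻ _ _ (m+n≡0⇒m≡0 _ eq)) (fun-instance (head C)) ,
                        body⁻ (body C) (m+n≡0⇒n≡0 (distance (fst item) _) eq)

      someF : List Clause → Fun 2
      someF []       = lit 1
      someF (C ∷ Cs) = followsF C *F someF Cs

      some⁺ : ∀ {Cs C item l} → C ∈ Cs → Follows item l C → fun (someF Cs) (item ∷ l ∷ []) ≡ 0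
      some⁺ {C ∷ Cs} {item = item} {l} (here refl) f = cong (_* fun (someF Cs) (item ∷ l ∷ [])) (follows⁺ C item l f)
      some⁺ {C ∷ Cs} {item = item} {l} (there C∈) f =
        trans (cong (fun (followsF C) (item ∷ l ∷ []) *_) (some⁺ C∈ f)) (*-zeroʳ (fun (followsF C) (item ∷ l ∷ [])))

      some⁻ : ∀ {Cs item l} → fun (someF Cs) (item ∷ l ∷ []) ≡ 0 → ∃[ C ] C ∈ Cs × Follows item l C
      some⁻ {C ∷ Cs} {item} {l} eq with m*n≡0⇒m≡0∨n≡0 (fun (followsF C) (item ∷ l ∷ [])) eq
      ... | inj₁ p = C , here refl , follows⁻ C item l p
      ... | inj₂ p with some⁻ {Cs} p
      ...   | C′ , C∈ , f = C′ , there C∈ , f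

    stepOK : ℕ → ℕ
    stepOK s = s * fun (someF P) (hd s ∷ tl s ∷ [])

    valid : ℕ → ℕ
    valid l = ∑< (λ i → stepOK (suffix i l)) l

    validF : Fun 1
    validF = as
      (∑F (s *F someF P $$ (hdF $$ (s ∷ []) ∷ tlF $$ (s ∷ []) ∷ [])) $$ (arg 0F ∷ arg 0F ∷ []))
      (unary valid) λ { (l ∷ []) → refl }
      where
      s : Fun 2
      s = suffixF $$ (arg 0F ∷ arg 1F ∷ [])

    private
      sound-fuel : ∀ n l → l ≤ n → (∀ i → stepOK (suffix i l) ≡ 0) →
        ∀ i → suffix i l ≢ 0 → ∃[ a ] fst (hd (suffix i l)) ≡ atomCode a × Derivable P a
      sound-fuel n zero l≤n ok i ≢0 = contradiction (suffix-0 i) ≢0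
      sound-fuel (suc n) l@(suc l′) (s≤s l≤n) ok = at
        where
        later : ∀ i → suffix i (tl l) ≢ 0 → ∃[ a ] fst (hd (suffix i (tl l))) ≡ atomCode a × Derivable P a
        later = sound-fuel n (tl l) (≤-trans (tl-suc l′) l≤n)
          (λ i → trans (cong stepOK (suffix-tl i l)) (ok (suc i)))

        derive : ∀ as → All (λ b → Member (atomCode b) (tl l)) as → All (Derivable P) as
        derive []       []                    = []
        derive (b ∷ bs) ((i , ≢0 , eq) ∷ ms) with later i ≢0
        ... | a , eq′ , d with refl ← atomCode-injective a b (trans (sym eq′) eq) = d ∷ derive bs ms

        at : ∀ i → suffix i l ≢ 0 → ∃[ a ] fst (hd (suffix i l)) ≡ atomCode a × Derivable P a
        at zero    ≢0 with some⁻ {P} (m+n≡0⇒m≡0 _ (ok 0))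
        ... | C , C∈P , eq , ms = _ , eq , rule C∈P _ (derive _ ms)
        at (suc i) ≢0 rewrite sym (suffix-tl i l) = later i ≢0

    Checks : ℕ → Atom → Set
    Checks l a = valid l + member (atomCode a) l ≡ 0

    checks-sound : ∀ l a → Checks l a → Derivable P a
    checks-sound l a eq with member⁻ _ l (m+n≡0⇒n≡0 (valid l) eq)
    ... | i , ≢0 , eq₁ with sound-fuel l l ≤-refl ok i ≢0
      where
      ok : ∀ i → stepOK (suffix i l) ≡ 0
      ok i with suffix i l in eq₂
      ... | zero  = refl
      ... | suc s = trans (cong stepOK (sym eq₂)) (∑<≡0⁻ (m+n≡0⇒m≡0 _ eq)
        (suffix-bound l l ≤-refl i λ ≡0 → contradiction (trans (sym eq₂) ≡0) λ ()))
    ... | b , eq₂ , d with refl ← atomCode-injective b a (trans (sym eq₂) eq₁) = d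

    private
      data Valid : List ℕ → Set where
        []  : Valid []
        _∷_ : ∀ {item l} → (∃[ C ] C ∈ P × Follows item (listCode l) C) → Valid l → Valid (item ∷ l)

      Lists : List ℕ → ℕ → Set
      Lists l b = ∃[ item ] item ∈ l × fst item ≡ b

      Lists⇒Member : ∀ {l b} → Lists l b → Member b (listCode l)
      Lists⇒Member (item , item∈ , eq) = subst (λ b → Member b _) eq (Member-listCode item∈)

      Member⇒Lists : ∀ l {b} → Member b (listCode l) → Lists l b
      Member⇒Lists []      (i , ≢0 , eq) = contradiction (suffix-0 i) ≢0
      Member⇒Lists (x ∷ l) (zero , ≢0 , eq) = x , here refl , trans (cong fst (sym (hd-listCode x l))) eq
      Member⇒Lists (x ∷ l) (suc i , ≢0 , eq)
        with Member⇒Lists l (i , (λ ≡0 → ≢0 (trans (suffix-listCode i x l) ≡0)) ,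
                                 trans (cong (λ s → fst (hd s)) (sym (suffix-listCode i x l))) eq)
      ... | y , y∈ , eq′ = y , there y∈ , eq′

      Lists-++ˡ : ∀ {l m a} → Lists l a → Lists (l ++ m) a
      Lists-++ˡ (x , x∈ , eq) = x , ∈-++⁺ˡ x∈ , eq

      Lists-++ʳ : ∀ l {m a} → Lists m a → Lists (l ++ m) a
      Lists-++ʳ l (x , x∈ , eq) = x , ∈-++⁺ʳ l x∈ , eq

      Valid-++ : ∀ {l m} → Valid l → Valid m → Valid (l ++ m)
      Valid-++ [] w = w
      Valid-++ {x ∷ l} ((C , C∈ , eq , ms) ∷ v) w =
        (C , C∈ , eq , All.map (λ p → Lists⇒Member (Lists-++ˡ (Member⇒Lists l p))) ms) ∷ Valid-++ v w

      mutual
        linearise : ∀ {a} → Derivable P a → ∃[ l ] Valid l × Lists l (atomCode a)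
        linearise (rule {C} C∈ ρ ds) with linearise* ds
        ... | l , v , ms = item ∷ l , (C , C∈ , head-eq , body-ok) ∷ v , item , here refl , fst-⟪⟫ _ _
          where
          item = ⟪ atomCode (funs (head C) ρ) , envCode ρ ⟫
          ρ-eq : env (arity C) (snd item) ≡ ρ
          ρ-eq = trans (cong (env _) (snd-⟪⟫ _ _)) (env-envCode ρ)
          head-eq : fst item ≡ atomCode (funs (head C) (env (arity C) (snd item)))
          head-eq = trans (fst-⟪⟫ _ _) (cong (λ ρ → atomCode (funs (head C) ρ)) (sym ρ-eq))
          body-ok = subst (λ ρ → All (λ b → Member (atomCode b) (listCode l)) (instances C ρ)) (sym ρ-eq)
            (All.map Lists⇒Member ms)

        linearise* : ∀ {as} → All (Derivable P) as → ∃[ l ] Valid l × All (λ a → Lists l (atomCode a)) as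
        linearise* []       = [] , [] , []
        linearise* (d ∷ ds) with linearise d | linearise* ds
        ... | l , v , i | m , w , is = l ++ m , Valid-++ v w , Lists-++ˡ i ∷ All.map (Lists-++ʳ l) is

      stepOK-listCode : ∀ {l} → Valid l → ∀ i → stepOK (suffix i (listCode l)) ≡ 0
      stepOK-listCode [] i = cong stepOK (suffix-0 i)
      stepOK-listCode {x ∷ l} ((C , C∈ , f) ∷ v) zero = trans
        (cong₂ (λ h t → listCode (x ∷ l) * fun (someF P) (h ∷ t ∷ [])) (hd-listCode x l) (tl-listCode x l))
        (trans (cong (listCode (x ∷ l) *_) (some⁺ C∈ f)) (*-zeroʳ (listCode (x ∷ l))))
      stepOK-listCode {x ∷ l} (_ ∷ v) (suc i) =
        trans (cong stepOK (suffix-listCode i x l)) (stepOK-listCode v i)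

    checks-complete : ∀ {a} → Derivable P a → ∃[ l ] Checks l a
    checks-complete {a} d with linearise d
    ... | l , v , i = listCode l , cong₂ _+_
      (∑<≡0⁺ (listCode l) (stepOK-listCode v)) (member⁺ _ _ (Lists⇒Member i))

    private
      module _ (a : AtomF 1) where
        check : ℕ → ℕ → ℕ
        check l x = valid l + member (atomCode (funs a (x ∷ []))) l

        checkF : Fun 2
        checkF = as
          (validF $$ (arg 0F ∷ []) +F memberF $$ ((atomCodeF $$ a) $$ (arg 1F ∷ []) ∷ arg 0F ∷ []))
          (binary check) λ { (l ∷ x ∷ []) → refl }

      minimum : ∀ (f : Fun 2) x l → fun f (l ∷ x ∷ []) ≡ 0 →
        ∃[ m ] fun f (m ∷ x ∷ []) ≡ 0 × min (code f) ⟨ x ∷ [] ⟩↦ m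
      minimum f x l eq = search l 0 (λ _ ()) (subst (λ m → fun f (m ∷ x ∷ []) ≡ 0) (sym (+-identityʳ l)) eq)
        where
        search : ∀ gap m → (∀ z → z < m → ∃[ w ] code f ⟨ z ∷ x ∷ [] ⟩↦ suc w) →
          fun f (gap + m ∷ x ∷ []) ≡ 0 → ∃[ m ] fun f (m ∷ x ∷ []) ≡ 0 × min (code f) ⟨ x ∷ [] ⟩↦ m
        search gap m below eq with fun f (m ∷ x ∷ []) in eq′
        ... | zero = m , eq′ , min (subst (code f ⟨ m ∷ x ∷ [] ⟩↦_) eq′ (halts f _)) below
        search zero m below eq | suc w = contradiction (trans (sym eq′) eq) λ ()
        search (suc gap) m below eq | suc w = search gap (suc m) below′
          (subst (λ m → fun f (m ∷ x ∷ []) ≡ 0) (sym (+-suc gap m)) eq)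
          where
          below′ : ∀ z → z < suc m → ∃[ w ] code f ⟨ z ∷ x ∷ [] ⟩↦ suc w
          below′ z z≤m with m≤n⇒m<n∨m≡n (s≤s⁻¹ z≤m)
          ... | inj₁ z<m  = below z z<m
          ... | inj₂ refl = w , subst (code f ⟨ z ∷ x ∷ [] ⟩↦_) eq′ (halts f _)

    -- Post's theorem: search for a derivation of either atom.
    decide : ∀ (accept reject : AtomF 1) → ∃[ p ] ∀ x →
      (Derivable P (funs accept (x ∷ [])) → Derivable P (funs reject (x ∷ [])) → ⊥) →
      (Derivable P (funs accept (x ∷ [])) → p ⟨ x ∷ [] ⟩↦ 1) ×
      (Derivable P (funs reject (x ∷ [])) → p ⟨ x ∷ [] ⟩↦ 0)
    decide accept reject = comp (code answerF) (min (code bothF) ∷ proj 0F ∷ []) , λ x disjoint →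
      (λ d → let l , c = checks-complete d in by-yes x disjoint d (minimum bothF x l (cong (_* check reject l x) c))) ,
      (λ d → let l , c = checks-complete d in by-no x disjoint d
        (minimum bothF x l (trans (cong (check accept l x *_) c) (*-zeroʳ (check accept l x)))))
      where
      bothF answerF : Fun 2
      bothF = as (checkF accept *F checkF reject) (binary λ l x → check accept l x * check reject l x)
        λ { (l ∷ x ∷ []) → refl }
      answerF = as (lit 1 ∸F checkF accept) (binary λ l x → 1 ∸ check accept l x) λ { (l ∷ x ∷ []) → refl }

      Found : ℕ → Set
      Found x = ∃[ m ] fun bothF (m ∷ x ∷ []) ≡ 0 × min (code bothF) ⟨ x ∷ [] ⟩↦ m

      answer : ∀ {x m y} → min (code bothF) ⟨ x ∷ [] ⟩↦ m → 1 ∸ check accept m x ≡ y →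
        comp (code answerF) (min (code bothF) ∷ proj 0F ∷ []) ⟨ x ∷ [] ⟩↦ y
      answer {x} {m} run eq = comp (run ∷ proj 0F ∷ []) (subst (code answerF ⟨ m ∷ x ∷ [] ⟩↦_) eq (halts answerF _))

      by-yes : ∀ x → (Derivable P (funs accept (x ∷ [])) → Derivable P (funs reject (x ∷ [])) → ⊥) →
        Derivable P (funs accept (x ∷ [])) → Found x → _
      by-yes x disjoint d (m , eq , run) with m*n≡0⇒m≡0∨n≡0 (check accept m x) eq
      ... | inj₁ p = answer run (cong (1 ∸_) p)
      ... | inj₂ p = contradiction (checks-sound m _ p) (disjoint d)

      by-no : ∀ x → (Derivable P (funs accept (x ∷ [])) → Derivable P (funs reject (x ∷ [])) → ⊥) →
        Derivable P (funs reject (x ∷ [])) → Found x → _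
      by-no x disjoint d (m , eq , run) with check accept m x in eq′
      ... | zero  = contradiction d (disjoint (checks-sound m _ eq′))
      ... | suc n = answer run (trans (cong (1 ∸_) eq′) (0∸n≡0 n))

open Computability
open HornPrograms hiding (member)


least : (∀ a → ExcludedMiddle a) → ∀ {q} (Q : ℕ → Set q) → ∃ Q → ∃[ n ] Q n × (∀ m → Q m → n ℕ.≤ m)
least em {q} Q (n , Qn) = <-rec (λ n → Q n → ∃[ n ] Q n × (∀ m → Q m → n ℕ.≤ m)) search n Qn
  where
  search : ∀ n → (∀ {m} → m ℕ.< n → Q m → ∃[ n ] Q n × (∀ m → Q m → n ℕ.≤ m)) →
           Q n → ∃[ n ] Q n × (∀ m → Q m → n ℕ.≤ m)
  search n smaller Qn with em q {∃[ m ] m ℕ.< n × Q m}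
  ... | yes (m , m<n , Qm) = smaller m<n Qm
  ... | no none = n , Qn , λ m Qm → ℕ.≮⇒≥ (λ m<n → none (m , m<n , Qm))

module Subrings {c ℓ} (T : CommutativeRing c ℓ) where
  open CommutativeRing T public
  open RingProperties ring public using (-1*x≈-x)
  open SemiringExp semiring public using (_^_; ^-homo-*)
  open SemiringSolver commutativeSemiring public using (solve; _:=_; _:+_; _:*_)

  private
    variable
      a s t u v w x : Carrier
      d e : ℕ
      l l′ : List Carrier

  Subset : Set _
  Subset = Pred Carrier (c ⊔ ℓ)

  infix 4 _≉0
  _≉0 : Carrier → Set ℓ
  v ≉0 = ¬ (v ≈ 0#)

  record IsSubring (S : Subset) : Set (c ⊔ ℓ) where
    field
      resp : u ≈ v → S u → S v
      0∈   : S 0#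
      1∈   : S 1#
      +∈   : S u → S v → S (u + v)
      *∈   : S u → S v → S (u * v)
      -1∈  : S (- 1#)

  v-w+w : ∀ v w → (v + (- 1#) * w) + w ≈ v
  v-w+w v w = trans (+-assoc v _ w) (trans (+-congˡ (trans (+-congʳ (-1*x≈-x w)) (-‿inverseˡ w))) (+-identityʳ v))

  cancel-neg : ∀ w → w + (- 1#) * w ≈ 0#
  cancel-neg w = trans (+-congˡ (-1*x≈-x w)) (-‿inverseʳ w)

  data Comb (S : Subset) : List Carrier → Subset where
    nil  : v ≈ 0# → Comb S [] v
    cons : S a → Comb S l w → v ≈ a * t + w → Comb S (t ∷ l) v

  Comb-mono : ∀ {S S′ : Subset} → (∀ {v} → S v → S′ v) → Comb S l v → Comb S′ l v
  Comb-mono ⊆ (nil eq)      = nil eq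
  Comb-mono ⊆ (cons a p eq) = cons (⊆ a) (Comb-mono ⊆ p) eq

  Comb-resp : ∀ {S} → u ≈ v → Comb S l u → Comb S l v
  Comb-resp eq (nil eq′)      = nil (trans (sym eq) eq′)
  Comb-resp eq (cons a p eq′) = cons a p (trans (sym eq) eq′)

  module _ {S : Subset} (isSubring : IsSubring S) where
    open IsSubring isSubring

    Comb-0 : ∀ l → Comb S l 0#
    Comb-0 []      = nil refl
    Comb-0 (t ∷ l) = cons 0∈ (Comb-0 l) (sym (trans (+-identityʳ _) (zeroˡ t)))

    Comb-+ : Comb S l u → Comb S l v → Comb S l (u + v)
    Comb-+ (nil p) (nil q) = nil (trans (+-cong p q) (+-identityˡ 0#))
    Comb-+ (cons {a = a} {w = w} {t = t} a∈ p eq) (cons {a = a′} {w = w′} a′∈ p′ eq′) =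
      cons (+∈ a∈ a′∈) (Comb-+ p p′) (trans (+-cong eq eq′)
        (solve 5 (λ a a′ t w w′ → (a :* t :+ w) :+ (a′ :* t :+ w′) := (a :+ a′) :* t :+ (w :+ w′)) refl a a′ t w w′))

    Comb-* : S s → Comb S l v → Comb S l (s * v)
    Comb-* {s} s∈ (nil p) = nil (trans (*-congˡ p) (zeroʳ s))
    Comb-* {s} s∈ (cons {a = a} {w = w} {t = t} a∈ p eq) = cons (*∈ s∈ a∈) (Comb-* s∈ p)
      (trans (*-congˡ eq) (solve 4 (λ s a t w → s :* (a :* t :+ w) := (s :* a) :* t :+ s :* w) refl s a t w))

    Comb-skip : Comb S l v → Comb S (t ∷ l) v
    Comb-skip {t = t} p = cons 0∈ p (sym (trans (+-congʳ (zeroˡ t)) (+-identityˡ _)))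

    Comb-head : ∀ t l → Comb S (t ∷ l) t
    Comb-head t l = cons 1∈ (Comb-0 l) (sym (trans (+-identityʳ _) (*-identityˡ t)))

    Comb-all : (l : List Carrier) → All (Comb S l) l
    Comb-all []      = []
    Comb-all (t ∷ l) = Comb-head t l ∷ All.map Comb-skip (Comb-all l)

    Comb-trans : All (Comb S l) l′ → Comb S l′ v → Comb S l v
    Comb-trans {l} [] (nil p) = Comb-resp (sym p) (Comb-0 l)
    Comb-trans (p ∷ ps) (cons a∈ q eq) = Comb-resp (sym eq) (Comb-+ (Comb-* a∈ p) (Comb-trans ps q))

  -- The values at x of polynomials over S, in Horner form: of those of degree
  -- less than d, and of the monic ones of degree d.

  data Poly< (S : Subset) (x : Carrier) : ℕ → Subset where
    nil  : v ≈ 0# → Poly< S x 0 v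
    cons : S s → Poly< S x d w → v ≈ s + x * w → Poly< S x (suc d) v

  data Monic (S : Subset) (x : Carrier) : ℕ → Subset where
    one  : v ≈ 1# → Monic S x 0 v
    cons : S s → Monic S x d w → v ≈ s + x * w → Monic S x (suc d) v

  Poly : Subset → Carrier → Subset
  Poly S x v = ∃[ d ] Poly< S x d v

  Poly<-resp : ∀ {S} → u ≈ v → Poly< S x d u → Poly< S x d v
  Poly<-resp eq (nil p)      = nil (trans (sym eq) p)
  Poly<-resp eq (cons s p q) = cons s p (trans (sym eq) q)

  Monic-resp : ∀ {S} → u ≈ v → Monic S x d u → Monic S x d v
  Monic-resp eq (one p)      = one (trans (sym eq) p)
  Monic-resp eq (cons s p q) = cons s p (trans (sym eq) q)

  Poly<-mono : ∀ {S S′ : Subset} → (∀ {v} → S v → S′ v) → Poly< S x d v → Poly< S′ x d v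
  Poly<-mono ⊆ (nil p)      = nil p
  Poly<-mono ⊆ (cons s p q) = cons (⊆ s) (Poly<-mono ⊆ p) q

  module _ {S : Subset} (isSubring : IsSubring S) {x : Carrier} where
    open IsSubring isSubring

    Poly<-0 : ∀ d → Poly< S x d 0#
    Poly<-0 zero    = nil refl
    Poly<-0 (suc d) = cons 0∈ (Poly<-0 d) (sym (trans (+-identityˡ _) (zeroʳ x)))

    Poly<-+ : Poly< S x d u → Poly< S x d v → Poly< S x d (u + v)
    Poly<-+ (nil p) (nil q) = nil (trans (+-cong p q) (+-identityˡ 0#))
    Poly<-+ (cons {s = s} {w = w} s∈ p eq) (cons {s = s′} {w = w′} s′∈ p′ eq′) =
      cons (+∈ s∈ s′∈) (Poly<-+ p p′) (trans (+-cong eq eq′)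
        (solve 5 (λ s s′ x w w′ → (s :+ x :* w) :+ (s′ :+ x :* w′) := (s :+ s′) :+ x :* (w :+ w′)) refl s s′ x w w′))

    Poly<-scale : S a → Poly< S x d v → Poly< S x d (a * v)
    Poly<-scale {a} a∈ (nil p) = nil (trans (*-congˡ p) (zeroʳ a))
    Poly<-scale {a} a∈ (cons {s = s} {w = w} s∈ p eq) = cons (*∈ a∈ s∈) (Poly<-scale a∈ p)
      (trans (*-congˡ eq) (solve 4 (λ a s x w → a :* (s :+ x :* w) := a :* s :+ x :* (a :* w)) refl a s x w))

    Poly<-≤ : d ℕ.≤ e → Poly< S x d v → Poly< S x e v
    Poly<-≤ {e = e} z≤n       (nil p)        = Poly<-resp (sym p) (Poly<-0 e)
    Poly<-≤         (s≤s d≤e) (cons s∈ p eq) = cons s∈ (Poly<-≤ d≤e p) eq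

    Poly<-const : S s → Poly< S x 1 s
    Poly<-const s∈ = cons s∈ (nil refl) (sym (trans (+-congˡ (zeroʳ x)) (+-identityʳ _)))

    Poly<-shift : Poly< S x d v → Poly< S x (suc d) (x * v)
    Poly<-shift p = cons 0∈ p (sym (+-identityˡ _))

    Poly<-shift^ : ∀ e → Poly< S x d v → Poly< S x (e ℕ.+ d) (x ^ e * v)
    Poly<-shift^ zero    p = Poly<-resp (sym (*-identityˡ _)) p
    Poly<-shift^ (suc e) p = Poly<-resp (sym (*-assoc x _ _)) (Poly<-shift (Poly<-shift^ e p))

    Poly<-* : Poly< S x d u → Poly< S x e v → Poly< S x (d ℕ.+ e) (u * v)
    Poly<-* {e = e} {v} (nil p) q = Poly<-resp (sym (trans (*-congʳ p) (zeroˡ v))) (Poly<-0 e)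
    Poly<-* {e = e} {v} (cons {s = s} {d = d} {w = w} s∈ p eq) q = Poly<-resp
      (trans (solve 4 (λ s x w v → s :* v :+ x :* (w :* v) := (s :+ x :* w) :* v) refl s x w v) (*-congʳ (sym eq)))
      (Poly<-+ (Poly<-≤ (ℕ.≤-trans (ℕ.m≤n+m e d) (ℕ.n≤1+n _)) (Poly<-scale s∈ q)) (Poly<-shift (Poly<-* p q)))

    Monic⇒Poly< : Monic S x d v → Poly< S x (suc d) v
    Monic⇒Poly< (one p)        = Poly<-resp (sym p) (Poly<-const 1∈)
    Monic⇒Poly< (cons s∈ p eq) = cons s∈ (Monic⇒Poly< p) eq

    Monic-+ : Monic S x d v → Poly< S x d w → Monic S x d (v + w)
    Monic-+ (one p) (nil q) = one (trans (+-cong p q) (+-identityʳ 1#))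
    Monic-+ (cons {s = s} {w = w} s∈ p eq) (cons {s = s′} {w = w′} s′∈ p′ eq′) =
      cons (+∈ s∈ s′∈) (Monic-+ p p′) (trans (+-cong eq eq′)
        (solve 5 (λ s s′ x w w′ → (s :+ x :* w) :+ (s′ :+ x :* w′) := (s :+ s′) :+ x :* (w :+ w′)) refl s s′ x w w′))

    Monic-shift : Monic S x d v → Monic S x (suc d) (x * v)
    Monic-shift p = cons 0∈ p (sym (+-identityˡ _))

    Monic-* : Monic S x d u → Monic S x e v → Monic S x (d ℕ.+ e) (u * v)
    Monic-* {v = v} (one p) q = Monic-resp (sym (trans (*-congʳ p) (*-identityˡ v))) q
    Monic-* {e = e} {v} (cons {s = s} {d = d} {w = w} s∈ p eq) q = Monic-resp
      (trans (solve 4 (λ s x w v → x :* (w :* v) :+ s :* v := (s :+ x :* w) :* v) refl s x w v) (*-congʳ (sym eq)))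
      (Monic-+ (Monic-shift (Monic-* p q)) (Poly<-≤ (s≤s (ℕ.m≤n+m e d)) (Poly<-scale s∈ (Monic⇒Poly< q))))

    Poly<-top : ∀ d → Poly< S x (suc d) v → ∃[ a ] S a × ∃[ w ] Poly< S x d w × v ≈ w + a * x ^ d
    Poly<-top zero (cons {s = s} s∈ (nil p) eq) = s , s∈ , 0# , nil refl ,
      trans eq (trans (+-congˡ (trans (*-congˡ p) (zeroʳ x)))
        (trans (+-comm s 0#) (+-congˡ (sym (*-identityʳ s)))))
    Poly<-top (suc d) (cons {s = s} s∈ p eq) with Poly<-top d p
    ... | a , a∈ , w , w∈ , eq′ = a , a∈ , s + x * w , cons s∈ w∈ refl , trans eq (trans (+-congˡ (*-congˡ eq′))
      (solve 5 (λ s x w a y → s :+ x :* (w :+ a :* y) := (s :+ x :* w) :+ a :* (x :* y)) refl s x w a (x ^ d)))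

    Monic-top : ∀ d → Monic S x d v → ∃[ w ] Poly< S x d w × v ≈ w + x ^ d
    Monic-top zero (one p) = 0# , nil refl , trans p (sym (+-identityˡ 1#))
    Monic-top (suc d) (cons {s = s} s∈ p eq) with Monic-top d p
    ... | w , w∈ , eq′ = s + x * w , cons s∈ w∈ refl , trans eq (trans (+-congˡ (*-congˡ eq′))
      (solve 4 (λ s x w y → s :+ x :* (w :+ y) := (s :+ x :* w) :+ x :* y) refl s x w (x ^ d)))

    Poly-subring : IsSubring (Poly S x)
    Poly-subring = record
      { resp = λ eq (d , p) → d , Poly<-resp eq p
      ; 0∈   = 0 , nil refl
      ; 1∈   = 1 , Poly<-const 1∈
      ; +∈   = λ (d , p) (e , q) → d ℕ.+ e ,
               Poly<-+ (Poly<-≤ (ℕ.m≤m+n d e) p) (Poly<-≤ (ℕ.m≤n+m e d) q)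
      ; *∈   = λ (d , p) (e , q) → d ℕ.+ e , Poly<-* p q
      ; -1∈  = 1 , Poly<-const -1∈
      }

    Poly-const : S s → Poly S x s
    Poly-const s∈ = 1 , Poly<-const s∈

    Poly-var : Poly S x x
    Poly-var = 2 , Poly<-resp (*-identityʳ x) (Poly<-shift (Poly<-const 1∈))

    module _ {e z} (monic : Monic S x e z) (z≈0 : z ≈ 0#) where
      reduce-top : Poly< S x (suc e) v → Poly< S x e v
      reduce-top p with Poly<-top e p | Monic-top e monic
      ... | a , a∈ , w , w∈ , eq | w′ , w′∈ , eq′ = Poly<-resp
        (trans (sym (+-identityʳ _)) (trans (+-congˡ (sym (trans (*-congˡ z≈0) (zeroʳ a))))
        (trans (+-congˡ (*-congˡ eq′))
        (trans (solve 5 (λ w a m w′ y → (w :+ a :* (m :* w′)) :+ a :* (w′ :+ y) := (w :+ a :* y) :+ a :* (w′ :+ m :* w′)) refl w a (- 1#) w′ (x ^ e))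
        (trans (+-congˡ (trans (*-congˡ (cancel-neg w′)) (zeroʳ a)))
        (trans (+-identityʳ _) (sym eq)))))))
        (Poly<-+ w∈ (Poly<-scale a∈ (Poly<-scale -1∈ w′∈)))

      reduce : Poly< S x d v → Poly< S x e v
      reduce (nil p)        = Poly<-resp (sym p) (Poly<-0 e)
      reduce (cons s∈ p eq) = reduce-top (cons s∈ (reduce p) eq)

  Adjoin : Subset → List Carrier → Subset
  Adjoin S []       = S
  Adjoin S (x ∷ xs) = Adjoin (Poly S x) xs

  Adjoin-subring : ∀ {S} → IsSubring S → ∀ xs → IsSubring (Adjoin S xs)
  Adjoin-subring S []       = S
  Adjoin-subring S (x ∷ xs) = Adjoin-subring (Poly-subring S) xs

  Adjoin-base : ∀ {S} → IsSubring S → ∀ xs → S v → Adjoin S xs v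
  Adjoin-base S []       v∈ = v∈
  Adjoin-base S (x ∷ xs) v∈ = Adjoin-base (Poly-subring S) xs (Poly-const S v∈)

  Adjoin-generators : ∀ {S} → IsSubring S → ∀ xs → All (Adjoin S xs) xs
  Adjoin-generators S []       = []
  Adjoin-generators S (x ∷ xs) =
    Adjoin-base (Poly-subring S) xs (Poly-var S) ∷ Adjoin-generators (Poly-subring S) xs

  Adjoin-mono : ∀ {S S′ : Subset} → (∀ {v} → S v → S′ v) → ∀ xs → Adjoin S xs v → Adjoin S′ xs v
  Adjoin-mono ⊆ []       p = ⊆ p
  Adjoin-mono ⊆ (x ∷ xs) p = Adjoin-mono (λ (d , q) → d , Poly<-mono ⊆ q) xs p

module Noetherian (em : ∀ a → ExcludedMiddle a) {c ℓ} (T : CommutativeRing c ℓ) where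
  open Subrings T

  -- The ascending chain condition, in inductive form.
  data Noeth (S : Subset) (l : List Carrier) : Set (c ⊔ ℓ) where
    extend : (∀ v → S v → ¬ Comb S l v → Noeth S (v ∷ l)) → Noeth S l

  record IsIdealOf {i} (S : Subset) (I : Pred Carrier i) : Set (c ⊔ ℓ ⊔ i) where
    field
      resp : ∀ {u v} → u ≈ v → I u → I v
      +∈   : ∀ {u v} → I u → I v → I (u + v)
      *∈   : ∀ {s v} → S s → I v → I (s * v)

  Comb-ideal : ∀ {i S} {I : Pred Carrier i} → IsIdealOf S I → I 0# → ∀ {l v} → All I l → Comb S l v → I v
  Comb-ideal ideal 0∈ []       (nil eq)       = IsIdealOf.resp ideal (sym eq) 0∈
  Comb-ideal ideal 0∈ (p ∷ ps) (cons a∈ q eq) =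
    IsIdealOf.resp ideal (sym eq) (IsIdealOf.+∈ ideal (IsIdealOf.*∈ ideal a∈ p) (Comb-ideal ideal 0∈ ps q))

  FinitelyGenerated : ∀ {i} → Subset → Pred Carrier i → Set _
  FinitelyGenerated S I = ∃[ F ] All I F × (∀ v → S v → I v → Comb S F v)

  generated : ∀ {i S} {I : Pred Carrier i} → Noeth S [] → FinitelyGenerated S I
  generated {i} {S} {I} noeth = search noeth []
    where
    search : ∀ {l} → Noeth S l → All I l → FinitelyGenerated S I
    search {l} (extend next) l⊆ with em (c ⊔ ℓ ⊔ i) {∃[ v ] S v × I v × ¬ Comb S l v}
    ... | yes (v , v∈S , v∈I , v∉) = search (next v v∈S v∉) (v∈I ∷ l⊆)
    ... | no none = l , l⊆ , λ v v∈S v∈I → decidable-stable (em _) (λ v∉ → none (v , v∈S , v∈I , v∉))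

  -- Conversely, along an infinite extension the union of the ideals would be finitely generated.
  noetherian : ∀ {S} → IsSubring S →
    (∀ (I : Subset) → IsIdealOf S I → I 0# → FinitelyGenerated S I) → Noeth S []
  noetherian {S} isSubring fg = decidable-stable (em _) λ bad → absurd bad
    where
    outside : ∀ {l} → ¬ Noeth S l → ∃[ v ] S v × ¬ Comb S l v × ¬ Noeth S (v ∷ l)
    outside {l} bad = decidable-stable (em _) λ none → bad (extend λ v v∈ v∉ →
      decidable-stable (em _) λ bad′ → none (v , v∈ , v∉ , bad′))

    module _ (bad : ¬ Noeth S []) where
      chain : ℕ → ∃[ l ] ¬ Noeth S l
      chain zero    = [] , bad
      chain (suc n) = let v , _ , _ , bad′ = outside (proj₂ (chain n)) in v ∷ _ , bad′

      I : Subset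
      I v = ∃[ n ] Comb S (proj₁ (chain n)) v

      longer : ∀ m n {v} → Comb S (proj₁ (chain n)) v → Comb S (proj₁ (chain (m ℕ.+ n))) v
      longer zero    n p = p
      longer (suc m) n p = Comb-skip isSubring (longer m n p)

      longer′ : ∀ m n {v} → Comb S (proj₁ (chain n)) v → Comb S (proj₁ (chain (n ℕ.+ m))) v
      longer′ m n {v} p = ≡.subst (λ k → Comb S (proj₁ (chain k)) v) (ℕ.+-comm m n) (longer m n p)

      ideal : IsIdealOf S I
      ideal = record
        { resp = λ eq (n , p) → n , Comb-resp eq p
        ; +∈   = λ (n , p) (m , q) → n ℕ.+ m , Comb-+ isSubring (longer′ m n p) (longer n m q)
        ; *∈   = λ s∈ (n , p) → n , Comb-* isSubring s∈ p
        }

      bounded : ∀ {F} → All I F → ∃[ n ] All (Comb S (proj₁ (chain n))) F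
      bounded []             = 0 , []
      bounded ((n , p) ∷ ps) with bounded ps
      ... | m , qs = n ℕ.+ m , longer′ m n p ∷ All.map (longer n m) qs

      absurd : _
      absurd with fg I ideal (0 , nil refl)
      ... | F , F⊆ , gen with bounded F⊆
      ... | n , F⊆n with outside (proj₂ (chain n)) in eq
      ... | v , v∈ , v∉ , _ = v∉ (Comb-trans isSubring F⊆n (gen v v∈ (suc n , v∈next)))
        where
        v∈next : Comb S (proj₁ (chain (suc n))) v
        v∈next rewrite eq = Comb-head isSubring v _

  -- Hilbert's basis theorem: elements of minimal degree outside of the ideal
  -- generated so far have leading coefficients extending an ideal of S.
  module _ {S : Subset} (isSubring : IsSubring S) (x : Carrier) where
    private
      module S = IsSubring isSubring
      S[x] = Poly S x
      isSubring[x] = Poly-subring isSubring {x}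

    module _ {i} {I : Pred Carrier i} (ideal : IsIdealOf S[x] I) (0∈ : I 0#) where
      private
        module I = IsIdealOf ideal

      data Leading : List Carrier → List Carrier → ℕ → Set (c ⊔ ℓ ⊔ i) where
        []   : ∀ {D} → Leading [] [] D
        cons : ∀ {a as g gs w d D} → S a → Poly< S x d w → g ≈ w + a * x ^ d → d ℕ.≤ D → I g →
               Leading as gs D → Leading (a ∷ as) (g ∷ gs) D

      Leading-≤ : ∀ {as gs D D′} → D ℕ.≤ D′ → Leading as gs D → Leading as gs D′
      Leading-≤ D≤ []                      = []
      Leading-≤ D≤ (cons a∈ w∈ eq d≤ g∈ L) = cons a∈ w∈ eq (ℕ.≤-trans d≤ D≤) g∈ (Leading-≤ D≤ L)

      Leading-ideal : ∀ {as gs D} → Leading as gs D → All I gs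
      Leading-ideal []                     = []
      Leading-ideal (cons _ _ _ _ g∈ L) = g∈ ∷ Leading-ideal L

      lift-Comb : ∀ {as gs D a} → Leading as gs D → Comb S as a →
             ∃[ u ] Comb S[x] gs u × ∃[ w ] Poly< S x D w × u ≈ w + a * x ^ D
      lift-Comb {D = D} {a} [] (nil eq) = 0# , nil refl , 0# , Poly<-0 isSubring D ,
        sym (trans (+-congˡ (trans (*-congʳ eq) (zeroˡ _))) (+-identityˡ 0#))
      lift-Comb {D = D} (cons {a = a} {g = g} {w = w} {d = d} a∈ w∈ g≈ d≤D g∈ L) (cons {a = k} {w = b} k∈ p eq)
        with lift-Comb L p
      ... | u , u∈ , w′ , w′∈ , u≈ =
        (k * y) * g + u ,
        cons (IsSubring.*∈ isSubring[x] (Poly-const isSubring k∈) y∈) u∈ refl ,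
        k * (y * w) + w′ ,
        Poly<-+ isSubring (Poly<-scale isSubring k∈
          (≡.subst (λ n → Poly< S x n (y * w)) (ℕ.m∸n+n≡m d≤D) (Poly<-shift^ isSubring (D ℕ.∸ d) w∈))) w′∈ ,
        trans (+-cong (*-congˡ g≈) u≈)
        (trans (solve 8 (λ k y w a z w′ b Y → (k :* y) :* (w :+ a :* z) :+ (w′ :+ b :* Y) :=
                                              (k :* (y :* w) :+ w′) :+ ((k :* a) :* (y :* z) :+ b :* Y)) refl k y w a (x ^ d) w′ b (x ^ D))
        (+-congˡ (trans (+-congʳ (*-congˡ yz≈))
        (trans (sym (distribʳ (x ^ D) (k * a) b)) (*-congʳ (sym eq))))))
        where
        y = x ^ (D ℕ.∸ d)
        y∈ : S[x] y
        y∈ = _ , Poly<-resp (*-identityʳ y) (Poly<-shift^ isSubring (D ℕ.∸ d) (Poly<-const isSubring S.1∈))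
        yz≈ : y * x ^ d ≈ x ^ D
        yz≈ = trans (sym (^-homo-* x (D ℕ.∸ d) d)) (reflexive (≡.cong (x ^_) (ℕ.m∸n+n≡m d≤D)))

      basis : ∀ {as gs D} → Noeth S as → Leading as gs D →
        (∀ e v → I v → Poly< S x e v → ¬ Comb S[x] gs v → D ℕ.< e) → FinitelyGenerated S[x] I
      basis {as} {gs} {D} (extend next) L minimal
        with em (c ⊔ ℓ ⊔ i) {∃[ e ] ∃[ v ] I v × Poly< S x e v × ¬ Comb S[x] gs v}
      ... | no none = gs , Leading-ideal L , λ v (e , p) v∈I →
        decidable-stable (em _) λ v∉ → none (e , v , v∈I , p , v∉)
      ... | yes some with least em _ some
      ... | zero , (v , v∈I , p , v∉) , least-e = contradiction (minimal 0 v v∈I p v∉) λ ()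
      ... | suc d , (v , v∈I , p , v∉) , least-e with Poly<-top isSubring d p
      ... | a , a∈ , w , w∈ , v≈ = basis (next a a∈ a∉) (cons a∈ w∈ v≈ ℕ.≤-refl v∈I L′)
        λ e u u∈I q u∉ → least-e e (u , u∈I , q , λ u∈ → u∉ (Comb-skip isSubring[x] u∈))
        where
        D≤d : D ℕ.≤ d
        D≤d = ℕ.s≤s⁻¹ (minimal (suc d) v v∈I p v∉)
        L′ = Leading-≤ D≤d L
        a∉ : ¬ Comb S as a
        a∉ a∈as with lift-Comb L′ a∈as
        ... | u , u∈ , w′ , w′∈ , u≈ = ℕ.1+n≰n (least-e d (v + (- 1#) * u ,
          I.+∈ v∈I (I.*∈ -1∈ (Comb-ideal ideal 0∈ (Leading-ideal L) u∈)) ,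
          Poly<-resp difference (Poly<-+ isSubring w∈ (Poly<-scale isSubring S.-1∈ w′∈)) ,
          λ v-u∈ → v∉ (Comb-resp (v-w+w v u) (Comb-+ isSubring[x] v-u∈ u∈))))
          where
          -1∈ = IsSubring.-1∈ isSubring[x]
          y = a * x ^ d
          difference : w + (- 1#) * w′ ≈ v + (- 1#) * u
          difference = sym (trans (+-cong v≈ (*-congˡ u≈))
            (trans (solve 4 (λ w y m w′ → (w :+ y) :+ m :* (w′ :+ y) := (w :+ m :* w′) :+ (y :+ m :* y)) refl w y (- 1#) w′)
            (trans (+-congˡ (cancel-neg y)) (+-identityʳ _))))

    Noeth-Poly : Noeth S [] → Noeth S[x] []
    Noeth-Poly noeth = noetherian isSubring[x] λ I ideal 0∈ →
      basis ideal 0∈ noeth [] (λ { zero v v∈I (nil eq) v∉ → contradiction (nil eq) v∉ ; (suc e) v _ _ _ → s≤s z≤n })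

  Noeth-Adjoin : ∀ {S} → IsSubring S → ∀ xs → Noeth S [] → Noeth (Adjoin S xs) []
  Noeth-Adjoin S []       noeth = noeth
  Noeth-Adjoin S (x ∷ xs) noeth = Noeth-Adjoin (Poly-subring S) xs (Noeth-Poly S x noeth)

  Noeth-field : ∀ {S} → IsSubring S → (∀ {v} → S v → v ≉0 → ∃[ w ] S w × v * w ≈ 1#) → Noeth S []
  Noeth-field {S} isSubring inverse = extend λ v v∈ v∉ → extend λ u u∈ u∉ → contradiction
    (let w , w∈ , vw≈1 = inverse v∈ (λ eq → v∉ (nil eq)) in
     cons (*∈ u∈ w∈) (nil refl) (sym (trans (+-identityʳ _)
       (trans (*-assoc u w v) (trans (*-congˡ (trans (*-comm w v) vw≈1)) (*-identityʳ u))))))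
    u∉
    where open IsSubring isSubring

module FiniteType (em : ∀ a → ExcludedMiddle a) {c ℓ} (K : CommutativeRing c ℓ) (isField : IsField K) where
  open Subrings K

  private
    m : Carrier
    m = - 1#

    1≉0 : 1# ≉0
    1≉0 = proj₁ isField

    inverse : ∀ v → v ≉0 → ∃[ w ] v * w ≈ 1#
    inverse = proj₂ isField

  no-zero-divisors : ∀ {u v} → u * v ≈ 0# → u ≉0 → v ≈ 0#
  no-zero-divisors {u} {v} uv≈0 u≉0 = let w , uw≈1 = inverse u u≉0 in
    trans (sym (*-identityˡ v)) (trans (*-congʳ (trans (sym uw≈1) (*-comm u w)))
      (trans (*-assoc w u v) (trans (*-congˡ uv≈0) (zeroʳ w))))

  *-≉0 : ∀ {u v} → u ≉0 → v ≉0 → (u * v) ≉0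
  *-≉0 u≉0 v≉0 uv≈0 = v≉0 (no-zero-divisors uv≈0 u≉0)

  difference≈0 : ∀ {u v} → u + m * v ≈ 0# → u ≈ v
  difference≈0 {u} {v} eq = trans (sym (v-w+w u v)) (trans (+-congʳ eq) (+-identityˡ v))

  record IsSubfieldOf (k : Subset) : Set (c ⊔ ℓ) where
    field
      isSubring : IsSubring k
      inverse∈  : ∀ {v w} → k v → v * w ≈ 1# → k w
    open IsSubring isSubring public

  Algebraic : Subset → Carrier → Set (c ⊔ ℓ)
  Algebraic k x = ∃[ e ] ∃[ z ] Monic k x e z × z ≈ 0#

  module _ {k : Subset} (isSubfield : IsSubfieldOf k) where
    private
      module k = IsSubfieldOf isSubfield
      isSubring = k.isSubring

    normalise : ∀ {x d v} → Poly< k x d v → v ≉0 →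
      ∃[ e ] e ℕ.< d × (∃[ w ] Monic k x e w × (∃[ a ] k a × a ≉0 × v ≈ a * w))
    normalise (nil eq) v≉0 = contradiction eq v≉0
    normalise {x} {v = v} (cons {s = s} {w = w} s∈ p eq) v≉0 with em ℓ {w ≈ 0#}
    ... | yes w≈0 = 0 , s≤s z≤n , 1# , one refl , s , s∈ ,
      (λ s≈0 → v≉0 (trans v≈s s≈0)) , trans v≈s (sym (*-identityʳ s))
      where
      v≈s : v ≈ s
      v≈s = trans eq (trans (+-congˡ (trans (*-congˡ w≈0) (zeroʳ x))) (+-identityʳ s))
    ... | no w≉0 with normalise p w≉0
    ...   | e , e<d , w′ , monic , a , a∈ , a≉0 , w≈ with inverse a a≉0
    ...     | a′ , aa′≈1 = suc e , s≤s e<d , a′ * s + x * w′ ,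
      cons (k.*∈ (k.inverse∈ a∈ aa′≈1) s∈) monic refl , a , a∈ , a≉0 ,
      trans eq (trans (+-cong (sym (trans (*-congʳ aa′≈1) (*-identityˡ s))) (*-congˡ w≈))
        (solve 5 (λ a a′ s x w → (a :* a′) :* s :+ x :* (a :* w) := a :* (a′ :* s :+ x :* w)) refl a a′ s x w′))

    division : ∀ {x r v p} g → Monic k x r v → Monic k x (g ℕ.+ r) p →
      ∃[ q ] ∃[ s ] Monic k x g q × Poly< k x r s × p ≈ q * v + s
    division {x} {r} {v} {p} zero monic monic′ with Monic-top isSubring r monic | Monic-top isSubring r monic′
    ... | w , w∈ , v≈ | w′ , w′∈ , p≈ = 1# , w′ + m * w , one refl ,
      Poly<-+ isSubring w′∈ (Poly<-scale isSubring k.-1∈ w∈) ,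
      trans p≈ (sym (trans (+-congʳ (trans (*-identityˡ v) v≈))
        (trans (solve 4 (λ w y w′ n → (w :+ y) :+ (w′ :+ n) := (w′ :+ y) :+ (w :+ n)) refl w (x ^ r) w′ (m * w))
        (trans (+-congˡ (cancel-neg w)) (+-identityʳ _)))))
    division {x} {r} {v} {p} (suc g) monic (cons {s = s} {w = w} s∈ monic′ p≈) with division g monic monic′
    ... | q , s′ , monic-q , s′∈ , w≈ with Poly<-top isSubring r (cons s∈ s′∈ refl) | Monic-top isSubring r monic
    ...   | a , a∈ , u , u∈ , top≈ | v′ , v′∈ , v≈ =
      a + x * q , u + m * (a * v′) , cons a∈ monic-q refl ,
      Poly<-+ isSubring u∈ (Poly<-scale isSubring k.-1∈ (Poly<-scale isSubring a∈ v′∈)) ,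
      (begin
        p                                                ≈⟨ p≈ ⟩
        s + x * w                                        ≈⟨ +-congˡ (*-congˡ w≈) ⟩
        s + x * (q * v + s′)                             ≈⟨ solve 5 (λ s x q v s′ → s :+ x :* (q :* v :+ s′) := (x :* q) :* v :+ (s :+ x :* s′)) refl s x q v s′ ⟩
        (x * q) * v + (s + x * s′)                       ≈⟨ +-congˡ top≈ ⟩
        (x * q) * v + (u + a * x ^ r)                    ≈⟨ +-congˡ (+-identityʳ _) ⟨
        (x * q) * v + ((u + a * x ^ r) + 0#)             ≈⟨ +-congˡ (+-congˡ (cancel-neg (a * v′))) ⟨
        (x * q) * v + ((u + a * x ^ r) + (a * v′ + m * (a * v′))) ≈⟨ solve 7 (λ xq v u a y v′ n → xq :* v :+ ((u :+ a :* y) :+ (a :* v′ :+ n)) := (xq :* v :+ a :* (v′ :+ y)) :+ (u :+ n)) refl (x * q) v u a (x ^ r) v′ (m * (a * v′)) ⟩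
        ((x * q) * v + a * (v′ + x ^ r)) + (u + m * (a * v′)) ≈⟨ +-congʳ (+-congˡ (*-congˡ v≈)) ⟨
        ((x * q) * v + a * v) + (u + m * (a * v′))       ≈⟨ +-congʳ (trans (+-comm _ _) (sym (distribʳ v a (x * q)))) ⟩
        (a + x * q) * v + (u + m * (a * v′))             ∎)
      where open import Relation.Binary.Reasoning.Setoid setoid

    Minimal : Carrier → ℕ → Set (c ⊔ ℓ)
    Minimal x e = ∀ d → (∃[ z ] Monic k x d z × z ≈ 0#) → e ℕ.≤ d

    minimal-relation : ∀ {x} → Algebraic k x → ∃[ e ] (∃[ z ] Monic k x e z × z ≈ 0#) × Minimal x e
    minimal-relation = least em _

    -- By minimality, a polynomial of degree below e has nonzero remainders
    -- in the Euclidean algorithm until the last one is constant.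
    monic-invertible : ∀ {x e z} → Monic k x e z → z ≈ 0# → Minimal x e →
      ∀ r → r ℕ.< e → ∀ {v} → Monic k x r v → ∃[ w ] Poly k x w × v * w ≈ 1#
    monic-invertible {x} {e} {z} monic z≈0 minimal = <-rec _ invert
      where
      nonzero : ∀ {r v} → r ℕ.< e → Monic k x r v → v ≉0
      nonzero {r} r<e p v≈0 = ℕ.<⇒≱ r<e (minimal r (_ , p , v≈0))

      invert : ∀ r → (∀ {r′} → r′ ℕ.< r → r′ ℕ.< e → ∀ {v} → Monic k x r′ v → ∃[ w ] Poly k x w × v * w ≈ 1#) →
        r ℕ.< e → ∀ {v} → Monic k x r v → ∃[ w ] Poly k x w × v * w ≈ 1#
      invert zero    rec r<e (one eq) = 1# , Poly-const isSubring k.1∈ , trans (*-identityʳ _) eq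
      invert (suc r) rec r<e {v} p
        with division (e ℕ.∸ suc r) p (≡.subst (λ n → Monic k x n z) (≡.sym (ℕ.m∸n+n≡m (ℕ.<⇒≤ r<e))) monic)
      ... | q , s , monic-q , s∈ , z≈ with em ℓ {s ≈ 0#}
      ...   | yes s≈0 = contradiction
        (no-zero-divisors (trans (sym (trans z≈ (trans (+-congˡ s≈0) (+-identityʳ _)))) z≈0)
          (nonzero (ℕ.∸-monoʳ-< (s≤s z≤n) (ℕ.<⇒≤ r<e)) monic-q))
        (nonzero r<e p)
      ...   | no s≉0 with normalise s∈ s≉0
      ...     | r′ , r′<r , w , monic-w , a , a∈ , a≉0 , s≈ with inverse a a≉0 | rec r′<r (ℕ.<-trans r′<r r<e) monic-w
      ...       | a′ , aa′≈1 | w′ , w′∈ , ww′≈1 = m * (q * (a′ * w′)) ,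
        *∈ -1∈ (*∈ (_ , Monic⇒Poly< isSubring monic-q) (*∈ (Poly-const isSubring (k.inverse∈ a∈ aa′≈1)) w′∈)) ,
        (begin
          v * (m * (q * (a′ * w′)))       ≈⟨ +-identityˡ _ ⟨
          0# + v * (m * (q * (a′ * w′)))  ≈⟨ +-congʳ (trans (*-congʳ z≈0) (zeroˡ _)) ⟨
          z * (a′ * w′) + v * (m * (q * (a′ * w′))) ≈⟨ +-congʳ (*-congʳ (trans z≈ (+-congˡ s≈))) ⟩
          (q * v + a * w) * (a′ * w′) + v * (m * (q * (a′ * w′))) ≈⟨ solve 7 (λ q v a w a′ w′ m → (q :* v :+ a :* w) :* (a′ :* w′) :+ v :* (m :* (q :* (a′ :* w′))) := (a :* a′) :* (w :* w′) :+ (q :* v :* (a′ :* w′) :+ m :* (q :* v :* (a′ :* w′)))) refl q v a w a′ w′ m ⟩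
          (a * a′) * (w * w′) + (q * v * (a′ * w′) + m * (q * v * (a′ * w′))) ≈⟨ +-congˡ (cancel-neg _) ⟩
          (a * a′) * (w * w′) + 0#        ≈⟨ +-identityʳ _ ⟩
          (a * a′) * (w * w′)             ≈⟨ *-cong aa′≈1 ww′≈1 ⟩
          1# * 1#                         ≈⟨ *-identityˡ 1# ⟩
          1#                              ∎)
        where
        open import Relation.Binary.Reasoning.Setoid setoid
        open IsSubring (Poly-subring isSubring {x})

    Poly-subfield : ∀ {x} → Algebraic k x → IsSubfieldOf (Poly k x)
    Poly-subfield {x} algebraic with minimal-relation algebraic
    ... | e , (z , monic , z≈0) , minimal = record
      { isSubring = Poly-subring isSubring ; inverse∈ = inverse∈ }
      where
      open IsSubring (Poly-subring isSubring {x})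
      inverse∈ : ∀ {v w} → Poly k x v → v * w ≈ 1# → Poly k x w
      inverse∈ {v} {w} (d , p) vw≈1
        with normalise (reduce isSubring monic z≈0 p) (λ v≈0 → 1≉0 (trans (sym vw≈1) (trans (*-congʳ v≈0) (zeroˡ w))))
      ... | r , r<e , u , monic-u , a , a∈ , a≉0 , v≈
        with inverse a a≉0 | monic-invertible monic z≈0 minimal r r<e monic-u
      ...   | a′ , aa′≈1 | u′ , u′∈ , uu′≈1 = resp
        (trans (sym (*-identityʳ _)) (trans (*-congˡ (sym vw≈1))
        (trans (*-congˡ (*-congʳ v≈))
        (trans (solve 5 (λ a a′ u u′ w → (a′ :* u′) :* ((a :* u) :* w) := (a :* a′) :* (u :* u′) :* w) refl a a′ u u′ w)
        (trans (*-congʳ (trans (*-cong aa′≈1 uu′≈1) (*-identityˡ 1#))) (*-identityˡ w))))))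
        (*∈ (Poly-const isSubring (k.inverse∈ a∈ aa′≈1)) u′∈)

  module _ {S : Subset} (isSubring : IsSubring S) where
    private
      module S = IsSubring isSubring

    Fractions : Subset
    Fractions u = ∃[ a ] ∃[ b ] S a × S b × b ≉0 × u * b ≈ a

    Fractions-base : ∀ {v} → S v → Fractions v
    Fractions-base {v} v∈ = v , 1# , v∈ , S.1∈ , 1≉0 , *-identityʳ v

    Fractions-subfield : IsSubfieldOf Fractions
    Fractions-subfield = record
      { isSubring = record
        { resp = λ eq (a , b , a∈ , b∈ , b≉0 , ub≈a) → a , b , a∈ , b∈ , b≉0 , trans (*-congʳ (sym eq)) ub≈a
        ; 0∈   = Fractions-base S.0∈
        ; 1∈   = Fractions-base S.1∈
        ; +∈   = λ {u} {v} (a , b , a∈ , b∈ , b≉0 , ub≈a) (a′ , b′ , a′∈ , b′∈ , b′≉0 , vb′≈a′) →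
            a * b′ + a′ * b , b * b′ , S.+∈ (S.*∈ a∈ b′∈) (S.*∈ a′∈ b∈) , S.*∈ b∈ b′∈ , *-≉0 b≉0 b′≉0 ,
            trans (solve 4 (λ u v b b′ → (u :+ v) :* (b :* b′) := (u :* b) :* b′ :+ (v :* b′) :* b) refl u v b b′)
              (+-cong (*-congʳ ub≈a) (*-congʳ vb′≈a′))
        ; *∈   = λ {u} {v} (a , b , a∈ , b∈ , b≉0 , ub≈a) (a′ , b′ , a′∈ , b′∈ , b′≉0 , vb′≈a′) →
            a * a′ , b * b′ , S.*∈ a∈ a′∈ , S.*∈ b∈ b′∈ , *-≉0 b≉0 b′≉0 ,
            trans (solve 4 (λ u v b b′ → (u :* v) :* (b :* b′) := (u :* b) :* (v :* b′)) refl u v b b′)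
              (*-cong ub≈a vb′≈a′)
        ; -1∈  = Fractions-base S.-1∈
        }
      ; inverse∈ = λ {v} {w} (a , b , a∈ , b∈ , b≉0 , vb≈a) vw≈1 →
          let wa≈b = trans (*-congˡ (sym vb≈a))
                (trans (solve 3 (λ v w b → w :* (v :* b) := (v :* w) :* b) refl v w b)
                  (trans (*-congʳ vw≈1) (*-identityˡ b)))
          in b , a , b∈ , a∈ , (λ a≈0 → b≉0 (trans (sym wa≈b) (trans (*-congˡ a≈0) (zeroʳ w)))) , wa≈b
      }

    clear-denominators : ∀ {l v} → Comb Fractions l v → ∃[ d ] S d × d ≉0 × Comb S l (d * v)
    clear-denominators (nil eq) = 1# , S.1∈ , 1≉0 , nil (trans (*-identityˡ _) eq)
    clear-denominators (cons {a = a} {w = w} {t = t} (s , b , s∈ , b∈ , b≉0 , ab≈s) p eq) with clear-denominators p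
    ... | d , d∈ , d≉0 , q = b * d , S.*∈ b∈ d∈ , *-≉0 b≉0 d≉0 ,
      cons (S.*∈ d∈ s∈) (Comb-* isSubring b∈ q)
        (trans (*-congˡ eq)
        (trans (solve 5 (λ a b t d w → (b :* d) :* (a :* t :+ w) := (d :* (a :* b)) :* t :+ b :* (d :* w)) refl a b t d w)
        (+-congʳ (*-congʳ (*-congˡ ab≈s)))))

    common-denominator : ∀ {l} → (∀ v → Comb Fractions l v) → ∀ vs →
      ∃[ d ] S d × d ≉0 × All (λ v → Comb S l (d * v)) vs
    common-denominator all [] = 1# , S.1∈ , 1≉0 , []
    common-denominator all (v ∷ vs) with clear-denominators (all v) | common-denominator all vs
    ... | d , d∈ , d≉0 , p | d′ , d′∈ , d′≉0 , ps = d * d′ , S.*∈ d∈ d′∈ , *-≉0 d≉0 d′≉0 ,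
      Comb-resp (solve 3 (λ d d′ v → d′ :* (d :* v) := (d :* d′) :* v) refl d d′ v) (Comb-* isSubring d′∈ p) ∷
      All.map (λ {u} q → Comb-resp (sym (*-assoc d d′ u)) (Comb-* isSubring d∈ q)) ps

  exchange : ∀ {k es z} → IsSubfieldOf k → Comb k es z → z ≉0 →
    ∃[ es′ ] suc (length es′) ≡ length es × All (Comb k (z ∷ es′)) es
  exchange sub (nil eq) z≉0 = contradiction eq z≉0
  exchange {k} {t ∷ l} {z} sub (cons {a = a} {w = w} a∈ p eq) z≉0 with em ℓ {a ≈ 0#}
  ... | yes a≈0 with exchange sub (Comb-resp (sym (trans eq (trans (+-congʳ (trans (*-congʳ a≈0) (zeroˡ t))) (+-identityˡ w)))) p) z≉0
  ...   | es′ , len , ps = t ∷ es′ , ≡.cong suc len ,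
    Comb-skip isSubring (Comb-head isSubring t es′) ∷ All.map swap ps
    where
    open IsSubfieldOf sub
    swap : ∀ {v} → Comb k (z ∷ es′) v → Comb k (z ∷ t ∷ es′) v
    swap = Comb-trans isSubring (Comb-head isSubring z _ ∷ All.map (λ q → Comb-skip isSubring (Comb-skip isSubring q)) (Comb-all isSubring es′))
  exchange {k} {t ∷ l} {z} sub (cons {a = a} {w = w} a∈ p eq) z≉0 | no a≉0 with inverse a a≉0
  ... | a′ , aa′≈1 = l , ≡.refl ,
    Comb-resp t≈ (Comb-* isSubring (inverse∈ a∈ aa′≈1)
      (Comb-+ isSubring (Comb-head isSubring z l) (Comb-* isSubring -1∈ (Comb-skip isSubring p)))) ∷
    All.map (Comb-skip isSubring) (Comb-all isSubring l)
    where
    open IsSubfieldOf sub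
    t≈ : a′ * (z + m * w) ≈ t
    t≈ = trans (*-congˡ (trans (+-congʳ eq) (trans (+-assoc _ w _) (trans (+-congˡ (cancel-neg w)) (+-identityʳ _)))))
      (trans (sym (*-assoc a′ a t)) (trans (*-congʳ (trans (*-comm a′ a) aa′≈1)) (*-identityˡ t)))

  Adjoin-⊆ : ∀ {S M : Subset} → IsSubring M → (∀ {v} → S v → M v) → ∀ xs → All M xs → ∀ {v} → Adjoin S xs v → M v
  Adjoin-⊆ isM ⊆ []       []       p = ⊆ p
  Adjoin-⊆ {S} {M} isM ⊆ (x ∷ xs) (x∈ ∷ xs∈) p = Adjoin-⊆ isM (λ (d , q) → poly q) xs xs∈ p
    where
    open IsSubring isM
    poly : ∀ {d v} → Poly< S x d v → M v
    poly (nil eq)       = resp (sym eq) 0∈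
    poly (cons s∈ q eq) = resp (sym eq) (+∈ (⊆ s∈) (*∈ x∈ (poly q)))

  -- If K is finite over Fractions S and generated over S by xs, then
  -- Fractions S = S[1/d]: the multiplication table of a basis and the
  -- coordinates of xs have a common denominator d.
  module _ {S : Subset} (isSubring : IsSubring S) (xs : List Carrier) (whole : ∀ v → Adjoin S xs v) where
    private
      module S = IsSubring isSubring
      k = Fractions isSubring
      module k = IsSubfieldOf (Fractions-subfield isSubring)

    localisation : ∀ es → (∀ v → Comb k es v) → ∃[ d ] S d × d ≉0 × (∀ {u} → k u → ∃[ n ] S (d ^ n * u))
    localisation es₀ spans₀ with least em (λ n → ∃[ es ] length es ≡ n × (∀ v → Comb k (1# ∷ es) v))
      (_ , es₀ , ≡.refl , λ v → Comb-skip k.isSubring (spans₀ v))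
    ... | _ , (es , ≡.refl , spans) , minimal = result
      where
      L = 1# ∷ es

      independent : ∀ {z} → k z → Comb k es z → z ≈ 0#
      independent {z} z∈ p = decidable-stable (em ℓ) λ z≉0 →
        let es′ , len , ps = exchange (Fractions-subfield isSubring) p z≉0
            z∈span = Comb-resp (*-identityʳ z) (Comb-* k.isSubring z∈ (Comb-head k.isSubring 1# es′))
            spans′ = λ v → Comb-trans k.isSubring
              (Comb-head k.isSubring 1# es′ ∷
               All.map (Comb-trans k.isSubring (z∈span ∷ All.map (Comb-skip k.isSubring) (Comb-all k.isSubring es′))) ps)
              (spans v)
        in ℕ.<⇒≱ (ℕ.≤-reflexive len) (minimal (length es′) (es′ , ≡.refl , spans′))

      table : List Carrier
      table = xs ++ cartesianProductWith _*_ L L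

      result : ∃[ d ] S d × d ≉0 × (∀ {u} → k u → ∃[ n ] S (d ^ n * u))
      result with common-denominator isSubring spans table
      ... | d , d∈ , d≉0 , cleared = d , d∈ , d≉0 , λ {u} u∈ → integral u∈ (M-all u)
        where
        d^∈ : ∀ n → S (d ^ n)
        d^∈ zero    = S.1∈
        d^∈ (suc n) = S.*∈ d∈ (d^∈ n)

        M : Subset
        M v = ∃[ n ] Comb S L (d ^ n * v)

        row : ∀ {l t u} → (∀ {e} → e ∈ l → Comb S L (d * (t * e))) → Comb S l u → Comb S L (d * (t * u))
        row {t = t} products (nil eq) = Comb-resp
          (sym (trans (*-congˡ (trans (*-congˡ eq) (zeroʳ t))) (zeroʳ d))) (Comb-0 isSubring L)
        row {t = t} products (cons {a = a} {w = w} {t = e} a∈ p eq) = Comb-resp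
          (trans (solve 5 (λ a d t e w → a :* (d :* (t :* e)) :+ d :* (t :* w) := d :* (t :* (a :* e :+ w))) refl a d t e w)
            (*-congˡ (*-congˡ (sym eq))))
          (Comb-+ isSubring (Comb-* isSubring a∈ (products (here ≡.refl))) (row (λ e∈ → products (there e∈)) p))

        product : ∀ {u v} → Comb S L u → Comb S L v → Comb S L (d * (u * v))
        product {u} {v} p q = Comb-resp (*-congˡ (*-comm v u))
          (row (λ {e} e∈ → Comb-resp (*-congˡ (*-comm e v)) (row (λ e′∈ →
            All.lookup cleared (∈-++⁺ʳ xs (∈-cartesianProductWith⁺ _*_ e∈ e′∈))) q)) p)

        M-subring : IsSubring M
        M-subring = record
          { resp = λ eq (n , p) → n , Comb-resp (*-congˡ eq) p
          ; 0∈   = 0 , Comb-resp (sym (zeroʳ _)) (Comb-0 isSubring L)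
          ; 1∈   = 0 , Comb-resp (sym (*-identityˡ 1#)) (Comb-head isSubring 1# es)
          ; +∈   = λ {u} {v} (n , p) (n′ , q) → n ℕ.+ n′ , Comb-resp
              (trans (solve 4 (λ y y′ u v → y′ :* (y :* u) :+ y :* (y′ :* v) := (y :* y′) :* (u :+ v)) refl (d ^ n) (d ^ n′) u v)
                (*-congʳ (sym (^-homo-* d n n′))))
              (Comb-+ isSubring (Comb-* isSubring (d^∈ n′) p) (Comb-* isSubring (d^∈ n) q))
          ; *∈   = λ {u} {v} (n , p) (n′ , q) → suc (n ℕ.+ n′) , Comb-resp
              (trans (solve 5 (λ d y y′ u v → d :* ((y :* u) :* (y′ :* v)) := (d :* (y :* y′)) :* (u :* v)) refl d (d ^ n) (d ^ n′) u v)
                (*-congʳ (*-congˡ (sym (^-homo-* d n n′)))))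
              (product p q)
          ; -1∈  = 0 , Comb-resp (trans (*-identityʳ m) (sym (*-identityˡ m))) (Comb-* isSubring S.-1∈ (Comb-head isSubring 1# es))
          }

        M-all : ∀ v → M v
        M-all v = Adjoin-⊆ M-subring
          (λ {s} s∈ → 0 , Comb-resp (trans (*-identityʳ s) (sym (*-identityˡ s))) (Comb-* isSubring s∈ (Comb-head isSubring 1# es)))
          xs
          (All.tabulate λ x∈ → 1 , Comb-resp (*-congʳ (sym (*-identityʳ d))) (All.lookup cleared (∈-++⁺ˡ x∈)))
          (whole v)

        integral : ∀ {u} → k u → M u → ∃[ n ] S (d ^ n * u)
        integral {u} u∈ (n , cons {a = a} {w = w} a∈ p eq) = n , S.resp (sym (difference≈0 z≈0)) a∈
          where
          z≈w : d ^ n * u + m * a ≈ w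
          z≈w = trans (+-congʳ (trans eq (+-congʳ (*-identityʳ a))))
            (trans (solve 3 (λ a w n → (a :+ w) :+ n := (a :+ n) :+ w) refl a w (m * a))
              (trans (+-congʳ (cancel-neg a)) (+-identityˡ w)))
          z≈0 : d ^ n * u + m * a ≈ 0#
          z≈0 = independent
            (k.+∈ (k.*∈ (Fractions-base isSubring (d^∈ n)) u∈) (Fractions-base isSubring (S.*∈ S.-1∈ a∈)))
            (Comb-resp (sym z≈w) (Comb-mono (Fractions-base isSubring) p))

  coprime-power : ∀ {S y} → IsSubring S → S y → ∀ n → ∃[ q ] ∃[ r ] S q × S r × 1# ≈ (1# + y) * q + r * y ^ n
  coprime-power isSubring y∈ zero = 0# , 1# , 0∈ , 1∈ ,
    sym (trans (+-cong (zeroʳ _) (*-identityˡ 1#)) (+-identityˡ 1#))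
    where open IsSubring isSubring
  coprime-power {S} {y} isSubring y∈ (suc n) with coprime-power isSubring y∈ n
  ... | q , r , q∈ , r∈ , eq = q + r * y ^ n , m * r , +∈ q∈ (*∈ r∈ (y^∈ n)) , *∈ -1∈ r∈ ,
    trans eq (sym (trans
      (solve 6 (λ i y q r z m → (i :+ y) :* (q :+ r :* z) :+ (m :* r) :* (y :* z) :=
                                ((i :+ y) :* q :+ i :* (r :* z)) :+ (r :* y :* z :+ m :* (r :* y :* z))) refl 1# y q r (y ^ n) m)
      (trans (+-cong (+-congˡ (*-identityˡ _)) (cancel-neg _)) (+-identityʳ _))))
    where
    open IsSubring isSubring
    y^∈ : ∀ n → S (y ^ n)
    y^∈ zero    = 1∈
    y^∈ (suc n) = *∈ y∈ (y^∈ n)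

  -- As 1 + x d becomes a unit in k[x][1/d], it is zero or a unit in k[x].
  algebraic : ∀ {k x} (sub : IsSubfieldOf k) → ∀ {d} → Poly k x d → d ≉0 →
    (∀ {u} → Fractions (Poly-subring (IsSubfieldOf.isSubring sub) {x}) u → ∃[ n ] Poly k x (d ^ n * u)) → Algebraic k x
  algebraic {k} {x} sub {d} d∈ d≉0 integral with normalise sub (proj₂ d∈) d≉0
  ... | f , _ , w , monic-w , c , c∈ , c≉0 , d≈ with inverse c c≉0
  ...   | c′ , cc′≈1 with em ℓ {1# + x * d ≈ 0#}
  ...     | yes eq = suc f , x * w + c′ ,
    Monic-+ isSubring (Monic-shift isSubring monic-w) (Poly<-≤ isSubring (s≤s z≤n) (Poly<-const isSubring (inverse∈ c∈ cc′≈1))) ,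
    (begin
      x * w + c′                 ≈⟨ +-cong (sym (trans (*-congʳ cc′≈1) (*-identityˡ _))) (sym (*-identityʳ c′)) ⟩
      (c * c′) * (x * w) + c′ * 1#    ≈⟨ solve 5 (λ c c′ x w i → (c :* c′) :* (x :* w) :+ c′ :* i := c′ :* (i :+ x :* (c :* w))) refl c c′ x w 1# ⟩
      c′ * (1# + x * (c * w))    ≈⟨ *-congˡ (+-congˡ (*-congˡ d≈)) ⟨
      c′ * (1# + x * d)          ≈⟨ *-congˡ eq ⟩
      c′ * 0#                    ≈⟨ zeroʳ c′ ⟩
      0#                         ∎)
    where
    open IsSubfieldOf sub
    open import Relation.Binary.Reasoning.Setoid setoid
  ...     | no 1+y≉0 with inverse (1# + x * d) 1+y≉0
  ...       | u , [1+y]u≈1 with integral (Fractions-inverse [1+y]u≈1)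
    where
    open IsSubfieldOf sub
    isSubring[x] = Poly-subring isSubring {x}
    open IsSubring isSubring[x] using () renaming (1∈ to 1∈[x]; +∈ to +∈[x]; *∈ to *∈[x])
    Fractions-inverse : ∀ {u} → (1# + x * d) * u ≈ 1# → Fractions isSubring[x] u
    Fractions-inverse = IsSubfieldOf.inverse∈ (Fractions-subfield isSubring[x])
      (Fractions-base isSubring[x] (+∈[x] 1∈[x] (*∈[x] (Poly-var isSubring) d∈)))
  ...         | n , s∈ with coprime-power (Poly-subring (IsSubfieldOf.isSubring sub) {x})
                              (IsSubring.*∈ (Poly-subring (IsSubfieldOf.isSubring sub) {x}) (Poly-var (IsSubfieldOf.isSubring sub)) d∈) n
  ...           | q , r , q∈ , r∈ , 1≈ = relation (normalise sub (proj₂ t∈) t≉0)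
    where
    open IsSubfieldOf sub
    open import Relation.Binary.Reasoning.Setoid setoid
    module k[x] = IsSubring (Poly-subring isSubring {x})
    y = x * d
    s = d ^ n * u
    x^∈ : ∀ n → Poly k x (x ^ n)
    x^∈ zero    = k[x].1∈
    x^∈ (suc n) = k[x].*∈ (Poly-var isSubring) (x^∈ n)

    ^-distrib : ∀ n → y ^ n ≈ x ^ n * d ^ n
    ^-distrib zero    = sym (*-identityˡ 1#)
    ^-distrib (suc n) = trans (*-congˡ (^-distrib n))
      (solve 4 (λ x d a b → (x :* d) :* (a :* b) := (x :* a) :* (d :* b)) refl x d (x ^ n) (d ^ n))

    t : Carrier
    t = q + r * (x ^ n * s)

    t∈ : Poly k x t
    t∈ = k[x].+∈ q∈ (k[x].*∈ r∈ (k[x].*∈ (x^∈ n) s∈))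

    unit : (1# + y) * t ≈ 1#
    unit = begin
      (1# + y) * (q + r * (x ^ n * (d ^ n * u)))       ≈⟨ solve 6 (λ z q r a b u → z :* (q :+ r :* (a :* (b :* u))) := z :* q :+ r :* (a :* b) :* (z :* u)) refl (1# + y) q r (x ^ n) (d ^ n) u ⟩
      (1# + y) * q + r * (x ^ n * d ^ n) * ((1# + y) * u) ≈⟨ +-congˡ (trans (*-congˡ [1+y]u≈1) (*-identityʳ _)) ⟩
      (1# + y) * q + r * (x ^ n * d ^ n)               ≈⟨ +-congˡ (*-congˡ (^-distrib n)) ⟨
      (1# + y) * q + r * y ^ n                         ≈⟨ 1≈ ⟨
      1#                                               ∎

    t≉0 : t ≉0
    t≉0 t≈0 = 1≉0 (trans (sym unit) (trans (*-congˡ t≈0) (zeroʳ _)))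

    relation : (∃[ g ] g ℕ.< proj₁ t∈ × (∃[ w′ ] Monic k x g w′ × (∃[ b ] k b × b ≉0 × t ≈ b * w′))) → Algebraic k x
    relation (g , _ , w′ , monic-w′ , b , b∈ , b≉0 , t≈) with inverse b b≉0
    ... | b′ , bb′≈1 = suc (f ℕ.+ g) , x * (w * w′) + (c′ * b′) * (t + m) ,
      Monic-+ isSubring (Monic-shift isSubring (Monic-* isSubring monic-w monic-w′))
        (Poly<-scale isSubring (*∈ (inverse∈ c∈ cc′≈1) (inverse∈ b∈ bb′≈1))
          (Poly<-+ isSubring
            (Poly<-resp (sym t≈) (Poly<-≤ isSubring (s≤s (ℕ.m≤n+m g f)) (Poly<-scale isSubring b∈ (Monic⇒Poly< isSubring monic-w′))))
            (Poly<-≤ isSubring (s≤s z≤n) (Poly<-const isSubring -1∈)))) ,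
      (begin
        x * (w * w′) + (c′ * b′) * (t + m)
          ≈⟨ +-congʳ (sym (trans (*-congʳ (trans (*-cong cc′≈1 bb′≈1) (*-identityˡ 1#))) (*-identityˡ _))) ⟩
        ((c * c′) * (b * b′)) * (x * (w * w′)) + (c′ * b′) * (t + m)
          ≈⟨ solve 9 (λ c c′ b b′ x w w′ t m → ((c :* c′) :* (b :* b′)) :* (x :* (w :* w′)) :+ (c′ :* b′) :* (t :+ m) :=
                                               (c′ :* b′) :* ((t :+ (x :* (c :* w)) :* (b :* w′)) :+ m)) refl c c′ b b′ x w w′ t m ⟩
        (c′ * b′) * ((t + (x * (c * w)) * (b * w′)) + m)
          ≈⟨ *-congˡ (+-congʳ (+-congˡ (*-cong (*-congˡ d≈) t≈))) ⟨
        (c′ * b′) * ((t + (x * d) * t) + m)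
          ≈⟨ *-congˡ (+-congʳ (trans (+-congʳ (sym (*-identityˡ t))) (trans (sym (distribʳ t 1# y)) unit))) ⟩
        (c′ * b′) * (1# + m)
          ≈⟨ trans (*-congˡ (-‿inverseʳ 1#)) (zeroʳ _) ⟩
        0# ∎)

  Comb-++ : ∀ {S : Subset} {l l′ u v} → IsSubring S → Comb S l u → Comb S l′ v → Comb S (l ++ l′) (u + v)
  Comb-++ isSubring (nil eq) q = Comb-resp (sym (trans (+-congʳ eq) (+-identityˡ _))) q
  Comb-++ isSubring (cons a∈ p eq) q = cons a∈ (Comb-++ isSubring p q) (trans (+-congʳ eq) (+-assoc _ _ _))

  Comb-map : ∀ {S : Subset} {l v} x → Comb S l v → Comb S (List.map (x *_) l) (x * v)
  Comb-map x (nil eq) = nil (trans (*-congˡ eq) (zeroʳ x))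
  Comb-map x (cons {a = a} {w = w} {t = t} a∈ p eq) = cons a∈ (Comb-map x p)
    (trans (*-congˡ eq) (solve 4 (λ x a t w → x :* (a :* t :+ w) := a :* (x :* t) :+ x :* w) refl x a t w))

  powers : Carrier → ℕ → List Carrier
  powers x zero    = []
  powers x (suc d) = 1# ∷ List.map (x *_) (powers x d)

  Poly<⇒Comb : ∀ {S x d v} → Poly< S x d v → Comb S (powers x d) v
  Poly<⇒Comb (nil eq) = nil eq
  Poly<⇒Comb {x = x} (cons {s = s} s∈ p eq) = cons s∈ (Comb-map x (Poly<⇒Comb p)) (trans eq (+-congʳ (sym (*-identityʳ s))))

  Comb-tower : ∀ {S S′ : Subset} {fs} → IsSubring S → (∀ {v} → S′ v → Comb S fs v) →
    ∀ {es v} → Comb S′ es v → Comb S (List.concatMap (λ e → List.map (e *_) fs) es) v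
  Comb-tower isSubring over (nil eq) = nil eq
  Comb-tower isSubring over (cons {t = t} a∈ p eq) = Comb-resp (trans (+-congʳ (*-comm t _)) (sym eq))
    (Comb-++ isSubring (Comb-map t (over a∈)) (Comb-tower isSubring over p))

  mutual
    -- Zariski's lemma
    finite : ∀ {k} → IsSubfieldOf k → ∀ xs → (∀ v → Adjoin k xs v) → ∃[ es ] ∀ v → Comb k es v
    finite sub [] whole = 1# ∷ [] , λ v → cons (whole v) (nil refl) (sym (trans (+-identityʳ _) (*-identityʳ v)))
    finite {k} sub (x ∷ xs) whole =
      let alg = first-algebraic sub x xs whole
          e , (z , monic , z≈0) , _ = minimal-relation sub alg
          es , spans = finite (Poly-subfield sub alg) xs whole
      in _ , λ v → Comb-tower isSubring
        (λ (d , p) → Poly<⇒Comb (reduce isSubring monic z≈0 p)) (spans v)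
      where open IsSubfieldOf sub

    first-algebraic : ∀ {k} → IsSubfieldOf k → ∀ x xs → (∀ v → Adjoin k (x ∷ xs) v) → Algebraic k x
    first-algebraic sub x xs whole =
      let isSubring[x] = Poly-subring (IsSubfieldOf.isSubring sub) {x}
          es , spans = finite (Fractions-subfield isSubring[x]) xs
            (λ v → Adjoin-mono (Fractions-base isSubring[x]) xs (whole v))
          d , d∈ , d≉0 , integral = localisation isSubring[x] xs whole es spans
      in algebraic sub d∈ d≉0 integral

-- ν enumerates a subfield of R.
record Coefficients {c ℓ} (R : CommutativeRing c ℓ) : Set (c ⊔ ℓ) where
  open CommutativeRing R
  field
    nontrivial : ¬ (1# ≈ 0#)
    ν          : ℕ → Carrier
    zeroᶜ oneᶜ -oneᶜ : ℕ
    addᶜ mulᶜ  : ℕ → ℕ → ℕ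
    ν-zero     : ν zeroᶜ ≈ 0#
    ν-one      : ν oneᶜ ≈ 1#
    ν--one     : ν -oneᶜ ≈ - 1#
    ν-add      : ∀ i j → ν (addᶜ i j) ≈ ν i + ν j
    ν-mul      : ∀ i j → ν (mulᶜ i j) ≈ ν i * ν j
    ν-inverse  : ∀ i → ¬ (ν i ≈ 0#) → ∃[ j ] ν i * ν j ≈ 1#

data Term : Set where
  con var : ℕ → Term
  _⊕_ _⊗_ : Term → Term → Term

infixl 6 _⊕_
infixl 7 _⊗_

module Theory {c ℓ} (R : CommutativeRing c ℓ) (coefficients : Coefficients R) where
  private
    module R = CommutativeRing R
  open Coefficients coefficients

  𝟎 𝟏 -𝟏 : Term
  𝟎  = con zeroᶜ
  𝟏  = con oneᶜ
  -𝟏 = con -oneᶜ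

  -- Commutative semirings containing the semiring enumerated by ν; the
  -- coefficient -1 makes them rings.
  data Axiom : Term → Term → Set ℓ where
    +-assoc     : ∀ s t u → Axiom ((s ⊕ t) ⊕ u) (s ⊕ (t ⊕ u))
    +-comm      : ∀ s t → Axiom (s ⊕ t) (t ⊕ s)
    +-identityˡ : ∀ t → Axiom (𝟎 ⊕ t) t
    *-assoc     : ∀ s t u → Axiom ((s ⊗ t) ⊗ u) (s ⊗ (t ⊗ u))
    *-comm      : ∀ s t → Axiom (s ⊗ t) (t ⊗ s)
    *-identityˡ : ∀ t → Axiom (𝟏 ⊗ t) t
    distribˡ    : ∀ s t u → Axiom (s ⊗ (t ⊕ u)) (s ⊗ t ⊕ s ⊗ u)
    zeroˡ       : ∀ t → Axiom (𝟎 ⊗ t) 𝟎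
    con-+       : ∀ i j → Axiom (con i ⊕ con j) (con (addᶜ i j))
    con-*       : ∀ i j → Axiom (con i ⊗ con j) (con (mulᶜ i j))
    con-≈       : ∀ {i j} → ν i R.≈ ν j → Axiom (con i) (con j)

  Hypotheses : Set₁
  Hypotheses = Pred Term 0ℓ

  infix 4 _⊢_~_
  data _⊢_~_ (H : Hypotheses) : Term → Term → Set ℓ where
    ax       : ∀ {s t} → Axiom s t → H ⊢ s ~ t
    hyp      : ∀ {t} → H t → H ⊢ t ~ 𝟎
    ~sym     : ∀ {s t} → H ⊢ s ~ t → H ⊢ t ~ s
    ~trans   : ∀ {s t u} → H ⊢ s ~ t → H ⊢ t ~ u → H ⊢ s ~ u
    ⊕-congʳ  : ∀ {s t u} → H ⊢ s ~ t → H ⊢ s ⊕ u ~ t ⊕ u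
    ⊗-congʳ  : ∀ {s t u} → H ⊢ s ~ t → H ⊢ s ⊗ u ~ t ⊗ u

  module _ {H : Hypotheses} where
    ~refl : ∀ {t} → H ⊢ t ~ t
    ~refl {t} = ~trans (~sym (ax (+-identityˡ t))) (ax (+-identityˡ t))

    ⊕-cong : ∀ {s s′ t t′} → H ⊢ s ~ s′ → H ⊢ t ~ t′ → H ⊢ s ⊕ t ~ s′ ⊕ t′
    ⊕-cong p q = ~trans (⊕-congʳ p) (~trans (ax (+-comm _ _)) (~trans (⊕-congʳ q) (ax (+-comm _ _))))

    ⊗-cong : ∀ {s s′ t t′} → H ⊢ s ~ s′ → H ⊢ t ~ t′ → H ⊢ s ⊗ t ~ s′ ⊗ t′
    ⊗-cong p q = ~trans (⊗-congʳ p) (~trans (ax (*-comm _ _)) (~trans (⊗-congʳ q) (ax (*-comm _ _))))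

    distribʳ : ∀ s t u → H ⊢ (t ⊕ u) ⊗ s ~ t ⊗ s ⊕ u ⊗ s
    distribʳ s t u = ~trans (ax (*-comm _ s)) (~trans (ax (distribˡ s t u)) (⊕-cong (ax (*-comm s t)) (ax (*-comm s u))))

    negation : ∀ t → H ⊢ -𝟏 ⊗ t ⊕ t ~ 𝟎
    negation t = ~trans (⊕-cong ~refl (~sym (ax (*-identityˡ t)))) (~trans (~sym (distribʳ t -𝟏 𝟏))
      (~trans (⊗-congʳ (~trans (ax (con-+ _ _)) (ax (con-≈ (R.trans (ν-add _ _)
        (R.trans (R.+-cong ν--one ν-one) (R.trans (R.-‿inverseˡ R.1#) (R.sym ν-zero))))))))
      (ax (zeroˡ t))))

  quotient : Hypotheses → CommutativeRing 0ℓ ℓ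
  quotient H = record
    { Carrier = Term ; _≈_ = H ⊢_~_ ; _+_ = _⊕_ ; _*_ = _⊗_ ; -_ = -𝟏 ⊗_ ; 0# = 𝟎 ; 1# = 𝟏
    ; isCommutativeRing = record
      { isRing = record
        { +-isAbelianGroup = record
          { isGroup = record
            { isMonoid = record
              { isSemigroup = record
                { isMagma = record
                  { isEquivalence = record { refl = ~refl ; sym = ~sym ; trans = ~trans }
                  ; ∙-cong = ⊕-cong
                  }
                ; assoc = λ s t u → ax (+-assoc s t u)
                }
              ; identity = (λ t → ax (+-identityˡ t)) , (λ t → ~trans (ax (+-comm t 𝟎)) (ax (+-identityˡ t)))
              }
            ; inverse = negation , (λ t → ~trans (ax (+-comm t _)) (negation t))
            ; ⁻¹-cong = ⊗-cong ~refl
            }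
          ; comm = λ s t → ax (+-comm s t)
          }
        ; *-cong = ⊗-cong
        ; *-assoc = λ s t u → ax (*-assoc s t u)
        ; *-identity = (λ t → ax (*-identityˡ t)) , (λ t → ~trans (ax (*-comm t 𝟏)) (ax (*-identityˡ t)))
        ; distrib = (λ s t u → ax (distribˡ s t u)) , distribʳ
        }
      ; *-comm = λ s t → ax (*-comm s t)
      }
    }

  module Evaluation {q r} (Q : CommutativeRing q r) (κ x : ℕ → CommutativeRing.Carrier Q) where
    private
      module Q = CommutativeRing Q

    eval : Term → Q.Carrier
    eval (con i) = κ i
    eval (var i) = x i
    eval (s ⊕ t) = eval s Q.+ eval t
    eval (s ⊗ t) = eval s Q.* eval t

    module _ (κ-zero : κ zeroᶜ Q.≈ Q.0#) (κ-one : κ oneᶜ Q.≈ Q.1#)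
             (κ-add : ∀ i j → κ (addᶜ i j) Q.≈ κ i Q.+ κ j) (κ-mul : ∀ i j → κ (mulᶜ i j) Q.≈ κ i Q.* κ j)
             (κ-≈ : ∀ {i j} → ν i R.≈ ν j → κ i Q.≈ κ j) where

      axiom-sound : ∀ {s t} → Axiom s t → eval s Q.≈ eval t
      axiom-sound (+-assoc s t u)   = Q.+-assoc _ _ _
      axiom-sound (+-comm s t)      = Q.+-comm _ _
      axiom-sound (+-identityˡ t)   = Q.trans (Q.+-congʳ κ-zero) (Q.+-identityˡ _)
      axiom-sound (*-assoc s t u)   = Q.*-assoc _ _ _
      axiom-sound (*-comm s t)      = Q.*-comm _ _
      axiom-sound (*-identityˡ t)   = Q.trans (Q.*-congʳ κ-one) (Q.*-identityˡ _)
      axiom-sound (distribˡ s t u)  = Q.distribˡ _ _ _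
      axiom-sound (zeroˡ t)         = Q.trans (Q.*-congʳ κ-zero) (Q.trans (Q.zeroˡ _) (Q.sym κ-zero))
      axiom-sound (con-+ i j)       = Q.sym (κ-add i j)
      axiom-sound (con-* i j)       = Q.sym (κ-mul i j)
      axiom-sound (con-≈ eq)        = κ-≈ eq

      sound : ∀ {H} → (∀ {t} → H t → eval t Q.≈ Q.0#) → ∀ {s t} → H ⊢ s ~ t → eval s Q.≈ eval t
      sound H≈0 (ax a)       = axiom-sound a
      sound H≈0 (hyp h)      = Q.trans (H≈0 h) (Q.sym κ-zero)
      sound H≈0 (~sym p)     = Q.sym (sound H≈0 p)
      sound H≈0 (~trans p q) = Q.trans (sound H≈0 p) (sound H≈0 q)
      sound H≈0 (⊕-congʳ p)  = Q.+-congʳ (sound H≈0 p)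
      sound H≈0 (⊗-congʳ p)  = Q.*-congʳ (sound H≈0 p)

  module Value (x : ℕ → R.Carrier) where
    open Evaluation R ν x public using (eval)
    open Evaluation R ν x using (sound)

    value-sound : ∀ {H} → (∀ {t} → H t → eval t R.≈ R.0#) → ∀ {s t} → H ⊢ s ~ t → eval s R.≈ eval t
    value-sound = sound ν-zero ν-one ν-add ν-mul (λ eq → eq)

  module Substitution (H : Hypotheses) (σ : ℕ → Term) where
    open Evaluation (quotient H) con σ public using () renaming (eval to _[σ])
    open Evaluation (quotient H) con σ using (sound)

    substitute : ∀ {H′} → (∀ {t} → H′ t → H ⊢ t [σ] ~ 𝟎) → ∀ {s t} → H′ ⊢ s ~ t → H ⊢ s [σ] ~ t [σ]
    substitute = sound ~refl ~refl (λ i j → ~sym (ax (con-+ i j))) (λ i j → ~sym (ax (con-* i j)))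
      (λ eq → ax (con-≈ eq))

  cut : ∀ {H H′} → (∀ {t} → H′ t → H ⊢ t ~ 𝟎) → ∀ {s t} → H′ ⊢ s ~ t → H ⊢ s ~ t
  cut H′~0 (ax a)       = ax a
  cut H′~0 (hyp h)      = H′~0 h
  cut H′~0 (~sym p)     = ~sym (cut H′~0 p)
  cut H′~0 (~trans p q) = ~trans (cut H′~0 p) (cut H′~0 q)
  cut H′~0 (⊕-congʳ p)  = ⊕-congʳ (cut H′~0 p)
  cut H′~0 (⊗-congʳ p)  = ⊗-congʳ (cut H′~0 p)

  deduction : ∀ {H H′ u} → (∀ {t} → H′ t → t ≡ u ⊎ H t) → ∀ {s t} → H′ ⊢ s ~ t → ∃[ w ] H ⊢ s ~ t ⊕ w ⊗ u
  deduction {H} {H′} {u} split = go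
    where
    open Subrings (quotient H) using (solve; _:=_; _:+_; _:*_) renaming (+-identityʳ to +-idʳ)

    unused : ∀ {s t} → H ⊢ s ~ t → ∃[ w ] H ⊢ s ~ t ⊕ w ⊗ u
    unused {s} {t} p = 𝟎 , ~trans p (~sym (~trans (⊕-cong ~refl (ax (zeroˡ u))) (+-idʳ t)))

    go : ∀ {s t} → H′ ⊢ s ~ t → ∃[ w ] H ⊢ s ~ t ⊕ w ⊗ u
    go (ax a) = unused (ax a)
    go (hyp {t} h) with split h
    ... | inj₁ ≡.refl = 𝟏 , ~sym (~trans (ax (+-identityˡ _)) (ax (*-identityˡ t)))
    ... | inj₂ h′     = unused (hyp h′)
    go (~sym {s} {t} p) with go p
    ... | w , q = -𝟏 ⊗ w , ~sym (~trans (⊕-congʳ q)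
      (~trans (solve 4 (λ t w u m → (t :+ w :* u) :+ (m :* w) :* u := t :+ (m :* w :+ w) :* u) ~refl t w u -𝟏)
      (~trans (⊕-cong ~refl (~trans (⊗-congʳ (negation w)) (ax (zeroˡ u)))) (+-idʳ t))))
    go (~trans {s} {t} {v} p q) with go p | go q
    ... | w , p′ | w′ , q′ = w′ ⊕ w , ~trans p′ (~trans (⊕-congʳ q′)
      (solve 4 (λ v w w′ u → (v :+ w′ :* u) :+ w :* u := v :+ (w′ :+ w) :* u) ~refl v w w′ u))
    go (⊕-congʳ {s} {t} {v} p) with go p
    ... | w , p′ = w , ~trans (⊕-congʳ p′) (solve 4 (λ t w u v → (t :+ w :* u) :+ v := (t :+ v) :+ w :* u) ~refl t w u v)
    go (⊗-congʳ {s} {t} {v} p) with go p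
    ... | w , p′ = w ⊗ v , ~trans (⊗-congʳ p′) (solve 4 (λ t w u v → (t :+ w :* u) :* v := t :* v :+ (w :* v) :* u) ~refl t w u v)

  Low : ℕ → Term → Set
  Low n (con i) = ⊤
  Low n (var i) = i ℕ.< n
  Low n (s ⊕ t) = Low n s × Low n t
  Low n (s ⊗ t) = Low n s × Low n t

  Low-≤ : ∀ {m n} → m ℕ.≤ n → ∀ t → Low m t → Low n t
  Low-≤ m≤n (con i) _       = tt
  Low-≤ m≤n (var i) i<m     = ℕ.≤-trans i<m m≤n
  Low-≤ m≤n (s ⊕ t) (p , q) = Low-≤ m≤n s p , Low-≤ m≤n t q
  Low-≤ m≤n (s ⊗ t) (p , q) = Low-≤ m≤n s p , Low-≤ m≤n t q

  bound : Term → ℕ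
  bound (con i) = 0
  bound (var i) = suc i
  bound (s ⊕ t) = bound s ℕ.⊔ bound t
  bound (s ⊗ t) = bound s ℕ.⊔ bound t

  Low-bound : ∀ t → Low (bound t) t
  Low-bound (con i) = tt
  Low-bound (var i) = ℕ.≤-refl
  Low-bound (s ⊕ t) = Low-≤ (ℕ.m≤m⊔n _ _) s (Low-bound s) , Low-≤ (ℕ.m≤n⊔m _ _) t (Low-bound t)
  Low-bound (s ⊗ t) = Low-≤ (ℕ.m≤m⊔n _ _) s (Low-bound s) , Low-≤ (ℕ.m≤n⊔m _ _) t (Low-bound t)

  bounded : ∀ E → ∃[ n ] All (Low n) E
  bounded []      = 0 , []
  bounded (t ∷ E) with bounded E
  ... | n , ps = bound t ℕ.⊔ n , Low-≤ (ℕ.m≤m⊔n _ _) t (Low-bound t) ∷ All.map (λ {t} → Low-≤ (ℕ.m≤n⊔m _ _) t) ps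

  data MonicIn (i : ℕ) : ℕ → Term → Set where
    one  : MonicIn i 0 𝟏
    cons : ∀ {d a q} → Low i a → MonicIn i d q → MonicIn i (suc d) (a ⊕ var i ⊗ q)

  data Triangular : ℕ → List Term → Set where
    nil  : Triangular 0 []
    cons : ∀ {i T d a q} → Triangular i T → Low i a → MonicIn i d q → Triangular (suc i) ((a ⊕ var i ⊗ q) ∷ T)

  Entails : List Term → List Term → Set ℓ
  Entails T E = All (λ f → (_∈ T) ⊢ f ~ 𝟎) E

  vars : ℕ → ℕ → List Term
  vars i zero    = []
  vars i (suc m) = var i ∷ vars (suc i) m

  var∈vars : ∀ {i j} m → i ℕ.≤ j → j ℕ.< i ℕ.+ m → var j ∈ vars i m
  var∈vars {i} {j} zero    i≤j j< = contradiction (≡.subst (j ℕ.<_) (ℕ.+-identityʳ i) j<) (ℕ.≤⇒≯ i≤j)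
  var∈vars {i} {j} (suc m) i≤j j< with ℕ.m≤n⇒m<n∨m≡n i≤j
  ... | inj₁ i<j    = there (var∈vars m i<j (≡.subst (j ℕ.<_) (ℕ.+-suc i m) j<))
  ... | inj₂ ≡.refl = here ≡.refl

  module Constants (H : Hypotheses) where
    open Subrings (quotient H) using (Subset; IsSubring; Adjoin; Adjoin-subring; Adjoin-base; Adjoin-generators; module IsSubring)

    Constant : Subset
    Constant t = ∃[ i ] H ⊢ t ~ con i

    Constant-subring : IsSubring Constant
    Constant-subring = record
      { resp = λ eq (i , p) → i , ~trans (~sym eq) p
      ; 0∈   = _ , ~refl
      ; 1∈   = _ , ~refl
      ; +∈   = λ (i , p) (j , q) → _ , ~trans (⊕-cong p q) (ax (con-+ i j))
      ; *∈   = λ (i , p) (j , q) → _ , ~trans (⊗-cong p q) (ax (con-* i j))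
      ; -1∈  = _ , ax (con-* _ _)
      }

    constant-inverse : ∀ {v i} → H ⊢ v ~ con i → ¬ (ν i R.≈ R.0#) → ∃[ j ] H ⊢ v ⊗ con j ~ 𝟏
    constant-inverse {v} {i} p νi≉0 with ν-inverse i νi≉0
    ... | j , eq = j , ~trans (⊗-congʳ p) (~trans (ax (con-* i j))
      (ax (con-≈ (R.trans (ν-mul i j) (R.trans eq (R.sym ν-one))))))

    vanishing : ∀ {v i} → H ⊢ v ~ con i → ν i R.≈ R.0# → H ⊢ v ~ 𝟎
    vanishing p eq = ~trans p (ax (con-≈ (R.trans eq (R.sym ν-zero))))

    everything : ∀ {n} → (∀ {i} → n ℕ.≤ i → H (var i)) → ∀ t → Adjoin Constant (vars 0 n) t
    everything {n} high = go
      where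
      open IsSubring (Adjoin-subring Constant-subring (vars 0 n))
      go : ∀ t → Adjoin Constant (vars 0 n) t
      go (con i) = Adjoin-base Constant-subring (vars 0 n) (i , ~refl)
      go (var i) with ℕ.<-≤-connex i n
      ... | inj₁ i<n = All.lookup (Adjoin-generators Constant-subring (vars 0 n)) (var∈vars n z≤n i<n)
      ... | inj₂ n≤i = resp (~sym (hyp (high n≤i))) 0∈
      go (s ⊕ t) = +∈ (go s) (go t)
      go (s ⊗ t) = *∈ (go s) (go t)

  module Completeness (em : ∀ a → ExcludedMiddle a) where

    Consistent : Hypotheses → Set ℓ
    Consistent H = ¬ (H ⊢ 𝟏 ~ 𝟎)

    -- The variables from n on are set to zero in order that the quotient be
    -- generated by finitely many elements.
    module _ (E : List Term) (n : ℕ) where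
      base : Hypotheses
      base t = t ∈ E ⊎ ∃[ i ] n ℕ.≤ i × t ≡ var i

      base-consistent : All (Low n) E → Consistent (_∈ E) → Consistent base
      base-consistent low consistent p = consistent (substitute zeros p)
        where
        σ : ℕ → Term
        σ i with ℕ.<-≤-connex i n
        ... | inj₁ _ = var i
        ... | inj₂ _ = 𝟎
        open Substitution (_∈ E) σ
        unchanged : ∀ t → Low n t → t [σ] ≡ t
        unchanged (con i) _ = ≡.refl
        unchanged (var i) i<n with ℕ.<-≤-connex i n
        ... | inj₁ _   = ≡.refl
        ... | inj₂ n≤i = contradiction i<n (ℕ.≤⇒≯ n≤i)
        unchanged (s ⊕ t) (p , q) = ≡.cong₂ _⊕_ (unchanged s p) (unchanged t q)
        unchanged (s ⊗ t) (p , q) = ≡.cong₂ _⊗_ (unchanged s p) (unchanged t q)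
        zeros : ∀ {t} → base t → (_∈ E) ⊢ t [σ] ~ 𝟎
        zeros {t} (inj₁ t∈) = ≡.subst (λ s → (_∈ E) ⊢ s ~ 𝟎) (≡.sym (unchanged t (All.lookup low t∈))) (hyp t∈)
        zeros (inj₂ (i , n≤i , ≡.refl)) with ℕ.<-≤-connex i n
        ... | inj₁ i<n = contradiction i<n (ℕ.≤⇒≯ n≤i)
        ... | inj₂ _   = ~refl

      extension : List Term → Hypotheses
      extension l t = t ∈ l ⊎ base t

      open Subrings (quotient base) using (Comb; nil; cons; Adjoin; Adjoin-subring)
      open Noetherian em (quotient base)
      open Constants base

      Comb⇒⊢ : ∀ {S l v} → Comb S l v → extension l ⊢ v ~ 𝟎
      Comb⇒⊢ (nil eq) = cut (λ h → hyp (inj₂ h)) eq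
      Comb⇒⊢ {l = t ∷ l} (cons {a = a} a∈ p eq) = ~trans (cut (λ h → hyp (inj₂ h)) eq)
        (~trans (⊕-cong (~trans (ax (*-comm a t)) (~trans (⊗-congʳ (hyp (inj₁ (here ≡.refl)))) (ax (zeroˡ a))))
                        (cut (λ { (inj₁ t∈) → hyp (inj₁ (there t∈)) ; (inj₂ h) → hyp (inj₂ h) }) (Comb⇒⊢ p)))
                (ax (+-identityˡ 𝟎)))

      Maximal : List Term → Set ℓ
      Maximal l = Consistent (extension l) × (∀ v → ¬ (extension l ⊢ v ~ 𝟎) → ¬ Consistent (extension (v ∷ l)))

      maximal : Consistent base → ∃[ l ] Maximal l
      maximal consistent = search noeth (λ p → consistent (cut (λ { (inj₂ h) → hyp h }) p))
        where
        Whole = Adjoin Constant (vars 0 n)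

        noeth : Noeth Whole []
        noeth = Noeth-Adjoin Constant-subring (vars 0 n) (Noeth-field Constant-subring λ {v} (i , p) v≉0 →
          let j , q = constant-inverse p (λ eq → v≉0 (vanishing p eq)) in con j , (j , ~refl) , q)

        search : ∀ {l} → Noeth Whole l → Consistent (extension l) → ∃[ l ] Maximal l
        search {l} (extend next) con-l with em ℓ {∃[ v ] ¬ (extension l ⊢ v ~ 𝟎) × Consistent (extension (v ∷ l))}
        ... | yes (v , v≉0 , con-v) = search (next v (everything (λ n≤i → inj₂ (_ , n≤i , ≡.refl)) v) (λ v∈ → v≉0 (Comb⇒⊢ v∈))) con-v
        ... | no none = l , con-l , λ v v≉0 con-v → none (v , v≉0 , con-v)

    module Field (H : Hypotheses) (n : ℕ) (high : ∀ {i} → n ℕ.≤ i → H (var i)) (isField : IsField (quotient H)) where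
      private
        module K = Subrings (quotient H)

        1≉0 : Consistent H
        1≉0 = proj₁ isField
      open Constants H
      open FiniteType em (quotient H) isField

      Constant-subfield : IsSubfieldOf Constant
      Constant-subfield = record
        { isSubring = Constant-subring
        ; inverse∈  = λ {v} {w} (i , p) vw≈1 →
            let j , q = constant-inverse p λ eq → 1≉0 (~trans (~sym vw≈1)
                          (~trans (⊗-congʳ (vanishing p eq)) (ax (zeroˡ w))))
            in j , ~trans (~sym (ax (*-identityˡ w))) (~trans (⊗-congʳ (~sym q))
                 (~trans (ax (*-assoc v (con j) w)) (~trans (⊗-cong ~refl (ax (*-comm (con j) w)))
                 (~trans (~sym (ax (*-assoc v w (con j)))) (~trans (⊗-congʳ vw≈1) (ax (*-identityˡ _)))))))
        }

      Exact : ℕ → List Term → Set ℓ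
      Exact i T = ∀ t → Low i t → H ⊢ t ~ 𝟎 → (_∈ T) ⊢ t ~ 𝟎

      Terms : ℕ → K.Subset → Set ℓ
      Terms i k = (∀ {v} → k v → ∃[ t ] Low i t × H ⊢ v ~ t) × (∀ t → Low i t → k t)

      module _ {i : ℕ} {k : K.Subset} (terms : Terms i k) where
        Poly<-term : ∀ {d v} → K.Poly< k (var i) d v → ∃[ t ] Low (suc i) t × H ⊢ v ~ t
        Poly<-term (K.nil eq) = 𝟎 , tt , eq
        Poly<-term (K.cons s∈ p eq) with proj₁ terms s∈ | Poly<-term p
        ... | a , low-a , s~a | q , low-q , w~q = a ⊕ var i ⊗ q , (Low-≤ (ℕ.n≤1+n i) a low-a , ℕ.≤-refl , low-q) ,
          ~trans eq (⊕-cong s~a (⊗-cong ~refl w~q))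

        Monic-term : ∀ {d v} → K.Monic k (var i) d v → ∃[ t ] MonicIn i d t × H ⊢ v ~ t
        Monic-term (K.one eq) = 𝟏 , one , eq
        Monic-term (K.cons s∈ p eq) with proj₁ terms s∈ | Monic-term p
        ... | a , low-a , s~a | q , monic-q , w~q = a ⊕ var i ⊗ q , cons low-a monic-q ,
          ~trans eq (⊕-cong s~a (⊗-cong ~refl w~q))

      module _ {H′ : Hypotheses} {S : Subrings.Subset (quotient H′)} (isSubring : Subrings.IsSubring (quotient H′) S)
               {i : ℕ} (low : ∀ t → Low i t → S t) where
        open Subrings (quotient H′) using (Poly; Poly-const; Poly-var; Poly-subring; Monic; one; cons; module IsSubring)
        open IsSubring (Poly-subring isSubring {var i})

        term-Poly : ∀ t → Low (suc i) t → Poly S (var i) t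
        term-Poly (con j) _ = Poly-const isSubring (low (con j) tt)
        term-Poly (var j) j<1+i with ℕ.m≤n⇒m<n∨m≡n (ℕ.s≤s⁻¹ j<1+i)
        ... | inj₁ j<i    = Poly-const isSubring (low (var j) j<i)
        ... | inj₂ ≡.refl = Poly-var isSubring
        term-Poly (s ⊕ t) (p , q) = +∈ (term-Poly s p) (term-Poly t q)
        term-Poly (s ⊗ t) (p , q) = *∈ (term-Poly s p) (term-Poly t q)

        term-Monic : ∀ {d q} → MonicIn i d q → Monic S (var i) d q
        term-Monic one = one ~refl
        term-Monic (cons {a = a} low-a m) = cons (low a low-a) (term-Monic m) ~refl

      -- The new element of T′ is the minimal polynomial of var i over k.
      module Step {i : ℕ} {k : K.Subset} (sub : IsSubfieldOf k) (terms : Terms i k) {T : List Term}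
                  (T-zero : ∀ {p} → p ∈ T → H ⊢ p ~ 𝟎) (exact : Exact i T)
                  {e : ℕ} {a q : Term} (low-a : Low i a) (monic-q : MonicIn i e q)
                  (p~0 : H ⊢ a ⊕ var i ⊗ q ~ 𝟎) (minimal : Minimal sub (var i) (suc e)) where
        private
          module k = IsSubfieldOf sub
          T′ : List Term
          T′ = (a ⊕ var i ⊗ q) ∷ T
          module B = Subrings (quotient (_∈ T′))

        T′-zero : ∀ {p} → p ∈ T′ → H ⊢ p ~ 𝟎
        T′-zero (here ≡.refl) = p~0
        T′-zero (there p∈)    = T-zero p∈

        private
          S : B.Subset
          S v = ∃[ t ] Low i t × (_∈ T′) ⊢ v ~ t

          S-subring : B.IsSubring S
          S-subring = record
            { resp = λ eq (t , low , p) → t , low , ~trans (~sym eq) p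
            ; 0∈   = 𝟎 , tt , ~refl
            ; 1∈   = 𝟏 , tt , ~refl
            ; +∈   = λ (s , low-s , p) (t , low-t , q) → s ⊕ t , (low-s , low-t) , ⊕-cong p q
            ; *∈   = λ (s , low-s , p) (t , low-t , q) → s ⊗ t , (low-s , low-t) , ⊗-cong p q
            ; -1∈  = -𝟏 ⊗ 𝟏 , (tt , tt) , ~refl
            }

          low∈S : ∀ t → Low i t → S t
          low∈S t low = t , low , ~refl

          transfer : ∀ {d v} → B.Poly< S (var i) d v → K.Poly< k (var i) d v
          transfer (B.nil eq) = K.nil (cut T′-zero eq)
          transfer (B.cons (t , low , s~t) p eq) =
            K.cons (k.resp (~sym (cut T′-zero s~t)) (proj₂ terms t low)) (transfer p) (cut T′-zero eq)

          power : ∀ d → K.Monic k (var i) d (var i B.^ d)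
          power zero    = K.one ~refl
          power (suc d) = K.Monic-shift k.isSubring (power d)

          reduced-exact : ∀ d → d ℕ.≤ suc e → ∀ {v} → B.Poly< S (var i) d v → H ⊢ v ~ 𝟎 → (_∈ T′) ⊢ v ~ 𝟎
          reduced-exact zero    d≤ (B.nil eq) v~0 = eq
          reduced-exact (suc d) d< {v} p v~0 with B.Poly<-top S-subring d p
          ... | c , (t , low , c~t) , w , w∈ , v~ with em ℓ {H ⊢ t ~ 𝟎}
          ...   | yes t~0 = ~trans v~w (reduced-exact d (ℕ.<⇒≤ d<) w∈ (~trans (~sym (cut T′-zero v~w)) v~0))
            where
            v~w : (_∈ T′) ⊢ v ~ w
            v~w = ~trans v~ (~trans (⊕-cong ~refl (~trans (⊗-congʳ (~trans c~t
              (cut (λ p∈ → hyp (there p∈)) (exact t low t~0)))) (ax (zeroˡ _)))) (B.+-identityʳ w))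
          ...   | no t≁0 with proj₂ isField t t≁0
          ...     | b , tb~1 = contradiction (minimal d (b ⊗ w ⊕ y ,
              K.Monic-resp (ax (+-comm _ _)) (K.Monic-+ k.isSubring (power d) (K.Poly<-scale k.isSubring b∈ (transfer w∈))) ,
              relation))
              (ℕ.<⇒≱ d<)
            where
            y = var i B.^ d
            b∈ : k b
            b∈ = k.inverse∈ (proj₂ terms t low) tb~1
            relation : H ⊢ b ⊗ w ⊕ y ~ 𝟎
            relation = ~trans (⊕-cong ~refl (~trans (~sym (ax (*-identityˡ y))) (⊗-congʳ (~sym tb~1))))
              (~trans (K.solve 4 (λ b w t y → b K.:* w K.:+ (t K.:* b) K.:* y K.:= b K.:* (w K.:+ t K.:* y)) ~refl b w t y)
              (~trans (⊗-cong ~refl (~trans (⊕-cong ~refl (⊗-congʳ (~sym (cut T′-zero c~t))))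
                                            (~trans (~sym (cut T′-zero v~)) v~0)))
              (K.zeroʳ b)))

        T′-exact : Exact (suc i) T′
        T′-exact t low t~0 = reduced-exact (suc e) ℕ.≤-refl
          (B.reduce S-subring (term-Monic S-subring low∈S (cons low-a monic-q)) (hyp (here ≡.refl))
            (proj₂ (term-Poly S-subring low∈S t low)))
          t~0

      build : ∀ m i {k : K.Subset} → IsSubfieldOf k → Terms i k → (∀ v → K.Adjoin k (vars i m) v) →
        ∀ {T} → Triangular i T → (∀ {p} → p ∈ T → H ⊢ p ~ 𝟎) → Exact i T →
        ∃[ T′ ] Triangular (i ℕ.+ m) T′ × Exact (i ℕ.+ m) T′
      build zero i sub terms whole {T} tri T-zero exact rewrite ℕ.+-identityʳ i = T , tri , exact
      build (suc m) i {k} sub terms whole {T} tri T-zero exact =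
        ≡.subst (λ j → ∃[ T′ ] Triangular j T′ × Exact j T′) (≡.sym (ℕ.+-suc i m)) (adjoin (minimal-relation sub alg))
        where
        alg : Algebraic k (var i)
        alg = first-algebraic sub (var i) (vars (suc i) m) whole

        continue : ∀ {e a q} → Low i a → MonicIn i e q → H ⊢ a ⊕ var i ⊗ q ~ 𝟎 → Minimal sub (var i) (suc e) →
          ∃[ T′ ] Triangular (suc i ℕ.+ m) T′ × Exact (suc i ℕ.+ m) T′
        continue low-a monic-q p~0 minimal = build m (suc i) (Poly-subfield sub alg)
          ((λ (d , p) → Poly<-term terms p) , term-Poly (IsSubfieldOf.isSubring sub) (proj₂ terms))
          whole (cons tri low-a monic-q) T′-zero T′-exact
          where open Step sub terms T-zero exact low-a monic-q p~0 minimal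

        adjoin : (∃[ e ] (∃[ z ] K.Monic k (var i) e z × H ⊢ z ~ 𝟎) × Minimal sub (var i) e) →
          ∃[ T′ ] Triangular (suc i ℕ.+ m) T′ × Exact (suc i ℕ.+ m) T′
        adjoin (zero , (z , K.one z~1 , z~0) , minimal) = contradiction (~trans (~sym z~1) z~0) 1≉0
        adjoin (suc e , (z , K.cons s∈ p z~ , z~0) , minimal) =
          let a , low-a , s~a = proj₁ terms s∈
              q , monic-q , w~q = Monic-term terms p
          in continue low-a monic-q (~trans (~sym (⊕-cong s~a (⊗-cong ~refl w~q))) (~trans (~sym z~) z~0)) minimal

      triangular-system : ∃[ T ] Triangular n T × Exact n T
      triangular-system = build n 0 Constant-subfield
        ((λ (i , p) → con i , tt , p) , closed) (everything high) nil (λ ()) exact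
        where
        closed : ∀ {H′} t → Low 0 t → ∃[ i ] H′ ⊢ t ~ con i
        closed (con i) _ = i , ~refl
        closed (s ⊕ t) (p , q) with closed s p | closed t q
        ... | i , eq | j , eq′ = addᶜ i j , ~trans (⊕-cong eq eq′) (ax (con-+ i j))
        closed (s ⊗ t) (p , q) with closed s p | closed t q
        ... | i , eq | j , eq′ = mulᶜ i j , ~trans (⊗-cong eq eq′) (ax (con-* i j))

        exact : Exact 0 []
        exact t low t~0 with closed {_∈ []} t low
        ... | i , eq with em ℓ {ν i R.≈ R.0#}
        ...   | yes νi≈0 = ~trans eq (ax (con-≈ (R.trans νi≈0 (R.sym ν-zero))))
        ...   | no  νi≉0 with constant-inverse {i = i} (~trans (~sym t~0) (cut (λ ()) eq)) νi≉0
        ...     | j , p = contradiction (~trans (~sym p) (ax (zeroˡ _))) 1≉0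

    refutation-or-triangular : ∀ E → (_∈ E) ⊢ 𝟏 ~ 𝟎 ⊎ (∃[ n ] ∃[ T ] Triangular n T × Entails T E)
    refutation-or-triangular E with em ℓ {(_∈ E) ⊢ 𝟏 ~ 𝟎} | bounded E
    ... | yes p | _ = inj₁ p
    ... | no consistent | n , low with maximal E n (base-consistent E n low consistent)
    ...   | l , consistent-l , max with Field.triangular-system (extension E n l) n (λ n≤i → inj₂ (inj₂ (_ , n≤i , ≡.refl))) (consistent-l , inverse)
      where
      inverse : ∀ v → ¬ (extension E n l ⊢ v ~ 𝟎) → ∃[ w ] extension E n l ⊢ v ⊗ w ~ 𝟏
      inverse v v≁0 with deduction (λ { (inj₁ (here eq)) → inj₁ eq ; (inj₁ (there t∈)) → inj₂ (inj₁ t∈) ; (inj₂ h) → inj₂ (inj₂ h) })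
                           (decidable-stable (em ℓ) (max v v≁0))
      ... | w , p = w , ~trans (ax (*-comm v w)) (~sym (~trans p (ax (+-identityˡ _))))
    ...     | T , tri , exact = inj₂ (n , T , tri , All.tabulate λ {f} f∈ →
      exact f (All.lookup low f∈) (hyp (inj₂ (inj₁ f∈))))

module Codes where
  open import Data.Nat.Base using (_≤_; _+_)

  encode : Term → ℕ
  encode (con i) = ⟪ 0 , i ⟫
  encode (var i) = ⟪ 1 , i ⟫
  encode (s ⊕ t) = ⟪ 2 , ⟪ encode s , encode t ⟫ ⟫
  encode (s ⊗ t) = ⟪ 3 , ⟪ encode s , encode t ⟫ ⟫

  encodeTerms : List Term → ℕ
  encodeTerms E = listCode (List.map encode E)

  private
    tagged : ℕ → ℕ → (ℕ → Term) → Term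
    tagged 0 i dec = con i
    tagged 1 i dec = var i
    tagged 2 n dec = dec (fst n) ⊕ dec (snd n)
    tagged 3 n dec = dec (fst n) ⊗ dec (snd n)
    tagged _ _ _   = con 0

    decodeWith : ℕ → ℕ → Term
    decodeWith zero    n = con 0
    decodeWith (suc f) n = tagged (fst n) (snd n) (decodeWith f)

    fst≤ : ∀ n → fst n ≤ n
    fst≤ n = ℕ.≤-trans (ℕ.m≤m+n _ _) (fst+snd≤ n)

    decodeWith-stable : ∀ f g n → n < f → n < g → decodeWith f n ≡ decodeWith g n
    decodeWith-stable (suc f) (suc g) n (s≤s n≤f) (s≤s n≤g) = go (fst n) ≡.refl
      where
      go : ∀ q → q ≡ fst n → tagged q (snd n) (decodeWith f) ≡ tagged q (snd n) (decodeWith g)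
      go 0 eq = ≡.refl
      go 1 eq = ≡.refl
      go (suc (suc q)) eq = branch q
        where
        snd< : snd n < n
        snd< = ℕ.≤-trans (ℕ.+-monoˡ-≤ (snd n) (s≤s z≤n)) (≡.subst (λ q → q + snd n ≤ n) (≡.sym eq) (fst+snd≤ n))
        component : ∀ m → m ≤ snd n → decodeWith f m ≡ decodeWith g m
        component m m≤ = decodeWith-stable f g m (ℕ.≤-trans (s≤s m≤) (ℕ.≤-trans snd< n≤f))
                                                 (ℕ.≤-trans (s≤s m≤) (ℕ.≤-trans snd< n≤g))
        branch : ∀ q → tagged (suc (suc q)) (snd n) (decodeWith f) ≡ tagged (suc (suc q)) (snd n) (decodeWith g)
        branch 0 = cong₂ _⊕_ (component _ (fst≤ _)) (component _ (snd-≤ _))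
        branch 1 = cong₂ _⊗_ (component _ (fst≤ _)) (component _ (snd-≤ _))
        branch (suc (suc q)) = ≡.refl

    decodeTermsWith : ℕ → ℕ → List Term
    decodeTermsWith f       zero    = []
    decodeTermsWith zero    (suc n) = []
    decodeTermsWith (suc f) (suc n) = decodeWith (suc (fst n)) (fst n) ∷ decodeTermsWith f (snd n)

    decodeTermsWith-stable : ∀ f g n → n ≤ f → n ≤ g → decodeTermsWith f n ≡ decodeTermsWith g n
    decodeTermsWith-stable f       g       zero    n≤f       n≤g       = ≡.refl
    decodeTermsWith-stable (suc f) (suc g) (suc n) (s≤s n≤f) (s≤s n≤g) =
      cong (_ ∷_) (decodeTermsWith-stable f g (snd n) (ℕ.≤-trans (snd-≤ n) n≤f) (ℕ.≤-trans (snd-≤ n) n≤g))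

    ⟪2,⟫> : ∀ q n → n < ⟪ suc q , n ⟫
    ⟪2,⟫> q n = ℕ.≤-trans (ℕ.+-monoˡ-≤ n (s≤s z≤n)) (≡.subst₂ (λ a b → a + b ≤ ⟪ suc q , n ⟫)
      (fst-⟪⟫ (suc q) n) (snd-⟪⟫ (suc q) n) (fst+snd≤ ⟪ suc q , n ⟫))

  opaque
    decode : ℕ → Term
    decode n = decodeWith (suc n) n

    decodeTerms : ℕ → List Term
    decodeTerms n = decodeTermsWith n n

    decode-con : ∀ i → decode ⟪ 0 , i ⟫ ≡ con i
    decode-con i rewrite fst-⟪⟫ 0 i | snd-⟪⟫ 0 i = ≡.refl

    decode-var : ∀ i → decode ⟪ 1 , i ⟫ ≡ var i
    decode-var i rewrite fst-⟪⟫ 1 i | snd-⟪⟫ 1 i = ≡.refl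

    private
      component : ∀ q m a → a ≤ m → decodeWith ⟪ suc q , m ⟫ a ≡ decode a
      component q m a a≤ = decodeWith-stable _ (suc a) a (ℕ.≤-trans (s≤s a≤) (⟪2,⟫> q m)) ℕ.≤-refl

    decode-⊕ : ∀ a b → decode ⟪ 2 , ⟪ a , b ⟫ ⟫ ≡ decode a ⊕ decode b
    decode-⊕ a b rewrite fst-⟪⟫ 2 ⟪ a , b ⟫ | snd-⟪⟫ 2 ⟪ a , b ⟫ | fst-⟪⟫ a b | snd-⟪⟫ a b =
      cong₂ _⊕_ (component 1 _ a (x≤⟪⟫ a b)) (component 1 _ b (y≤⟪⟫ a b))

    decode-⊗ : ∀ a b → decode ⟪ 3 , ⟪ a , b ⟫ ⟫ ≡ decode a ⊗ decode b
    decode-⊗ a b rewrite fst-⟪⟫ 3 ⟪ a , b ⟫ | snd-⟪⟫ 3 ⟪ a , b ⟫ | fst-⟪⟫ a b | snd-⟪⟫ a b =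
      cong₂ _⊗_ (component 2 _ a (x≤⟪⟫ a b)) (component 2 _ b (y≤⟪⟫ a b))

    decode-[] : decodeTerms 0 ≡ []
    decode-[] = ≡.refl

    decode-∷ : ∀ t e → decodeTerms (suc ⟪ t , e ⟫) ≡ decode t ∷ decodeTerms e
    decode-∷ t e rewrite fst-⟪⟫ t e | snd-⟪⟫ t e =
      cong (_ ∷_) (decodeTermsWith-stable _ e e (y≤⟪⟫ t e) ℕ.≤-refl)

  decode-encode : ∀ t → decode (encode t) ≡ t
  decode-encode (con i) = decode-con i
  decode-encode (var i) = decode-var i
  decode-encode (s ⊕ t) = ≡.trans (decode-⊕ _ _) (cong₂ _⊕_ (decode-encode s) (decode-encode t))
  decode-encode (s ⊗ t) = ≡.trans (decode-⊗ _ _) (cong₂ _⊗_ (decode-encode s) (decode-encode t))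

open Codes

module _ {k : ℕ} where
  conF varF : Fun k → Fun k
  conF i = lit 0 ⟪,⟫ i
  varF i = lit 1 ⟪,⟫ i

  infixl 6 _⊕F_
  infixl 7 _⊗F_
  infixr 5 _∷F_
  _⊕F_ _⊗F_ _∷F_ : Fun k → Fun k → Fun k
  s ⊕F t = lit 2 ⟪,⟫ s ⟪,⟫ t
  s ⊗F t = lit 3 ⟪,⟫ s ⟪,⟫ t
  t ∷F e = sucF $$ ((t ⟪,⟫ e) ∷ [])

  EQ : Fun k → Fun k → Fun k → AtomF k
  EQ e s t = lit 0 ∷ e ∷ s ∷ t ∷ []

  LOW MON TRI SAT : Fun k → Fun k → AtomF k
  LOW i t = lit 1 ∷ i ∷ t ∷ lit 0 ∷ []
  MON i q = lit 2 ∷ i ∷ q ∷ lit 0 ∷ []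
  TRI i T = lit 3 ∷ i ∷ T ∷ lit 0 ∷ []
  SAT T E = lit 4 ∷ T ∷ E ∷ lit 0 ∷ []

record Computableᶜ {c ℓ} {R : CommutativeRing c ℓ} (coefficients : Coefficients R) : Set ℓ where
  open CommutativeRing R using (_≈_)
  open Coefficients coefficients
  field
    addᶜF mulᶜF selectF : Fun 2
    addᶜF-correct   : ∀ i j → fun addᶜF (i ∷ j ∷ []) ≡ addᶜ i j
    mulᶜF-correct   : ∀ i j → fun mulᶜF (i ∷ j ∷ []) ≡ mulᶜ i j
    select-sound    : ∀ i j → ν i ≈ ν (fun selectF (i ∷ j ∷ []))
    select-complete : ∀ i j → ν i ≈ ν j → fun selectF (i ∷ j ∷ []) ≡ j

module TermProgram {c ℓ} (R : CommutativeRing c ℓ) (coefficients : Coefficients R)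
                   (computable : Computableᶜ coefficients) where
  open Coefficients coefficients
  open Computableᶜ computable
  open Theory R coefficients

  𝟎F 𝟏F : ∀ {k} → Fun k
  𝟎F = conF (lit zeroᶜ)
  𝟏F = conF (lit oneᶜ)

  private
    x₀ : ∀ {k} → Fun (1 ℕ.+ k)
    x₀ = arg 0F
    x₁ : ∀ {k} → Fun (2 ℕ.+ k)
    x₁ = arg 1F
    x₂ : ∀ {k} → Fun (3 ℕ.+ k)
    x₂ = arg 2F
    x₃ : ∀ {k} → Fun (4 ℕ.+ k)
    x₃ = arg 3F

  equational : Program
  equational =
    clause 3 (EQ x₀ x₂ x₁) (EQ x₀ x₁ x₂ ∷ []) ∷
    clause 4 (EQ x₀ x₁ x₃) (EQ x₀ x₁ x₂ ∷ EQ x₀ x₂ x₃ ∷ []) ∷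
    clause 4 (EQ x₀ (x₁ ⊕F x₃) (x₂ ⊕F x₃)) (EQ x₀ x₁ x₂ ∷ []) ∷
    clause 4 (EQ x₀ (x₁ ⊗F x₃) (x₂ ⊗F x₃)) (EQ x₀ x₁ x₂ ∷ []) ∷
    clause 4 (EQ x₀ ((x₁ ⊕F x₂) ⊕F x₃) (x₁ ⊕F (x₂ ⊕F x₃))) [] ∷
    clause 3 (EQ x₀ (x₁ ⊕F x₂) (x₂ ⊕F x₁)) [] ∷
    clause 2 (EQ x₀ (𝟎F ⊕F x₁) x₁) [] ∷
    clause 4 (EQ x₀ ((x₁ ⊗F x₂) ⊗F x₃) (x₁ ⊗F (x₂ ⊗F x₃))) [] ∷
    clause 3 (EQ x₀ (x₁ ⊗F x₂) (x₂ ⊗F x₁)) [] ∷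
    clause 2 (EQ x₀ (𝟏F ⊗F x₁) x₁) [] ∷
    clause 4 (EQ x₀ (x₁ ⊗F (x₂ ⊕F x₃)) (x₁ ⊗F x₂ ⊕F x₁ ⊗F x₃)) [] ∷
    clause 2 (EQ x₀ (𝟎F ⊗F x₁) 𝟎F) [] ∷
    clause 3 (EQ x₀ (conF x₁ ⊕F conF x₂) (conF (addᶜF $$ (x₁ ∷ x₂ ∷ [])))) [] ∷
    clause 3 (EQ x₀ (conF x₁ ⊗F conF x₂) (conF (mulᶜF $$ (x₁ ∷ x₂ ∷ [])))) [] ∷
    clause 3 (EQ x₀ (conF x₁) (conF (selectF $$ (x₁ ∷ x₂ ∷ [])))) [] ∷
    clause 2 (EQ (x₁ ∷F x₀) x₁ 𝟎F) [] ∷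
    clause 3 (EQ (x₁ ∷F x₀) x₂ 𝟎F) (EQ x₀ x₂ 𝟎F ∷ []) ∷
    []

  triangularity : Program
  triangularity =
    clause 2 (LOW x₀ (conF x₁)) [] ∷
    clause 1 (LOW (sucF $$ (x₀ ∷ [])) (varF x₀)) [] ∷
    clause 2 (LOW (sucF $$ (x₀ ∷ [])) x₁) (LOW x₀ x₁ ∷ []) ∷
    clause 3 (LOW x₀ (x₁ ⊕F x₂)) (LOW x₀ x₁ ∷ LOW x₀ x₂ ∷ []) ∷
    clause 3 (LOW x₀ (x₁ ⊗F x₂)) (LOW x₀ x₁ ∷ LOW x₀ x₂ ∷ []) ∷
    clause 1 (MON x₀ 𝟏F) [] ∷
    clause 3 (MON x₀ (x₁ ⊕F varF x₀ ⊗F x₂)) (LOW x₀ x₁ ∷ MON x₀ x₂ ∷ []) ∷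
    clause 0 (TRI (lit 0) (lit 0)) [] ∷
    clause 4 (TRI (sucF $$ (x₀ ∷ [])) ((x₂ ⊕F varF x₀ ⊗F x₃) ∷F x₁)) (TRI x₀ x₁ ∷ LOW x₀ x₂ ∷ MON x₀ x₃ ∷ []) ∷
    clause 1 (SAT x₀ (lit 0)) [] ∷
    clause 3 (SAT x₀ (x₂ ∷F x₁)) (EQ x₀ x₂ 𝟎F ∷ SAT x₀ x₁ ∷ []) ∷
    []

  termProgram : Program
  termProgram = equational ++ triangularity

  module _ (Other : Atom → Set (c ⊔ ℓ)) where
    Meaning : Atom → Set (c ⊔ ℓ)
    Meaning (0 ∷ e ∷ s ∷ t ∷ []) = Lift (c ⊔ ℓ) ((_∈ decodeTerms e) ⊢ decode s ~ decode t)
    Meaning (1 ∷ i ∷ t ∷ _ ∷ []) = Lift (c ⊔ ℓ) (Low i (decode t))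
    Meaning (2 ∷ i ∷ q ∷ _ ∷ []) = Lift (c ⊔ ℓ) (∃[ d ] MonicIn i d (decode q))
    Meaning (3 ∷ i ∷ T ∷ _ ∷ []) = Lift (c ⊔ ℓ) (Triangular i (decodeTerms T))
    Meaning (4 ∷ T ∷ E ∷ _ ∷ []) = Lift (c ⊔ ℓ) (Entails (decodeTerms T) (decodeTerms E))
    Meaning a                    = Other a

    private
      module _ {H : Hypotheses} where
        by : ∀ {a b s t} → decode a ≡ s → decode b ≡ t → H ⊢ s ~ t → H ⊢ decode a ~ decode b
        by ≡.refl ≡.refl p = p

      _⊕ᵈ_ : ∀ {a b s t} → decode a ≡ s → decode b ≡ t → decode ⟪ 2 , ⟪ a , b ⟫ ⟫ ≡ s ⊕ t
      _⊕ᵈ_ {a} {b} ≡.refl ≡.refl = decode-⊕ a b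

      _⊗ᵈ_ : ∀ {a b s t} → decode a ≡ s → decode b ≡ t → decode ⟪ 3 , ⟪ a , b ⟫ ⟫ ≡ s ⊗ t
      _⊗ᵈ_ {a} {b} ≡.refl ≡.refl = decode-⊗ a b

      𝟎ᵈ : decode ⟪ 0 , zeroᶜ ⟫ ≡ 𝟎
      𝟎ᵈ = decode-con zeroᶜ

      𝟏ᵈ : decode ⟪ 0 , oneᶜ ⟫ ≡ 𝟏
      𝟏ᵈ = decode-con oneᶜ

      r : ∀ {a} → decode a ≡ decode a
      r = ≡.refl

    equational-sound : All (Sound Meaning) equational
    equational-sound =
      (λ { (e ∷ s ∷ t ∷ []) (lift p ∷ []) → lift (~sym p) }) ∷
      (λ { (e ∷ s ∷ t ∷ u ∷ []) (lift p ∷ lift q ∷ []) → lift (~trans p q) }) ∷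
      (λ { (e ∷ s ∷ t ∷ u ∷ []) (lift p ∷ []) → lift (by (r ⊕ᵈ r) (r ⊕ᵈ r) (⊕-congʳ p)) }) ∷
      (λ { (e ∷ s ∷ t ∷ u ∷ []) (lift p ∷ []) → lift (by (r ⊗ᵈ r) (r ⊗ᵈ r) (⊗-congʳ p)) }) ∷
      (λ { (e ∷ s ∷ t ∷ u ∷ []) [] → lift (by ((r ⊕ᵈ r) ⊕ᵈ r) (r ⊕ᵈ (r ⊕ᵈ r)) (ax (+-assoc _ _ _))) }) ∷
      (λ { (e ∷ s ∷ t ∷ []) [] → lift (by (r ⊕ᵈ r) (r ⊕ᵈ r) (ax (+-comm _ _))) }) ∷
      (λ { (e ∷ t ∷ []) [] → lift (by (𝟎ᵈ ⊕ᵈ r) r (ax (+-identityˡ _))) }) ∷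
      (λ { (e ∷ s ∷ t ∷ u ∷ []) [] → lift (by ((r ⊗ᵈ r) ⊗ᵈ r) (r ⊗ᵈ (r ⊗ᵈ r)) (ax (*-assoc _ _ _))) }) ∷
      (λ { (e ∷ s ∷ t ∷ []) [] → lift (by (r ⊗ᵈ r) (r ⊗ᵈ r) (ax (*-comm _ _))) }) ∷
      (λ { (e ∷ t ∷ []) [] → lift (by (𝟏ᵈ ⊗ᵈ r) r (ax (*-identityˡ _))) }) ∷
      (λ { (e ∷ s ∷ t ∷ u ∷ []) [] → lift (by (r ⊗ᵈ (r ⊕ᵈ r)) ((r ⊗ᵈ r) ⊕ᵈ (r ⊗ᵈ r)) (ax (distribˡ _ _ _))) }) ∷
      (λ { (e ∷ t ∷ []) [] → lift (by (𝟎ᵈ ⊗ᵈ r) 𝟎ᵈ (ax (zeroˡ _))) }) ∷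
      (λ { (e ∷ i ∷ j ∷ []) [] → lift (by (decode-con i ⊕ᵈ decode-con j)
             (≡.trans (decode-con _) (cong con (addᶜF-correct i j))) (ax (con-+ i j))) }) ∷
      (λ { (e ∷ i ∷ j ∷ []) [] → lift (by (decode-con i ⊗ᵈ decode-con j)
             (≡.trans (decode-con _) (cong con (mulᶜF-correct i j))) (ax (con-* i j))) }) ∷
      (λ { (e ∷ i ∷ j ∷ []) [] → lift (by (decode-con i) (decode-con _) (ax (con-≈ (select-sound i j)))) }) ∷
      (λ { (e ∷ f ∷ []) [] → lift (by r 𝟎ᵈ (hyp (≡.subst (decode f ∈_) (≡.sym (decode-∷ f e)) (here ≡.refl)))) }) ∷
      (λ { (e ∷ f ∷ t ∷ []) (lift p ∷ []) → lift (cut (λ t∈ → hyp (≡.subst (_ ∈_) (≡.sym (decode-∷ f e)) (there t∈))) p) }) ∷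
      []

    triangularity-sound : All (Sound Meaning) triangularity
    triangularity-sound =
      (λ { (n ∷ i ∷ []) [] → lift (≡.subst (Low n) (≡.sym (decode-con i)) tt) }) ∷
      (λ { (n ∷ []) [] → lift (≡.subst (Low (suc n)) (≡.sym (decode-var n)) ℕ.≤-refl) }) ∷
      (λ { (n ∷ t ∷ []) (lift p ∷ []) → lift (Low-≤ (ℕ.n≤1+n n) (decode t) p) }) ∷
      (λ { (n ∷ s ∷ t ∷ []) (lift p ∷ lift q ∷ []) → lift (≡.subst (Low n) (≡.sym (decode-⊕ s t)) (p , q)) }) ∷
      (λ { (n ∷ s ∷ t ∷ []) (lift p ∷ lift q ∷ []) → lift (≡.subst (Low n) (≡.sym (decode-⊗ s t)) (p , q)) }) ∷
      (λ { (i ∷ []) [] → lift (0 , ≡.subst (MonicIn i 0) (≡.sym 𝟏ᵈ) one) }) ∷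
      (λ { (i ∷ a ∷ q ∷ []) (lift low ∷ lift (d , m) ∷ []) →
             lift (suc d , ≡.subst (MonicIn i (suc d)) (≡.sym (r ⊕ᵈ (decode-var i ⊗ᵈ r))) (cons low m)) }) ∷
      (λ { [] [] → lift (≡.subst (Triangular 0) (≡.sym decode-[]) nil) }) ∷
      (λ { (i ∷ T ∷ a ∷ q ∷ []) (lift tri ∷ lift low ∷ lift (d , m) ∷ []) →
             lift (≡.subst (Triangular (suc i)) (≡.sym (≡.trans (decode-∷ _ T) (cong (_∷ _) (r ⊕ᵈ (decode-var i ⊗ᵈ r)))))
               (cons tri low m)) }) ∷
      (λ { (T ∷ []) [] → lift (≡.subst (Entails (decodeTerms T)) (≡.sym decode-[]) []) }) ∷
      (λ { (T ∷ E ∷ f ∷ []) (lift p ∷ lift ps ∷ []) →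
             lift (≡.subst (Entails (decodeTerms T)) (≡.sym (decode-∷ f E)) (by′ 𝟎ᵈ p ∷ ps)) }) ∷
      []
      where
      by′ : ∀ {H s b t} → decode b ≡ t → H ⊢ s ~ decode b → H ⊢ s ~ t
      by′ ≡.refl p = p

  module _ {P : Program} (⊆ : ∀ {C} → C ∈ termProgram → C ∈ P) where
    private
      apply : ∀ i ρ → All (Derivable P) (instances (List.lookup termProgram i) ρ) →
              Derivable P (funs (head (List.lookup termProgram i)) ρ)
      apply = rule-at termProgram ⊆

      module _ (e : ℕ) where
        ⊢-at : ℕ → ℕ → Set
        ⊢-at s t = Derivable P (0 ∷ e ∷ s ∷ t ∷ [])

        axiom-derivable : ∀ {s t} → Axiom s t → ⊢-at (encode s) (encode t)
        axiom-derivable (+-assoc s t u)  = apply (# 4) (e ∷ encode s ∷ encode t ∷ encode u ∷ []) []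
        axiom-derivable (+-comm s t)     = apply (# 5) (e ∷ encode s ∷ encode t ∷ []) []
        axiom-derivable (+-identityˡ t)  = apply (# 6) (e ∷ encode t ∷ []) []
        axiom-derivable (*-assoc s t u)  = apply (# 7) (e ∷ encode s ∷ encode t ∷ encode u ∷ []) []
        axiom-derivable (*-comm s t)     = apply (# 8) (e ∷ encode s ∷ encode t ∷ []) []
        axiom-derivable (*-identityˡ t)  = apply (# 9) (e ∷ encode t ∷ []) []
        axiom-derivable (distribˡ s t u) = apply (# 10) (e ∷ encode s ∷ encode t ∷ encode u ∷ []) []
        axiom-derivable (zeroˡ t)        = apply (# 11) (e ∷ encode t ∷ []) []
        axiom-derivable (con-+ i j)      = ≡.subst (λ k → ⊢-at (encode (con i ⊕ con j)) ⟪ 0 , k ⟫)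
          (addᶜF-correct i j) (apply (# 12) (e ∷ i ∷ j ∷ []) [])
        axiom-derivable (con-* i j)      = ≡.subst (λ k → ⊢-at (encode (con i ⊗ con j)) ⟪ 0 , k ⟫)
          (mulᶜF-correct i j) (apply (# 13) (e ∷ i ∷ j ∷ []) [])
        axiom-derivable (con-≈ {i} {j} eq) = ≡.subst (λ k → ⊢-at ⟪ 0 , i ⟫ ⟪ 0 , k ⟫)
          (select-complete i j eq) (apply (# 14) (e ∷ i ∷ j ∷ []) [])

    member-derivable : ∀ {E t} → t ∈ E → ⊢-at (encodeTerms E) (encode t) (encode 𝟎)
    member-derivable {f ∷ E} (here ≡.refl) = apply (# 15) (encodeTerms E ∷ encode f ∷ []) []
    member-derivable {f ∷ E} {t} (there t∈) =
      apply (# 16) (encodeTerms E ∷ encode f ∷ encode t ∷ []) (member-derivable t∈ ∷ [])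

    ⊢-derivable : ∀ {E s t} → (_∈ E) ⊢ s ~ t → Derivable P (0 ∷ encodeTerms E ∷ encode s ∷ encode t ∷ [])
    ⊢-derivable {E} (ax a) = axiom-derivable (encodeTerms E) a
    ⊢-derivable (hyp t∈) = member-derivable t∈
    ⊢-derivable {E} (~sym {s} {t} p) = apply (# 0) (encodeTerms E ∷ encode s ∷ encode t ∷ []) (⊢-derivable p ∷ [])
    ⊢-derivable {E} (~trans {s} {t} {u} p q) =
      apply (# 1) (encodeTerms E ∷ encode s ∷ encode t ∷ encode u ∷ []) (⊢-derivable p ∷ ⊢-derivable q ∷ [])
    ⊢-derivable {E} (⊕-congʳ {s} {t} {u} p) =
      apply (# 2) (encodeTerms E ∷ encode s ∷ encode t ∷ encode u ∷ []) (⊢-derivable p ∷ [])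
    ⊢-derivable {E} (⊗-congʳ {s} {t} {u} p) =
      apply (# 3) (encodeTerms E ∷ encode s ∷ encode t ∷ encode u ∷ []) (⊢-derivable p ∷ [])

    var-derivable : ∀ {n i} → suc i ℕ.≤′ n → Derivable P (1 ∷ n ∷ encode (var i) ∷ 0 ∷ [])
    var-derivable {suc n} ℕ.≤′-refl     = apply (# 18) (n ∷ []) []
    var-derivable {suc n} {i} (ℕ.≤′-step p) = apply (# 19) (n ∷ encode (var i) ∷ []) (var-derivable p ∷ [])

    Low-derivable : ∀ {n} t → Low n t → Derivable P (1 ∷ n ∷ encode t ∷ 0 ∷ [])
    Low-derivable {n} (con i) _ = apply (# 17) (n ∷ i ∷ []) []
    Low-derivable (var i) i<n = var-derivable (ℕ.≤⇒≤′ i<n)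
    Low-derivable {n} (s ⊕ t) (p , q) =
      apply (# 20) (n ∷ encode s ∷ encode t ∷ []) (Low-derivable s p ∷ Low-derivable t q ∷ [])
    Low-derivable {n} (s ⊗ t) (p , q) =
      apply (# 21) (n ∷ encode s ∷ encode t ∷ []) (Low-derivable s p ∷ Low-derivable t q ∷ [])

    Monic-derivable : ∀ {i d q} → MonicIn i d q → Derivable P (2 ∷ i ∷ encode q ∷ 0 ∷ [])
    Monic-derivable {i} one = apply (# 22) (i ∷ []) []
    Monic-derivable {i} (cons {a = a} {q} low m) =
      apply (# 23) (i ∷ encode a ∷ encode q ∷ []) (Low-derivable a low ∷ Monic-derivable m ∷ [])

    Triangular-derivable : ∀ {i T} → Triangular i T → Derivable P (3 ∷ i ∷ encodeTerms T ∷ 0 ∷ [])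
    Triangular-derivable nil = apply (# 24) [] []
    Triangular-derivable (cons {i} {T} {a = a} {q} tri low m) =
      apply (# 25) (i ∷ encodeTerms T ∷ encode a ∷ encode q ∷ [])
        (Triangular-derivable tri ∷ Low-derivable a low ∷ Monic-derivable m ∷ [])

    Entails-derivable : ∀ {T E} → Entails T E → Derivable P (4 ∷ encodeTerms T ∷ encodeTerms E ∷ 0 ∷ [])
    Entails-derivable {T} [] = apply (# 26) (encodeTerms T ∷ []) []
    Entails-derivable {T} {f ∷ E} (p ∷ ps) =
      apply (# 27) (encodeTerms T ∷ encodeTerms E ∷ encode f ∷ []) (⊢-derivable p ∷ Entails-derivable ps ∷ [])

module Solutions {c ℓ} (R : CommutativeRing c ℓ) (closed : IsAlgebraicallyClosedField R)
                 (coefficients : Coefficients R) where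
  open CommutativeRing R
  open SemiringSum semiring using (sum; sum-syntax; sum-cong-≋; *-distribˡ-sum)
  open SemiringExp semiring using (_^_)
  open Coefficients coefficients
  open Theory R coefficients hiding (zeroˡ; +-identityˡ; *-identityˡ)
  open Value

  Agree : ℕ → (ℕ → Carrier) → (ℕ → Carrier) → Set _
  Agree n x y = ∀ {i} → i ℕ.< n → x i ≡ y i

  eval-agree : ∀ {n x y} → Agree n x y → ∀ t → Low n t → eval x t ≡ eval y t
  eval-agree agree (con i) _       = ≡.refl
  eval-agree agree (var i) i<n     = agree i<n
  eval-agree agree (s ⊕ t) (p , q) = ≡.cong₂ _+_ (eval-agree agree s p) (eval-agree agree t q)
  eval-agree agree (s ⊗ t) (p , q) = ≡.cong₂ _*_ (eval-agree agree s p) (eval-agree agree t q)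

  polynomial : ∀ {d} → (Fin (suc d) → Carrier) → Carrier → Carrier
  polynomial {d} a X = ∑[ j < suc d ] (a j * X ^ toℕ j)

  prepend : ∀ {d} → Carrier → (Fin d → Carrier) → Fin (suc d) → Carrier
  prepend c a zero    = c
  prepend c a (suc j) = a j

  polynomial-prepend : ∀ {d} c (a : Fin (suc d) → Carrier) X → polynomial (prepend c a) X ≈ c + X * polynomial a X
  polynomial-prepend {d} c a X = +-cong (*-identityʳ c) (sym (trans
    (*-distribˡ-sum X (λ j → a j * X ^ toℕ j))
    (sum-cong-≋ λ j → solve 3 (λ X a y → X :* (a :* y) := a :* (X :* y)) refl X (a j) (X ^ toℕ j))))
    where open SemiringSolver commutativeSemiring using (solve; _:=_; _:*_)

  monic-polynomial : ∀ {i d q} → MonicIn i d q → ∀ x → ∃[ a ] a (fromℕ d) ≈ 1# ×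
    (∀ {y} → Agree i x y → eval y q ≈ polynomial {d} a (y i))
  monic-polynomial one x = (λ _ → 1#) , refl ,
    λ _ → trans ν-one (sym (trans (+-identityʳ _) (*-identityˡ 1#)))
  monic-polynomial {i} (cons {a = c} {q} low m) x with monic-polynomial m x
  ... | a , lead , eq = prepend (eval x c) a , lead , λ {y} agree →
    trans (+-cong (reflexive (≡.sym (eval-agree agree c low))) (*-congˡ (eq agree)))
      (sym (polynomial-prepend (eval x c) a (y i)))

  MonicIn-Low : ∀ {i d q} → MonicIn i d q → Low (suc i) q
  MonicIn-Low one = tt
  MonicIn-Low {i} (cons {a = a} low m) = Low-≤ (ℕ.n≤1+n i) a low , ℕ.≤-refl , MonicIn-Low m

  Triangular-Low : ∀ {n T} → Triangular n T → All (Low n) T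
  Triangular-Low nil = []
  Triangular-Low {suc i} (cons {a = a} tri low m) =
    MonicIn-Low (cons low m) ∷ All.map (λ {t} → Low-≤ (ℕ.n≤1+n i) t) (Triangular-Low tri)

  update : ℕ → Carrier → (ℕ → Carrier) → ℕ → Carrier
  update i X x j with i ℕ.≟ j
  ... | yes _ = X
  ... | no  _ = x j

  update-same : ∀ i X x → update i X x i ≡ X
  update-same i X x with i ℕ.≟ i
  ... | yes _  = ≡.refl
  ... | no i≢i = contradiction ≡.refl i≢i

  update-agree : ∀ i X x → Agree i x (update i X x)
  update-agree i X x {j} j<i with i ℕ.≟ j
  ... | yes ≡.refl = contradiction j<i (ℕ.<-irrefl ≡.refl)
  ... | no _       = ≡.refl

  Zero : (ℕ → Carrier) → List Term → Set ℓ
  Zero x E = All (λ t → eval x t ≈ 0#) E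

  triangular-zero : ∀ {n T} → Triangular n T → ∃[ x ] Zero x T
  triangular-zero nil = (λ _ → 0#) , []
  triangular-zero {suc i} (cons {d = d} {a = c} {q} tri low m) with triangular-zero tri
  ... | x , zeros with monic-polynomial (cons low m) x
  ... | a , lead , eq with proj₂ closed d a (λ lead≈0 → nontrivial (trans (sym lead) lead≈0))
  ... | X , root = update i X x ,
    trans (eq agree) (≡.subst (λ Y → polynomial a Y ≈ 0#) (≡.sym (update-same i X x)) root) ∷
    All.zipWith (λ {t} (low-t , eq) → trans (reflexive (≡.sym (eval-agree agree t low-t))) eq)
      (Triangular-Low tri , zeros)
    where
    agree : Agree i x (update i X x)
    agree = update-agree i X x

  Triangular⇒Zero : ∀ {n T E} → Triangular n T → Entails T E → ∃[ x ] Zero x E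
  Triangular⇒Zero tri ent with triangular-zero tri
  ... | x , zeros = x , All.map (λ p → trans (value-sound x (All.lookup zeros) p) ν-zero) ent

  refutation⇒no-Zero : ∀ {E} → (_∈ E) ⊢ 𝟏 ~ 𝟎 → ∀ x → ¬ Zero x E
  refutation⇒no-Zero p x zeros =
    nontrivial (trans (sym ν-one) (trans (value-sound x (All.lookup zeros) p) ν-zero))

-- Terms computed from the values of program variables

data TermF (k : ℕ) : Set where
  con var : Fun k → TermF k
  _⊕_ _⊗_ : TermF k → TermF k → TermF k

module _ {k : ℕ} where
  compile : TermF k → Fun k
  compile (con i) = conF i
  compile (var i) = varF i
  compile (s ⊕ t) = compile s ⊕F compile t
  compile (s ⊗ t) = compile s ⊗F compile t

  instantiate : Vec ℕ k → TermF k → Term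
  instantiate ρ (con i) = con (fun i ρ)
  instantiate ρ (var i) = var (fun i ρ)
  instantiate ρ (s ⊕ t) = instantiate ρ s ⊕ instantiate ρ t
  instantiate ρ (s ⊗ t) = instantiate ρ s ⊗ instantiate ρ t

  fun-compile : ∀ ρ t → fun (compile t) ρ ≡ encode (instantiate ρ t)
  fun-compile ρ (con i) = ≡.refl
  fun-compile ρ (var i) = ≡.refl
  fun-compile ρ (s ⊕ t) = cong₂ (λ a b → ⟪ 2 , ⟪ a , b ⟫ ⟫) (fun-compile ρ s) (fun-compile ρ t)
  fun-compile ρ (s ⊗ t) = cong₂ (λ a b → ⟪ 3 , ⟪ a , b ⟫ ⟫) (fun-compile ρ s) (fun-compile ρ t)

  infixr 5 _++F_
  _++F_ : List (TermF k) → Fun k → Fun k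
  []       ++F e = e
  (t ∷ ts) ++F e = compile t ∷F (ts ++F e)

  decode-++F : ∀ ρ ts e → decodeTerms (fun (ts ++F e) ρ) ≡ List.map (instantiate ρ) ts ++ decodeTerms (fun e ρ)
  decode-++F ρ []       e = ≡.refl
  decode-++F ρ (t ∷ ts) e = ≡.trans (decode-∷ _ _)
    (cong₂ _∷_ (≡.trans (cong decode (fun-compile ρ t)) (decode-encode _)) (decode-++F ρ ts e))

  encode-++F : ∀ ρ ts e {E} → fun e ρ ≡ encodeTerms E →
    fun (ts ++F e) ρ ≡ encodeTerms (List.map (instantiate ρ) ts ++ E)
  encode-++F ρ []       e eq = eq
  encode-++F ρ (t ∷ ts) e eq = cong₂ (λ a b → suc ⟪ a , b ⟫) (fun-compile ρ t) (encode-++F ρ ts e eq)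

data Sign : Set where
  pos neg : Sign

data Kind : Set where
  constant unknown : Kind

signTag : Sign → ℕ
signTag pos = 0
signTag neg = 1

kindTag : Kind → ℕ
kindTag constant = 0
kindTag unknown = 1

symbol : Kind → ℕ → Symbol
symbol constant i = const i
symbol unknown i = var i

letter : Sign → Symbol → Letter
letter pos s = s ⁺
letter neg s = s ⁻

symbolOf : Letter → Symbol
symbolOf (s ⁺) = s
symbolOf (s ⁻) = s

symbolCode : Symbol → ℕ
symbolCode (const i) = ⟪ 0 , i ⟫
symbolCode (var i)   = ⟪ 1 , i ⟫

letterCode : Letter → ℕ
letterCode (s ⁺) = ⟪ 0 , symbolCode s ⟫
letterCode (s ⁻) = ⟪ 1 , symbolCode s ⟫

wordCode : List Letter → ℕ
wordCode u = listCode (List.map letterCode u)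

systemCode : System → ℕ
systemCode S = listCode (List.map wordCode S)

symbolCode-symbol : ∀ k i → symbolCode (symbol k i) ≡ ⟪ kindTag k , i ⟫
symbolCode-symbol constant i = ≡.refl
symbolCode-symbol unknown i = ≡.refl

letterCode-letter : ∀ sg s → letterCode (letter sg s) ≡ ⟪ signTag sg , symbolCode s ⟫
letterCode-letter pos s = ≡.refl
letterCode-letter neg s = ≡.refl

symbolOf-letter : ∀ sg s → symbolOf (letter sg s) ≡ s
symbolOf-letter pos s = ≡.refl
symbolOf-letter neg s = ≡.refl

symbolCode-injective : ∀ s s′ → symbolCode s ≡ symbolCode s′ → s ≡ s′
symbolCode-injective (const i) (const j) eq = cong const (proj₂ (⟪⟫-injective eq))
symbolCode-injective (var i)   (var j)   eq = cong var (proj₂ (⟪⟫-injective eq))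
symbolCode-injective (const i) (var j)   eq = contradiction (proj₁ (⟪⟫-injective eq)) λ ()
symbolCode-injective (var i)   (const j) eq = contradiction (proj₁ (⟪⟫-injective eq)) λ ()

letterCode-injective : ∀ l l′ → letterCode l ≡ letterCode l′ → l ≡ l′
letterCode-injective (s ⁺) (s′ ⁺) eq = cong _⁺ (symbolCode-injective s s′ (proj₂ (⟪⟫-injective eq)))
letterCode-injective (s ⁻) (s′ ⁻) eq = cong _⁻ (symbolCode-injective s s′ (proj₂ (⟪⟫-injective eq)))
letterCode-injective (s ⁺) (s′ ⁻) eq = contradiction (proj₁ (⟪⟫-injective eq)) λ ()
letterCode-injective (s ⁻) (s′ ⁺) eq = contradiction (proj₁ (⟪⟫-injective eq)) λ ()

listCode-injective : ∀ {X : Set} {f : X → ℕ} → (∀ x y → f x ≡ f y → x ≡ y) →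
  ∀ xs ys → listCode (List.map f xs) ≡ listCode (List.map f ys) → xs ≡ ys
listCode-injective inj []       []       eq = ≡.refl
listCode-injective inj (x ∷ xs) (y ∷ ys) eq with ⟪⟫-injective (ℕ.suc-injective eq)
... | eq₁ , eq₂ = cong₂ _∷_ (inj x y eq₁) (listCode-injective inj xs ys eq₂)

wordCode-injective : ∀ u v → wordCode u ≡ wordCode v → u ≡ v
wordCode-injective = listCode-injective letterCode-injective

systemCode-encode : ∀ S → systemCode S ≡ encodeSystem S
systemCode-encode = list λ u → list (λ { (s ⁺) → with-symbol 0 s ; (s ⁻) → with-symbol 1 s }) u
  where
  list : ∀ {X : Set} {f g : X → ℕ} → (∀ x → f x ≡ g x) → ∀ xs → listCode (List.map f xs) ≡ encodeList g xs
  list f≡g []       = ≡.refl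
  list f≡g (x ∷ xs) = cong suc (≡.trans (⟪⟫≡pair _ _) (cong₂ pair (f≡g x) (list f≡g xs)))
  symbols : ∀ s → symbolCode s ≡ encodeSymbol s
  symbols (const i) = ⟪⟫≡pair 0 i
  symbols (var i)   = ⟪⟫≡pair 1 i
  with-symbol : ∀ q s → ⟪ q , symbolCode s ⟫ ≡ pair q (encodeSymbol s)
  with-symbol q s = ≡.trans (⟪⟫≡pair q _) (cong (pair q) (symbols s))

-- The variables of the polynomial system are the entries of the letters and
-- of the values of the words.
letterVar wordVar : ∀ {n} → ℕ → Fin n → Fin n → ℕ
letterVar l r c = ⟪ 0 , ⟪ l , ⟪ toℕ r , toℕ c ⟫ ⟫ ⟫
wordVar   w r c = ⟪ 1 , ⟪ w , ⟪ toℕ r , toℕ c ⟫ ⟫ ⟫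

module GroupProgram {c ℓ} (R : CommutativeRing c ℓ) (closed : IsAlgebraicallyClosedField R)
  (coefficients : Coefficients R) (computable : Computableᶜ coefficients)
  (n : ℕ) (entryF : Fin n → Fin n → Fun 1) (polynomials : List ℤ[ Fin n × Fin n ]) where

  open CommutativeRing R hiding (zero)
  open SemiringSum semiring using (sum; sum-cong-≋)
  open Coefficients coefficients
  open Theory R coefficients using (𝟎; 𝟏; -𝟏; _⊢_~_; module Value; module Completeness; Triangular; Entails)
  open TermProgram R coefficients computable
  open Solutions R closed coefficients using (Zero; Triangular⇒Zero; refutation⇒no-Zero)
  open Matrices R using (Matrix; _≋_; _∙_; I)
  open Value using (eval)

  module _ {k : ℕ} where
    MatrixF : Set
    MatrixF = Fin n → Fin n → TermF k

    sumF : ∀ {m} → (Fin m → TermF k) → TermF k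
    sumF {zero}  f = con (lit zeroᶜ)
    sumF {suc m} f = f zero ⊕ sumF (λ i → f (suc i))

    infixl 7 _∙F_
    _∙F_ : MatrixF → MatrixF → MatrixF
    (M ∙F N) r c = sumF (λ k → M r k ⊗ N k c)

    identityF : ∀ {m} → Fin m → Fin m → TermF k
    identityF zero    zero    = con (lit oneᶜ)
    identityF zero    (suc _) = con (lit zeroᶜ)
    identityF (suc _) zero    = con (lit zeroᶜ)
    identityF (suc i) (suc j) = identityF i j

    evalℤF : ℤ[ Fin n × Fin n ] → MatrixF → TermF k
    evalℤF (var (r , c)) M = M r c
    evalℤF 𝟘 M             = con (lit zeroᶜ)
    evalℤF 𝟙 M             = con (lit oneᶜ)
    evalℤF (⊖ f) M         = con (lit -oneᶜ) ⊗ evalℤF f M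
    evalℤF (f ⊕ g) M       = evalℤF f M ⊕ evalℤF g M
    evalℤF (f ⊗ g) M       = evalℤF f M ⊗ evalℤF g M

    letterF wordF : Fun k → MatrixF
    letterF l r c = var (lit 0 ⟪,⟫ l ⟪,⟫ lit (toℕ r) ⟪,⟫ lit (toℕ c))
    wordF   w r c = var (lit 1 ⟪,⟫ w ⟪,⟫ lit (toℕ r) ⟪,⟫ lit (toℕ c))

    infix 4 _≋F_
    _≋F_ : MatrixF → MatrixF → List (TermF k)
    M ≋F N = List.concat (List.tabulate λ r → List.tabulate λ c → M r c ⊕ con (lit -oneᶜ) ⊗ N r c)

    module _ (x : ℕ → Carrier) (ρ : Vec ℕ k) where
      value : TermF k → Carrier
      value t = eval x (instantiate ρ t)

      values : MatrixF → Matrix n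
      values M r c = value (M r c)

      Vanish : List (TermF k) → Set ℓ
      Vanish = All (λ t → value t ≈ 0#)

      value-sumF : ∀ {m} (f : Fin m → TermF k) → value (sumF f) ≈ sum (λ i → value (f i))
      value-sumF {zero}  f = ν-zero
      value-sumF {suc m} f = +-congˡ (value-sumF (λ i → f (suc i)))

      values-∙F : ∀ M N → values (M ∙F N) ≋ values M ∙ values N
      values-∙F M N r c = value-sumF (λ k → M r k ⊗ N k c)

      values-identityF : ∀ {m} (i j : Fin m) → value (identityF i j) ≈ I i j
      values-identityF zero    zero    = ν-one
      values-identityF zero    (suc _) = ν-zero
      values-identityF (suc _) zero    = ν-zero
      values-identityF (suc i) (suc j) = values-identityF i j

      value-negate : ∀ v → ν -oneᶜ * v ≈ - v
      value-negate v = trans (*-congʳ ν--one) (-1*x≈-x v)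
        where open import Algebra.Properties.Ring ring using (-1*x≈-x)

      value-evalℤF : ∀ f M → value (evalℤF f M) ≈ evalℤ R f (λ (r , c) → values M r c)
      value-evalℤF (var (r , c)) M = refl
      value-evalℤF 𝟘 M       = ν-zero
      value-evalℤF 𝟙 M       = ν-one
      value-evalℤF (⊖ f) M   = trans (value-negate _) (-‿cong (value-evalℤF f M))
      value-evalℤF (f ⊕ g) M = +-cong (value-evalℤF f M) (value-evalℤF g M)
      value-evalℤF (f ⊗ g) M = *-cong (value-evalℤF f M) (value-evalℤF g M)

      ≋F-⇔ : ∀ {M N M′ N′} → values M ≋ M′ → values N ≋ N′ → Vanish (M ≋F N) ⇔ M′ ≋ N′
      ≋F-⇔ {M} {N} M≋ N≋ = mk⇔
        (λ p r c → trans (sym (M≋ r c)) (trans (equal (All.tabulate⁻ (All.tabulate⁻ (All.concat⁻ p) r) c)) (N≋ r c)))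
        (λ eq → All.concat⁺ (All.tabulate⁺ λ r → All.tabulate⁺ λ c →
          trans (+-congˡ (value-negate _)) (trans (+-congʳ (trans (M≋ r c) (trans (eq r c) (sym (N≋ r c))))) (-‿inverseʳ _))))
        where
        equal : ∀ {u v} → u + ν -oneᶜ * v ≈ 0# → u ≈ v
        equal {u} {v} eq = trans (sym (+-identityʳ u)) (trans (+-congˡ (sym (-‿inverseˡ v)))
          (trans (sym (+-assoc u (- v) v)) (trans (+-congʳ (trans (+-congˡ (sym (value-negate v))) eq)) (+-identityˡ v))))

      Zero-++F : ∀ ts e → Zero x (decodeTerms (fun (ts ++F e) ρ)) ⇔ (Vanish ts × Zero x (decodeTerms (fun e ρ)))
      Zero-++F ts e = mk⇔
        (λ z → let p , q = All.++⁻ (List.map (instantiate ρ) ts) (≡.subst (Zero x) (decode-++F ρ ts e) z) in All.map⁻ p , q)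
        (λ (p , q) → ≡.subst (Zero x) (≡.sym (decode-++F ρ ts e)) (All.++⁺ (All.map⁺ p) q))

  module _ (x : ℕ → Carrier) where
    letterMatrix wordMatrix : ℕ → Matrix n
    letterMatrix l r c = x (letterVar l r c)
    wordMatrix   w r c = x (wordVar w r c)

    Specific : Symbol → Set ℓ
    Specific (const i) = letterMatrix (letterCode (const i ⁺)) ≋ λ r c → ν (fun (entryF r c) (i ∷ []))
    Specific (var i)   = All (λ f → evalℤ R f (λ (r , c) → letterMatrix (letterCode (var i ⁺)) r c) ≈ 0#) polynomials

    SymbolOK : Symbol → Set ℓ
    SymbolOK s =
      letterMatrix (letterCode (s ⁺)) ∙ letterMatrix (letterCode (s ⁻)) ≋ I ×
      letterMatrix (letterCode (s ⁻)) ∙ letterMatrix (letterCode (s ⁺)) ≋ I ×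
      Specific s

    WordOK : List Letter → Set ℓ
    WordOK []      = wordMatrix (wordCode []) ≋ I
    WordOK (l ∷ u) = wordMatrix (wordCode (l ∷ u)) ≋ letterMatrix (letterCode l) ∙ wordMatrix (wordCode u) ×
                     SymbolOK (symbolOf l) × WordOK u

    SystemOK : System → Set ℓ
    SystemOK []      = ⊤
    SystemOK (u ∷ S) = wordMatrix (wordCode u) ≋ I × WordOK u × SystemOK S

  private
    HYP : ∀ {k} → Fun k → Fun k → Fun k → AtomF k
    HYP w E₀ E = lit 5 ∷ w ∷ E₀ ∷ E ∷ []

    SYS : ∀ {k} → Fun k → Fun k → AtomF k
    SYS S E = lit 6 ∷ S ∷ E ∷ lit 0 ∷ []

  YES NO : ∀ {k} → Fun k → AtomF k
  YES S = lit 7 ∷ S ∷ lit 0 ∷ lit 0 ∷ []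
  NO  S = lit 8 ∷ S ∷ lit 0 ∷ lit 0 ∷ []

  module _ (sg : Sign) (kd : Kind) where
    private
      wF EF E′F : Fun 4
      wF  = arg 1F
      EF  = arg 2F
      E′F = arg 3F

      signedF : ℕ → Fun 4
      signedF q = lit q ⟪,⟫ lit (kindTag kd) ⟪,⟫ arg 0F

    specificF : Kind → List (TermF 4)
    specificF constant = letterF (signedF 0) ≋F λ r c → con (entryF r c $$ (arg 0F ∷ []))
    specificF unknown = List.map (λ f → evalℤF f (letterF (signedF 0))) polynomials

    inverseF : Sign → List (TermF 4)
    inverseF pos = letterF (signedF 0) ∙F letterF (signedF 1) ≋F identityF
    inverseF neg = letterF (signedF 1) ∙F letterF (signedF 0) ≋F identityF

    extendedF : Fun 4
    extendedF = signedF (signTag sg) ∷F wF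

    equationsF : List (TermF 4)
    equationsF = (wordF extendedF ≋F letterF (signedF (signTag sg)) ∙F wordF wF) ++
                 inverseF pos ++ inverseF neg ++ specificF kd

    letterClause : Clause
    letterClause = clause 4 (HYP extendedF EF (equationsF ++F E′F)) (HYP wF EF E′F ∷ [])

  groupProgram : Program
  groupProgram =
    clause 1 (HYP (lit 0) (arg 0F) ((wordF (lit 0) ≋F identityF) ++F arg 0F)) [] ∷
    letterClause pos constant ∷ letterClause pos unknown ∷
    letterClause neg constant ∷ letterClause neg unknown ∷
    clause 0 (SYS (lit 0) (lit 0)) [] ∷
    clause 4 (SYS (arg 0F ∷F arg 1F) ((wordF (arg 0F) ≋F identityF) ++F arg 3F))
             (SYS (arg 1F) (arg 2F) ∷ HYP (arg 0F) (arg 2F) (arg 3F) ∷ []) ∷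
    clause 4 (YES (arg 0F)) (SYS (arg 0F) (arg 1F) ∷ TRI (arg 2F) (arg 3F) ∷ SAT (arg 3F) (arg 1F) ∷ []) ∷
    clause 2 (NO (arg 0F)) (SYS (arg 0F) (arg 1F) ∷ EQ (arg 1F) 𝟏F 𝟎F ∷ []) ∷
    []

  program : Program
  program = termProgram ++ groupProgram

  GroupMeaning : Atom → Set (c ⊔ ℓ)
  GroupMeaning (5 ∷ w ∷ E₀ ∷ E ∷ []) = ∀ u → wordCode u ≡ w → ∀ x →
    Zero x (decodeTerms E) ⇔ (WordOK x u × Zero x (decodeTerms E₀))
  GroupMeaning (6 ∷ s ∷ E ∷ _ ∷ []) = ∀ S → systemCode S ≡ s → ∀ x →
    Zero x (decodeTerms E) ⇔ SystemOK x S
  GroupMeaning (7 ∷ s ∷ _ ∷ _ ∷ []) = ∀ S → systemCode S ≡ s → ∃[ x ] SystemOK x S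
  GroupMeaning (8 ∷ s ∷ _ ∷ _ ∷ []) = ∀ S → systemCode S ≡ s → ∀ x → ¬ SystemOK x S
  GroupMeaning _ = ⊤

  private
    module _ (sg : Sign) (kd : Kind) (x : ℕ → Carrier) (i w e e′ : ℕ) where
      private
        ρ : Vec ℕ 4
        ρ = i ∷ w ∷ e ∷ e′ ∷ []

        s : Symbol
        s = symbol kd i

        code-eq : ∀ q → ⟪ q , ⟪ kindTag kd , i ⟫ ⟫ ≡ ⟪ q , symbolCode s ⟫
        code-eq q = cong (λ s → ⟪ q , s ⟫) (≡.sym (symbolCode-symbol kd i))

        letter-values : ∀ q → values x ρ (letterF (lit q ⟪,⟫ lit (kindTag kd) ⟪,⟫ arg 0F)) ≋ letterMatrix x ⟪ q , symbolCode s ⟫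
        letter-values q r c = reflexive (cong (λ l → letterMatrix x l r c) (code-eq q))

        ∙-values : ∀ {M N M′ N′} → values x ρ M ≋ M′ → values x ρ N ≋ N′ → values x ρ (M ∙F N) ≋ M′ ∙ N′
        ∙-values {M} {N} p q r c = trans (values-∙F x ρ M N r c) (sum-cong-≋ λ k → *-cong (p r k) (q k c))

        specific-⇔ : ∀ kd′ → kd′ ≡ kd → Vanish x ρ (specificF sg kd kd′) ⇔ Specific x s
        specific-⇔ constant ≡.refl = ≋F-⇔ x ρ (letter-values 0) (λ _ _ → refl)
        specific-⇔ unknown ≡.refl = mk⇔
          (λ p → All.map (λ {f} eq → trans (sym (value-evalℤF x ρ f _)) eq) (All.map⁻ p))
          (λ p → All.map⁺ (All.map (λ {f} eq → trans (value-evalℤF x ρ f _) eq) p))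

        inverse-⇔ : ∀ q q′ → Vanish x ρ (letterF (lit q ⟪,⟫ lit (kindTag kd) ⟪,⟫ arg 0F) ∙F letterF (lit q′ ⟪,⟫ lit (kindTag kd) ⟪,⟫ arg 0F) ≋F identityF) ⇔
                    letterMatrix x ⟪ q , symbolCode s ⟫ ∙ letterMatrix x ⟪ q′ , symbolCode s ⟫ ≋ I
        inverse-⇔ q q′ = ≋F-⇔ x ρ (∙-values (letter-values q) (letter-values q′)) (values-identityF x ρ)

        l : Letter
        l = letter sg s

        l-code : ⟪ signTag sg , ⟪ kindTag kd , i ⟫ ⟫ ≡ letterCode l
        l-code = ≡.trans (code-eq (signTag sg)) (≡.sym (letterCode-letter sg s))

        product-⇔ : Vanish x ρ (wordF (extendedF sg kd) ≋F letterF (lit (signTag sg) ⟪,⟫ lit (kindTag kd) ⟪,⟫ arg 0F) ∙F wordF (arg 1F)) ⇔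
                    wordMatrix x (suc ⟪ letterCode l , w ⟫) ≋ letterMatrix x (letterCode l) ∙ wordMatrix x w
        product-⇔ = ≋F-⇔ x ρ
          (λ r c → reflexive (cong (λ l → wordMatrix x (suc ⟪ l , w ⟫) r c) l-code))
          (∙-values (λ r c → reflexive (cong (λ l → letterMatrix x l r c) l-code)) (λ _ _ → refl))

      equations-⇔ : ∀ u → wordCode u ≡ w → Vanish x ρ (equationsF sg kd) ⇔
        (wordMatrix x (wordCode (l ∷ u)) ≋ letterMatrix x (letterCode l) ∙ wordMatrix x (wordCode u) × SymbolOK x (symbolOf l))
      equations-⇔ u ≡.refl = mk⇔
        (λ p → let p₁ , p′ = All.++⁻ (wordF (extendedF sg kd) ≋F letterF _ ∙F wordF (arg 1F)) p
                   p₂ , p″ = All.++⁻ (inverseF sg kd pos) p′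
                   p₃ , p₄ = All.++⁻ (inverseF sg kd neg) p″
               in to product-⇔ p₁ , ≡.subst (SymbolOK x) (≡.sym (symbolOf-letter sg s))
                  (to (inverse-⇔ 0 1) p₂ , to (inverse-⇔ 1 0) p₃ , to (specific-⇔ kd ≡.refl) p₄))
        (λ (p₁ , ok) → let p₂ , p₃ , p₄ = ≡.subst (SymbolOK x) (symbolOf-letter sg s) ok in
          All.++⁺ (from product-⇔ p₁) (All.++⁺ (from (inverse-⇔ 0 1) p₂) (All.++⁺ (from (inverse-⇔ 1 0) p₃) (from (specific-⇔ kd ≡.refl) p₄))))

      letter-of-code : ∀ l′ → letterCode l′ ≡ ⟪ signTag sg , ⟪ kindTag kd , i ⟫ ⟫ → l′ ≡ l
      letter-of-code l′ eq = letterCode-injective l′ l (≡.trans eq l-code)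

    nil-⇔ : ∀ {k} x (ρ : Vec ℕ k) w → Vanish x ρ (wordF w ≋F identityF) ⇔ wordMatrix x (fun w ρ) ≋ I
    nil-⇔ x ρ w = ≋F-⇔ x ρ (λ _ _ → refl) (values-identityF x ρ)

    letter-sound : ∀ sg kd → Sound (Meaning GroupMeaning) (letterClause sg kd)
    letter-sound sg kd (i ∷ w ∷ e ∷ e′ ∷ []) (m ∷ []) []      ()
    letter-sound sg kd (i ∷ w ∷ e ∷ e′ ∷ []) (m ∷ []) (l ∷ u) eq x =
      ≡.subst (λ l → Zero x (decodeTerms (fun (equationsF sg kd ++F arg 3F) ρ)) ⇔ (WordOK x (l ∷ u) × Zero x (decodeTerms e)))
        (≡.sym (letter-of-code sg kd x i w e e′ l (proj₁ eqs)))
        (mk⇔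
          (λ z → let v , z′ = to split z
                     ok , z₀ = to (m u (proj₂ eqs) x) z′
                     p , s = to equations v
                 in (p , s , ok) , z₀)
          (λ ((p , s , ok) , z₀) → from split (from equations (p , s) , from (m u (proj₂ eqs) x) (ok , z₀))))
      where
      ρ = i ∷ w ∷ e ∷ e′ ∷ []
      eqs = ⟪⟫-injective (ℕ.suc-injective eq)
      split = Zero-++F x ρ (equationsF sg kd) (arg 3F)
      equations = equations-⇔ sg kd x i w e e′ u (proj₂ eqs)

  groupProgram-sound : All (Sound (Meaning GroupMeaning)) groupProgram
  groupProgram-sound =
    (λ { (e ∷ []) [] [] eq x → mk⇔
           (λ z → let v , z₀ = to (Zero-++F x (e ∷ []) (wordF (lit 0) ≋F identityF) (arg 0F)) z in to (nil-⇔ x (e ∷ []) (lit 0)) v , z₀)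
           (λ (v , z₀) → from (Zero-++F x (e ∷ []) (wordF (lit 0) ≋F identityF) (arg 0F)) (from (nil-⇔ x (e ∷ []) (lit 0)) v , z₀)) }) ∷
    letter-sound pos constant ∷ letter-sound pos unknown ∷
    letter-sound neg constant ∷ letter-sound neg unknown ∷
    (λ { [] [] [] eq x → mk⇔ (λ _ → tt) (λ _ → ≡.subst (Zero x) (≡.sym decode-[]) []) }) ∷
    (λ { ρ@(w ∷ s ∷ e ∷ e′ ∷ []) (m ∷ m′ ∷ []) (u ∷ S) eq x →
           let eq₁ , eq₂ = ⟪⟫-injective (ℕ.suc-injective eq)
               split = Zero-++F x ρ (wordF (arg 0F) ≋F identityF) (arg 3F)
               trivial = nil-⇔ x ρ (arg 0F)
           in mk⇔
             (λ z → let v , z′ = to split z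
                        ok , z₀ = to (m′ u eq₁ x) z′
                    in ≡.subst (λ w → wordMatrix x w ≋ I) (≡.sym eq₁) (to trivial v) , ok , to (m S eq₂ x) z₀)
             (λ (p , ok , ok′) → from split
               (from trivial (≡.subst (λ w → wordMatrix x w ≋ I) eq₁ p) , from (m′ u eq₁ x) (ok , from (m S eq₂ x) ok′))) }) ∷
    (λ { (s ∷ e ∷ N ∷ T ∷ []) (m ∷ lift tri ∷ lift ent ∷ []) S eq →
           let x , z = Triangular⇒Zero tri ent in x , to (m S eq x) z }) ∷
    (λ { (s ∷ e ∷ []) (m ∷ lift p ∷ []) S eq x ok →
           refutation⇒no-Zero (≡.subst₂ ((_∈ decodeTerms e) ⊢_~_) (decode-con oneᶜ) (decode-con zeroᶜ) p) x (from (m S eq x) ok) }) ∷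
    []

  program-sound : ∀ {a} → Derivable program a → Meaning GroupMeaning a
  program-sound = derivable-sound (Meaning GroupMeaning)
    (All.++⁺ (All.++⁺ (equational-sound GroupMeaning) (triangularity-sound GroupMeaning)) groupProgram-sound)

  private
    termProgram⊆ : ∀ {C} → C ∈ termProgram → C ∈ program
    termProgram⊆ = ∈-++⁺ˡ

    apply : ∀ i ρ → All (Derivable program) (instances (List.lookup groupProgram i) ρ) →
            Derivable program (funs (head (List.lookup groupProgram i)) ρ)
    apply = rule-at groupProgram (∈-++⁺ʳ termProgram)

    letterClause-derivable : ∀ sg kd ρ → All (Derivable program) (instances (letterClause sg kd) ρ) →
      Derivable program (funs (head (letterClause sg kd)) ρ)
    letterClause-derivable pos constant = apply (# 1)
    letterClause-derivable pos unknown  = apply (# 2)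
    letterClause-derivable neg constant = apply (# 3)
    letterClause-derivable neg unknown  = apply (# 4)

    HypDerivable : List Letter → List Term → Set
    HypDerivable u E₀ = ∃[ E ] Derivable program (5 ∷ wordCode u ∷ encodeTerms E₀ ∷ encodeTerms E ∷ [])

    letter-derivable : ∀ sg kd i u {E₀} → HypDerivable u E₀ → HypDerivable (letter sg (symbol kd i) ∷ u) E₀
    letter-derivable sg kd i u {E₀} (E , d) = _ , ≡.subst₂
      (λ l e → Derivable program (5 ∷ suc ⟪ l , wordCode u ⟫ ∷ encodeTerms E₀ ∷ e ∷ []))
      (≡.trans (cong (λ s → ⟪ signTag sg , s ⟫) (≡.sym (symbolCode-symbol kd i))) (≡.sym (letterCode-letter sg (symbol kd i))))
      (encode-++F ρ (equationsF sg kd) (arg 3F) ≡.refl)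
      (letterClause-derivable sg kd ρ (d ∷ []))
      where ρ = i ∷ wordCode u ∷ encodeTerms E₀ ∷ encodeTerms E ∷ []

    word-derivable : ∀ u E₀ → HypDerivable u E₀
    word-derivable [] E₀ = _ , ≡.subst (λ e → Derivable program (5 ∷ 0 ∷ encodeTerms E₀ ∷ e ∷ []))
      (encode-++F (encodeTerms E₀ ∷ []) (wordF (lit 0) ≋F identityF) (arg 0F) ≡.refl)
      (apply (# 0) (encodeTerms E₀ ∷ []) [])
    word-derivable ((const i ⁺) ∷ u) E₀ = letter-derivable pos constant i u (word-derivable u E₀)
    word-derivable ((var i ⁺) ∷ u)   E₀ = letter-derivable pos unknown i u (word-derivable u E₀)
    word-derivable ((const i ⁻) ∷ u) E₀ = letter-derivable neg constant i u (word-derivable u E₀)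
    word-derivable ((var i ⁻) ∷ u)   E₀ = letter-derivable neg unknown i u (word-derivable u E₀)

    system-derivable : ∀ S → ∃[ E ] Derivable program (6 ∷ systemCode S ∷ encodeTerms E ∷ 0 ∷ [])
    system-derivable [] = [] , apply (# 5) [] []
    system-derivable (u ∷ S) = _ ,
      ≡.subst (λ e → Derivable program (6 ∷ suc ⟪ wordCode u , systemCode S ⟫ ∷ e ∷ 0 ∷ []))
        (encode-++F ρ (wordF (arg 0F) ≋F identityF) (arg 3F) ≡.refl)
        (apply (# 6) ρ (proj₂ (system-derivable S) ∷ proj₂ (word-derivable u E₀) ∷ []))
      where
      E₀ E : List Term
      E₀ = proj₁ (system-derivable S)
      E  = proj₁ (word-derivable u E₀)
      ρ : Vec ℕ 4
      ρ = wordCode u ∷ systemCode S ∷ encodeTerms E₀ ∷ encodeTerms E ∷ []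

  module _ (em : ∀ a → ExcludedMiddle a) where
    open Completeness em using (refutation-or-triangular)

    Yes No : ℕ → Set
    Yes s = Derivable program (7 ∷ s ∷ 0 ∷ 0 ∷ [])
    No  s = Derivable program (8 ∷ s ∷ 0 ∷ 0 ∷ [])

    yes-or-no : ∀ S → Yes (systemCode S) ⊎ No (systemCode S)
    yes-or-no S = Sum.swap (Sum.map refute solve (refutation-or-triangular E))
      where
      E : List Term
      E = proj₁ (system-derivable S)

      refute : (_∈ E) ⊢ 𝟏 ~ 𝟎 → No (systemCode S)
      refute p = apply (# 8) (systemCode S ∷ encodeTerms E ∷ [])
        (proj₂ (system-derivable S) ∷ ⊢-derivable termProgram⊆ p ∷ [])

      solve : (∃[ N ] ∃[ T ] Triangular N T × Entails T E) → Yes (systemCode S)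
      solve (N , T , tri , ent) = apply (# 7) (systemCode S ∷ encodeTerms E ∷ N ∷ encodeTerms T ∷ [])
        (proj₂ (system-derivable S) ∷ Triangular-derivable termProgram⊆ tri ∷ Entails-derivable termProgram⊆ ent ∷ [])

    SystemOK-decidable : ∃[ p ] ∀ S → Answers p (encodeSystem S ∷ []) (∃[ x ] SystemOK x S)
    SystemOK-decidable = proj₁ decision , λ S →
      ≡.subst (λ s → Answers (proj₁ decision) (s ∷ []) (∃[ x ] SystemOK x S)) (systemCode-encode S) (answers S)
      where
      decision = Check.decide program (YES (arg 0F)) (NO (arg 0F))

      yes⇒ : ∀ S → Yes (systemCode S) → ∃[ x ] SystemOK x S
      yes⇒ S d = program-sound d S ≡.refl

      no⇒ : ∀ S → No (systemCode S) → ∀ x → ¬ SystemOK x S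
      no⇒ S d = program-sound d S ≡.refl

      answers : ∀ S → Answers (proj₁ decision) (systemCode S ∷ []) (∃[ x ] SystemOK x S)
      answers S =
        (λ (x , ok) → proj₁ answer (fromInj₁ (λ d → contradiction ok (no⇒ S d x)) (yes-or-no S))) ,
        (λ none → proj₂ answer (fromInj₂ (λ d → contradiction (yes⇒ S d) none) (yes-or-no S)))
        where
        answer = proj₂ decision (systemCode S) (λ d d′ → let x , ok = yes⇒ S d in no⇒ S d′ x ok)

Answers-⇔ : ∀ {k a b} {p : Rec k} {xs} {A : Set a} {B : Set b} → A ⇔ B → Answers p xs A → Answers p xs B
Answers-⇔ A⇔B (yes⇒ , no⇒) = (λ b → yes⇒ (from A⇔B b)) , (λ ¬b → no⇒ (λ a → ¬b (to A⇔B a)))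

module _ (em : ∀ a → ExcludedMiddle a) {c ℓ} (R : CommutativeRing c ℓ) (isField : IsField R)
         {p} {A : Pred (CommutativeRing.Carrier R) p} (isSubfield : IsSubfield R A)
         {ν : ℕ → CommutativeRing.Carrier R} (enumeration : IsComputableEnumeration R A ν) where
  open CommutativeRing R
  open IsSubfield isSubfield
  open IsComputableEnumeration enumeration

  private
    binaryF : ∀ {q} {Q : ℕ → ℕ → ℕ → Set q} →
      (∃[ f ] ∀ i j → ∃[ k ] f ⟨ i ∷ j ∷ [] ⟩↦ k × Q i j k) → Fun 2
    binaryF (f , total) = record
      { fun   = λ { (i ∷ j ∷ []) → proj₁ (total i j) }
      ; code  = f
      ; halts = λ { (i ∷ j ∷ []) → proj₁ (proj₂ (total i j)) }
      }

    indicator : ∀ {a} {P : Set a} → Dec P → ℕ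
    indicator (yes _) = 1
    indicator (no _)  = 0

    equalF : Fun 2
    equalF = record
      { fun   = λ { (i ∷ j ∷ []) → indicator (em ℓ {ν i ≈ ν j}) }
      ; code  = proj₁ computable-≈
      ; halts = λ { (i ∷ j ∷ []) → run i j (em ℓ) }
      }
      where
      run : ∀ i j (d : Dec (ν i ≈ ν j)) → proj₁ computable-≈ ⟨ i ∷ j ∷ [] ⟩↦ indicator d
      run i j (yes eq) = proj₁ (proj₂ computable-≈ i j) eq
      run i j (no ¬eq) = proj₂ (proj₂ computable-≈ i j) ¬eq

    choose : ℕ → ℕ → ℕ → ℕ
    choose b i j = b ℕ.* j ℕ.+ (1 ℕ.∸ b) ℕ.* i

    choose-yes : ∀ i j → choose 1 i j ≡ j
    choose-yes i j = ≡.trans (ℕ.+-identityʳ _) (ℕ.+-identityʳ j)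

    choose-no : ∀ i j → choose 0 i j ≡ i
    choose-no i j = ℕ.+-identityʳ i

  coefficients : Coefficients R
  coefficients = record
    { nontrivial = proj₁ isField
    ; ν = ν
    ; zeroᶜ = proj₁ (surjective 0∈) ; oneᶜ = proj₁ (surjective 1∈) ; -oneᶜ = proj₁ (surjective (-∈ 1∈))
    ; addᶜ = λ i j → proj₁ (proj₂ computable-+ i j) ; mulᶜ = λ i j → proj₁ (proj₂ computable-* i j)
    ; ν-zero = proj₂ (surjective 0∈) ; ν-one = proj₂ (surjective 1∈) ; ν--one = proj₂ (surjective (-∈ 1∈))
    ; ν-add = λ i j → proj₂ (proj₂ (proj₂ computable-+ i j)) ; ν-mul = λ i j → proj₂ (proj₂ (proj₂ computable-* i j))
    ; ν-inverse = λ i νi≉0 →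
        let y , νi*y≈1 = proj₂ isField (ν i) νi≉0
            j , νj≈y = surjective (⁻¹∈ (member i) νi*y≈1)
        in j , trans (*-congˡ νj≈y) νi*y≈1
    }

  computable : Computableᶜ coefficients
  computable = record
    { addᶜF = binaryF computable-+ ; mulᶜF = binaryF computable-*
    ; selectF = equalF *F arg 1F +F (lit 1 ∸F equalF) *F arg 0F
    ; addᶜF-correct = λ i j → ≡.refl ; mulᶜF-correct = λ i j → ≡.refl
    ; select-sound = λ i j → sound i j (em ℓ)
    ; select-complete = λ i j → complete i j (em ℓ)
    }
    where
    sound : ∀ i j (d : Dec (ν i ≈ ν j)) → ν i ≈ ν (choose (indicator d) i j)
    sound i j (yes eq) = trans eq (reflexive (cong ν (≡.sym (choose-yes i j))))
    sound i j (no _)   = reflexive (cong ν (≡.sym (choose-no i j)))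
    complete : ∀ i j (d : Dec (ν i ≈ ν j)) → ν i ≈ ν j → choose (indicator d) i j ≡ j
    complete i j (yes _)  eq = choose-yes i j
    complete i j (no ¬eq) eq = contradiction eq ¬eq

module _ (em : ∀ a → ExcludedMiddle a) {c ℓ} (R : CommutativeRing c ℓ) (isField : IsField R)
         {X : Set} (coordinates : List X) (all : ∀ x → x ∈ coordinates) where
  private
    module R = CommutativeRing R
    Functions : CommutativeRing c (c ⊔ ℓ)
    Functions = Pointwise.commutativeRing (X → R.Carrier) R
  open Subrings Functions using (Subset; IsSubring; Comb; nil; cons; Adjoin; Adjoin-subring; Adjoin-base; Adjoin-generators; module IsSubring)
  open Noetherian em Functions using (Noeth; Noeth-field; Noeth-Adjoin; generated)

  private
    Constant : Subset
    Constant φ = ∃[ r ] ∀ ρ → φ ρ R.≈ r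

    Constant-subring : IsSubring Constant
    Constant-subring = record
      { resp = λ eq (r , p) → r , λ ρ → R.trans (R.sym (eq ρ)) (p ρ)
      ; 0∈   = _ , λ _ → R.refl
      ; 1∈   = _ , λ _ → R.refl
      ; +∈   = λ (r , p) (s , q) → _ , λ ρ → R.+-cong (p ρ) (q ρ)
      ; *∈   = λ (r , p) (s , q) → _ , λ ρ → R.*-cong (p ρ) (q ρ)
      ; -1∈  = _ , λ _ → R.refl
      }

    projections : List (( X → R.Carrier) → R.Carrier)
    projections = List.map (λ x ρ → ρ x) coordinates

    Polynomial : Subset
    Polynomial = Adjoin Constant projections

    noetherian : Noeth Polynomial []
    noetherian = Noeth-Adjoin Constant-subring projections (Noeth-field Constant-subring λ (r , p) φ≉0 →
      let s , rs≈1 = proj₂ isField r (λ r≈0 → φ≉0 (λ ρ → R.trans (p ρ) r≈0))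
      in (λ _ → s) , (s , λ _ → R.refl) , λ ρ → R.trans (R.*-congʳ (p ρ)) rs≈1)

    evalℤ-Polynomial : ∀ f → Polynomial (evalℤ R f)
    evalℤ-Polynomial = go
      where
      open IsSubring (Adjoin-subring Constant-subring projections)
      go : ∀ f → Polynomial (evalℤ R f)
      go (var x) = All.lookup (All.map⁻ (Adjoin-generators Constant-subring projections)) (all x)
      go 𝟘       = 0∈
      go 𝟙       = 1∈
      go (⊖ f)   = resp (λ ρ → -1*x≈-x (evalℤ R f ρ)) (*∈ -1∈ (go f))
        where open import Algebra.Properties.Ring R.ring using (-1*x≈-x)
      go (f ⊕ g) = +∈ (go f) (go g)
      go (f ⊗ g) = *∈ (go f) (go g)

  finite-zero-set : ∀ {v} (V : Pred ℤ[ X ] v) → ∃[ F ] All V F ×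
    (∀ ρ → All (λ f → evalℤ R f ρ R.≈ R.0#) F → ∀ f → V f → evalℤ R f ρ R.≈ R.0#)
  finite-zero-set V with generated {I = λ φ → ∃[ f ] V f × (∀ ρ → φ ρ R.≈ evalℤ R f ρ)} noetherian
  ... | F , F⊆ , gen = polynomials F⊆ , polynomials∈ F⊆ , λ ρ zeros f f∈ →
    vanish ρ (zero-at ρ F⊆ zeros) (gen (evalℤ R f) (evalℤ-Polynomial f) (f , f∈ , λ _ → R.refl))
    where
    Represented = λ (φ : (X → R.Carrier) → R.Carrier) → ∃[ f ] V f × (∀ ρ → φ ρ R.≈ evalℤ R f ρ)
    polynomials : ∀ {F} → All Represented F → List ℤ[ X ]
    polynomials []             = []
    polynomials ((f , _) ∷ ps) = f ∷ polynomials ps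
    polynomials∈ : ∀ {F} (ps : All Represented F) → All V (polynomials ps)
    polynomials∈ []                  = []
    polynomials∈ ((f , f∈ , _) ∷ ps) = f∈ ∷ polynomials∈ ps
    zero-at : ∀ ρ {F} (ps : All Represented F) → All (λ f → evalℤ R f ρ R.≈ R.0#) (polynomials ps) → All (λ φ → φ ρ R.≈ R.0#) F
    zero-at ρ []                  []       = []
    zero-at ρ ((f , _ , eq) ∷ ps) (z ∷ zs) = R.trans (eq ρ) z ∷ zero-at ρ ps zs
    vanish : ∀ ρ {F φ} → All (λ φ → φ ρ R.≈ R.0#) F → Comb Polynomial F φ → φ ρ R.≈ R.0#
    vanish ρ []       (nil eq)              = eq ρ
    vanish ρ (z ∷ zs) (cons {a = a} _ p eq) = R.trans (eq ρ)
      (R.trans (R.+-cong (R.trans (R.*-congˡ z) (R.zeroʳ (a ρ))) (vanish ρ zs p)) (R.+-identityʳ R.0#))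

module GroupSolutions (em : ∀ a → ExcludedMiddle a) {c ℓ} (R : CommutativeRing c ℓ) (closed : IsAlgebraicallyClosedField R)
  (coefficients : Coefficients R) (computable : Computableᶜ coefficients)
  (n : ℕ) (entryF : Fin n → Fin n → Fun 1) (polynomials : List ℤ[ Fin n × Fin n ])
  (μ : ℕ → Matrices.Invertible R n) {g} (G : Pred (Matrices.Invertible R n) g) where

  open CommutativeRing R
  open Matrices R
  open SemiringSum semiring using (sum-cong-≋)
  open Coefficients coefficients using (ν)
  open GroupProgram R closed coefficients computable n entryF polynomials
  open Diophantine (GL n) μ
  private
    module GL = Group (GL n)

  module _ (entries : ∀ i r s → ν (fun (entryF r s) (i ∷ [])) ≈ mat (μ i) r s)
           (μ∈G : ∀ i → G (μ i))
           (G⇒ : ∀ {h} → G h → All (λ f → evalℤ R f (λ (r , s) → mat h r s) ≈ 0#) polynomials)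
           (⇒G : ∀ {h} → All (λ f → evalℤ R f (λ (r , s) → mat h r s) ≈ 0#) polynomials → G h) where

    private
      ≋-trans : ∀ {L M N : Matrix n} → L ≋ M → M ≋ N → L ≋ N
      ≋-trans p q r s = trans (p r s) (q r s)

      ≋-sym : ∀ {M N : Matrix n} → M ≋ N → N ≋ M
      ≋-sym p r s = sym (p r s)

      ∙-cong : ∀ {M M′ N N′ : Matrix n} → M ≋ M′ → N ≋ N′ → M ∙ N ≋ M′ ∙ N′
      ∙-cong p q r s = sum-cong-≋ (λ k → *-cong (p r k) (q k s))

      evalℤ-cong : ∀ {X : Set} (f : ℤ[ X ]) {ρ ρ′ : X → Carrier} → (∀ x → ρ x ≈ ρ′ x) → evalℤ R f ρ ≈ evalℤ R f ρ′
      evalℤ-cong (var x) eq = eq x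
      evalℤ-cong 𝟘       eq = refl
      evalℤ-cong 𝟙       eq = refl
      evalℤ-cong (⊖ f)   eq = -‿cong (evalℤ-cong f eq)
      evalℤ-cong (f ⊕ g) eq = +-cong (evalℤ-cong f eq) (evalℤ-cong g eq)
      evalℤ-cong (f ⊗ g) eq = *-cong (evalℤ-cong f eq) (evalℤ-cong g eq)

    module FromGroup (y : ℕ → Invertible n) (y∈G : ∀ i → G (y i)) where

      data Index : Set where
        letterIndex : Letter → Fin n → Fin n → Index
        wordIndex   : List Letter → Fin n → Fin n → Index

      indexCode : Index → ℕ
      indexCode (letterIndex l r s) = letterVar (letterCode l) r s
      indexCode (wordIndex u r s)   = wordVar (wordCode u) r s

      entry : Index → Carrier
      entry (letterIndex l r s) = mat (evalLetter y l) r s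
      entry (wordIndex u r s)   = mat (evalWord y u) r s

      indexCode-injective : ∀ i j → indexCode i ≡ indexCode j → i ≡ j
      indexCode-injective (letterIndex l r s) (letterIndex l′ r′ s′) eq =
        let _ , eq₁ = ⟪⟫-injective eq ; eq-l , eq₂ = ⟪⟫-injective eq₁ ; eq-r , eq-s = ⟪⟫-injective eq₂
        in triple (letterCode-injective l l′ eq-l) (toℕ-injective eq-r) (toℕ-injective eq-s)
        where
        triple : l ≡ l′ → r ≡ r′ → s ≡ s′ → letterIndex l r s ≡ letterIndex l′ r′ s′
        triple ≡.refl ≡.refl ≡.refl = ≡.refl
      indexCode-injective (wordIndex u r s) (wordIndex u′ r′ s′) eq =
        let _ , eq₁ = ⟪⟫-injective eq ; eq-u , eq₂ = ⟪⟫-injective eq₁ ; eq-r , eq-s = ⟪⟫-injective eq₂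
        in triple (wordCode-injective u u′ eq-u) (toℕ-injective eq-r) (toℕ-injective eq-s)
        where
        triple : u ≡ u′ → r ≡ r′ → s ≡ s′ → wordIndex u r s ≡ wordIndex u′ r′ s′
        triple ≡.refl ≡.refl ≡.refl = ≡.refl
      indexCode-injective (letterIndex _ _ _) (wordIndex _ _ _) eq = contradiction (proj₁ (⟪⟫-injective eq)) λ ()
      indexCode-injective (wordIndex _ _ _) (letterIndex _ _ _) eq = contradiction (proj₁ (⟪⟫-injective eq)) λ ()

      valueAt : ∀ v → Dec (∃[ i ] indexCode i ≡ v) → Carrier
      valueAt v (yes (i , _)) = entry i
      valueAt v (no _)        = 0#

      x : ℕ → Carrier
      x v = valueAt v (em 0ℓ)

      x-entry : ∀ i → x (indexCode i) ≡ entry i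
      x-entry i = at (em 0ℓ)
        where
        at : ∀ d → valueAt (indexCode i) d ≡ entry i
        at (yes (j , eq)) = cong entry (indexCode-injective j i eq)
        at (no none)      = contradiction (i , ≡.refl) none

      letters : ∀ l → letterMatrix x (letterCode l) ≋ mat (evalLetter y l)
      letters l r s = reflexive (x-entry (letterIndex l r s))

      words : ∀ u → wordMatrix x (wordCode u) ≋ mat (evalWord y u)
      words u r s = reflexive (x-entry (wordIndex u r s))

      specific : ∀ s → Specific x s
      specific (const i) r s = trans (letters (const i ⁺) r s) (sym (entries i r s))
      specific (var i) = All.map (λ {f} eq → trans (evalℤ-cong f (λ (r , s) → letters (var i ⁺) r s)) eq) (G⇒ (y∈G i))

      symbolOK : ∀ s → SymbolOK x s
      symbolOK s =
        ≋-trans (∙-cong (letters (s ⁺)) (letters (s ⁻))) (invʳ (evalSymbol y s)) ,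
        ≋-trans (∙-cong (letters (s ⁻)) (letters (s ⁺))) (invˡ (evalSymbol y s)) ,
        specific s

      wordOK : ∀ u → WordOK x u
      wordOK []      = words []
      wordOK (l ∷ u) = ≋-trans (words (l ∷ u)) (≋-sym (∙-cong (letters l) (words u))) , symbolOK (symbolOf l) , wordOK u

      systemOK : ∀ S → All (λ w → evalWord y w GL.≈ GL.ε) S → SystemOK x S
      systemOK []      []         = tt
      systemOK (u ∷ S) (eq ∷ eqs) = ≋-trans (words u) eq , wordOK u , systemOK S eqs

    module ToGroup (x : ℕ → Carrier) where
      L : Letter → Matrix n
      L l = letterMatrix x (letterCode l)

      invertible : ∀ s → SymbolOK x s → Invertible n
      invertible s (invʳ , invˡ , _) = record { mat = L (s ⁺) ; inv = L (s ⁻) ; invˡ = invˡ ; invʳ = invʳ }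

      -- Variables without meaningful values do not occur in the system.
      solution : ∀ i → Dec (SymbolOK x (var i)) → Invertible n
      solution i (yes ok) = invertible (var i) ok
      solution i (no _)   = μ 0

      y : ℕ → Invertible n
      y i = solution i (em ℓ)

      y∈G : ∀ i → G (y i)
      y∈G i = at (em ℓ)
        where
        at : ∀ d → G (solution i d)
        at (yes ok) = ⇒G (proj₂ (proj₂ ok))
        at (no _)   = μ∈G 0

      symbols : ∀ s (ok : SymbolOK x s) → evalSymbol y s GL.≈ invertible s ok
      symbols (const i) ok r s = trans (sym (entries i r s)) (sym (proj₂ (proj₂ ok) r s))
      symbols (var i) ok = at (em ℓ)
        where
        at : ∀ d → solution i d GL.≈ invertible (var i) ok
        at (yes _) r s = refl
        at (no ¬ok)    = contradiction ok ¬ok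

      letters : ∀ l → SymbolOK x (symbolOf l) → mat (evalLetter y l) ≋ L l
      letters (s ⁺) ok = symbols s ok
      letters (s ⁻) ok = GL.⁻¹-cong {evalSymbol y s} {invertible s ok} (symbols s ok)

      words : ∀ u → WordOK x u → mat (evalWord y u) ≋ wordMatrix x (wordCode u)
      words []      eq            = ≋-sym eq
      words (l ∷ u) (eq , ok , w) = ≋-trans (∙-cong (letters l ok) (words u w)) (≋-sym eq)

      solves : ∀ S → SystemOK x S → All (λ w → evalWord y w GL.≈ GL.ε) S
      solves []      _            = []
      solves (u ∷ S) (eq , w , s) = ≋-trans (words u w) eq ∷ solves S s

    SystemOK-⇔ : ∀ S → (∃[ x ] SystemOK x S) ⇔ Solvable G S
    SystemOK-⇔ S = mk⇔
      (λ (x , ok) → let open ToGroup x in y , y∈G , solves S ok)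
      (λ (y , y∈G , eqs) → let open FromGroup y y∈G in x , systemOK S eqs)

    decidable : DecidableIn G
    decidable = let p , answers = SystemOK-decidable em in p , λ S → Answers-⇔ (SystemOK-⇔ S) (answers S)

mainTheorem7 : (∀ a → ExcludedMiddle a) →
    (Φ : RootSystem) → RootSystem.Indecomposable Φ → 1 < RootSystem.rank Φ →
    (L : LieAlgebra) → Semisimple L → (B : ChevalleyBasis L Φ) →
    ∀ {n} (π : Representation L n) → Faithful L π →
    (P : Matrices.Invertible ℂ-commutativeRing n) → Admissible B π P →
    ∀ {c ℓ p} (R : CommutativeRing c ℓ) → IsAlgebraicallyClosedField R →
    (A : Pred (CommutativeRing.Carrier R) p) → IsComputableSubfield R A →
    (μ : ℕ → Matrices.Invertible R n) →
    IsProperEnumeration R A (ChevalleyGroupOver B π P R A) μ →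
    Diophantine.DecidableIn (Matrices.GL R n) μ (ChevalleyGroup B π P R)
mainTheorem7 em Φ _ _ L _ B {n} π _ P _ R closed A (isSubfield , _) μ proper =
  GroupSolutions.decidable em R closed
    (coefficients em R (proj₁ closed) isSubfield ν-computable) (computable em R (proj₁ closed) isSubfield ν-computable)
    n entryF polynomials μ (ChevalleyGroup B π P R)
    (λ i r s → proj₂ (proj₂ (proj₂ (computable-entries r s) i)))
    (λ i → proj₁ (member i))
    (λ h∈G → All.map {P = Vanishing B π P} (λ {f} f∈ → h∈G f (λ {M} → f∈ {M})) (proj₁ (proj₂ finite)))
    (λ zeros f f∈ → proj₂ (proj₂ finite) _ zeros f (λ {M} → f∈ {M}))
  where
  open IsProperEnumeration proper
  finite = finite-zero-set em R (proj₁ closed) (cartesianProduct (allFin n) (allFin n))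
    (λ (r , s) → ∈-cartesianProduct⁺ (∈-allFin r) (∈-allFin s)) (Vanishing B π P)
  polynomials = proj₁ finite
  entryF : Fin n → Fin n → Fun 1
  entryF r s = record
    { fun   = λ { (i ∷ []) → proj₁ (proj₂ (computable-entries r s) i) }
    ; code  = proj₁ (computable-entries r s)
    ; halts = λ { (i ∷ []) → proj₁ (proj₂ (proj₂ (computable-entries r s) i)) }
    }
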